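{- There exists a deterministic online bipartite edge-coloring algorithm (under one-sided node arrivals, with known maximum degree $\Delta$) whose competitive ratio is less than $2$ for bipartite graphs with sufficiently large maximum degree $\Delta=\Omega(\log n)$, and whose competitive ratio is $\frac{e}{e-1}+o(1)$ for $\Delta=\omega(\log n)$.
   Context: Online bipartite edge coloring under one-sided node arrivals: the input is a bipartite graph with $n$ offline nodes known up front and $n$ online nodes $v_1,\dots,v_n$; at time $t$ the node $v_t$ is revealed with all its edges to offline nodes, and the algorithm must immediately and irrevocably color these edges so that no two edges sharing an endpoint get the same color. The maximum degree $\Delta$ is known in advance. A deterministic algorithm is $\alpha$-competitive if on every input of maximum degree $\Delta$ it uses at most $\alpha\Delta$ colors. Asymptotics are as $n\to\infty$. -}

module Defs where

open import Data.Nat as ℕ using (ℕ; zero; suc; _!)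
open import Data.Nat.Properties using (_!≢0)
open import Data.Integer using (+_)
open import Data.Rational as ℚ using (ℚ; _/_; 1ℚ; 0ℚ)
open import Data.Fin using (Fin; toℕ)
open import Data.Fin.Subset using (Subset; _∈_; ∣_∣)
open import Data.Vec using (Vec; lookup; tabulate; toList)
open import Data.List as List using (List)
open import Data.Product using (Σ; _×_; ∃)
open import Data.Sum using (_⊎_)
open import Relation.Binary.PropositionalEquality using (_≡_; _≢_)

-- Input model.
-- Offline nodes: Fin n.  Online nodes v_1..v_n: also indexed by Fin n
-- (arrival order = index order).  An input is the list of neighbourhoods
-- of the online nodes, in arrival order: ins[t] ⊆ offline nodes.

Input : ℕ → Set
Input n = Vec (Subset n) n

onDeg : ∀ {n} → Input n → Fin n → ℕ
onDeg ins t = ∣ lookup ins t ∣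

offDeg : ∀ {n} → Input n → Fin n → ℕ
offDeg ins u = ∣ tabulate (λ t → lookup (lookup ins t) u) ∣

MaxDegree : ∀ {n} → Input n → ℕ → Set
MaxDegree {n} ins Δ =
  (∀ t → onDeg ins t ℕ.≤ Δ) × (∀ u → offDeg ins u ℕ.≤ Δ) ×
  ((∃ λ t → onDeg ins t ≡ Δ) ⊎ (∃ λ u → offDeg ins u ≡ Δ))

-- Deterministic online algorithms.
-- Given n and Δ (known in advance), the neighbourhoods of the previously
-- arrived online nodes (oldest first) and the neighbourhood of the newly
-- arrived node, it returns a colour (a natural number) for each edge
-- (v_t , u), i.e. for each u in the new neighbourhood (values at non-
-- neighbours are irrelevant).  Since the algorithm is deterministic, its
-- own past colourings are a function of this history, so this is fully
-- general.  Decisions are irrevocable by construction.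

OnlineAlg : Set
OnlineAlg = (n Δ : ℕ) → List (Subset n) → Subset n → Fin n → ℕ

history : ∀ {n} → Input n → Fin n → List (Subset n)
history ins t = List.take (toℕ t) (toList ins)

colour : OnlineAlg → (n Δ : ℕ) → Input n → Fin n → Fin n → ℕ
colour alg n Δ ins t u = alg n Δ (history ins t) (lookup ins t) u

Proper : ∀ {n} → Input n → (Fin n → Fin n → ℕ) → Set
Proper {n} ins c =
  (∀ (t : Fin n) (u u' : Fin n) → u ≢ u' → u ∈ lookup ins t → u' ∈ lookup ins t →
     c t u ≢ c t u') ×
  (∀ (u : Fin n) (t t' : Fin n) → t ≢ t' → u ∈ lookup ins t → u ∈ lookup ins t' →
     c t u ≢ c t' u)

UsesAtMost : ∀ {n} → Input n → (Fin n → Fin n → ℕ) → ℕ → Set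
UsesAtMost {n} ins c K = ∀ (t u : Fin n) → u ∈ lookup ins t → c t u ℕ.< K

Guarantee : OnlineAlg → (n Δ K : ℕ) → Set
Guarantee alg n Δ K = ∀ (ins : Input n) → MaxDegree ins Δ →
  Proper ins (colour alg n Δ ins) × UsesAtMost ins (colour alg n Δ ins) K

toℚ : ℕ → ℚ
toℚ n = (+ n) / 1

eApprox : ℕ → ℚ
eApprox zero = 1ℚ
eApprox (suc N) = eApprox N ℚ.+ ((+ 1) / (suc N !)) {{suc N !≢0}}

-- K ≤ (e/(e-1) + ε)·Δ, for Δ ≥ 1 equivalently (K - εΔ)(e - 1) ≤ e·Δ.
-- Since e_N ≥ 1 and x ↦ r(x-1) - xΔ is monotone in x for the relevant
-- sign, and e = sup_N e_N, this is equivalent to: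
--   ∀ N, (K - εΔ)(e_N - 1) ≤ e_N·Δ
WithinEBound : ℕ → ℕ → ℚ → Set
WithinEBound K Δ ε = ∀ (N : ℕ) →
  (toℚ K ℚ.- ε ℚ.* toℚ Δ) ℚ.* (eApprox N ℚ.- 1ℚ) ℚ.≤ eApprox N ℚ.* toℚ Δ

{-# OPTIONS --safe #-}
-- The algorithm derandomises the following process by conditional expectations. Let D bound the degrees and
-- take a palette of (1 + 1/Z) D fresh colours. Every offline node u hides a uniformly random order of the palette.
-- When an online node arrives, each neighbour u draws its next colour, together with a random priority in
-- {1, …, Z}; for each colour drawn, at most the neighbour of best priority gets it, and drawn colours are never
-- drawn again by the same node. Whatever the adversary does, the unused parts of any two palettes keep
-- intersecting about as much as independent sets would (the normalised intersection size is a martingale), so by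
-- convexity a neighbour loses with probability at most 1 − avg_m (1 − 1/Z)^m ≈ (1 − 1/Z)^Z ≤ 1/e. Azuma's inequality
-- bounds the losses at every node by (1/e + O(1/Z)) D. The lost edges form a graph to which the process is applied
-- again with new colours, so that about D (1 + 1/e + 1/e² + …) = D e / (e − 1) colours are used in total; once the
-- degree is O(log n), greedy colouring finishes. All tail bounds use powers x ↦ x ^ k with rational x in place of
-- exponentials, and a potential, the sum over all bad events of bounds on their probabilities, stays below 1.
module Submission where

open import Defs

-- Burning the colour of a loser too keeps the dynamics simple: each removed colour is uniform in
-- the palette of its node and independent of the other draws, whoever wins, and this makes overlaps
-- martingales. Random priorities are needed because losses must be small at every offline node and
-- not only on average: under a fixed order the last of D neighbours would lose with probability
-- about 1 - 1/e. The surplus of about D / Z colours keeps every palette at size at least D / Z, so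
-- one removal moves an overlap by O(Z² / D) only. The exponent k is proportional to D: small enough
-- against the step size for a quadratic Taylor bound, yet each unit of k gains a factor that
-- depends on Z alone; hence degrees of order log n beat the roughly n² bad events. The tail of the
-- losses at an online node matters only at its own arrival: it is added to the potential there and
-- dropped afterwards, at the price of one more unit of budget. Finally, a single algorithm has to
-- serve all ε, so the accuracy 1 / Z is read off from n and Δ.

module EdgeColouring where

  open import Algebra using (CommutativeRing; IsCommutativeRing)
  open import Data.Bool as 𝔹 using (Bool; true; false; _∧_; not; if_then_else_)
  import Data.Bool.Properties as 𝔹P
  open import Data.Empty using (⊥; ⊥-elim)
  open import Data.Fin as Fin using (Fin; zero; suc; toℕ)
  open import Data.Fin.Properties as FinP using (any?)
  open import Data.Fin.Subset as Subset using (Subset)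
  import Data.Integer as ℤ
  import Data.Integer.Properties as ℤP
  open import Data.List as List using (List; []; _∷_; _++_; length; map; take; reverse)
  open import Data.List.Membership.DecPropositional as DecMem using ()
  open import Data.List.Membership.Propositional using (_∈_; _∉_)
  open import Data.List.Membership.Propositional.Properties using (∈-++⁺ˡ; ∈-++⁺ʳ)
  import Data.List.Properties as ListP
  open import Data.List.Relation.Unary.All as All using (All; []; _∷_)
  import Data.List.Relation.Unary.All.Properties as AllP
  open import Data.List.Relation.Unary.AllPairs as AllPairs using (AllPairs; []; _∷_)
  open import Data.List.Relation.Unary.Any using (here; there; index)
  open import Data.List.Relation.Unary.Any.Properties using (lookup-index)
  open import Data.Maybe using (Maybe; just; nothing)
  open import Data.Maybe.Properties using (just-injective)
  open import Data.Nat as ℕ using (ℕ; zero; suc)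
  open import Data.Nat.Coprimality using (1-coprimeTo; sym)
  open import Data.Nat.Logarithm using (⌊log₂_⌋; ⌊log₂⌋-mono-≤; ⌊log₂[2^n]⌋≡n)
  import Data.Nat.Properties as ℕP
  import Data.Nat.Tactic.RingSolver as NatSolver
  open import Data.Product using (Σ; _×_; _,_; proj₁; proj₂)
  open import Data.Rational as ℚ using (ℚ; 0ℚ; 1ℚ; mkℚ)
  import Data.Rational.Properties as ℚP
  import Data.Rational.Unnormalised as ℚᵘ
  import Data.Rational.Unnormalised.Properties as ℚᵘP
  open import Data.Sum using (inj₁; inj₂)
  open import Data.Unit using (⊤; tt)
  open import Data.Vec using (Vec; []; _∷_; lookup; _[_]≔_; toList; tabulate)
  import Data.Vec.Properties as VecP
  open VecP using (lookup∘updateAt′)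
  open import Function using (_∘_)
  open import Level using (0ℓ)
  open import Relation.Binary.Definitions using (_Respects₂_; tri<; tri≈; tri>)
  open import Relation.Binary.PropositionalEquality using (_≡_; _≢_; refl; trans; cong; cong₂; subst; subst₂)
    renaming (sym to ≡-sym)
  open import Relation.Binary.Structures using (IsTotalOrder)
  open import Relation.Nullary using (¬_; Dec; yes; no)
  open import Relation.Nullary.Decidable using (⌊_⌋; map′; _×-dec_)
  open import Tactic.RingSolver using (solve-∀)
  open import Tactic.RingSolver.Core.AlmostCommutativeRing using (AlmostCommutativeRing; fromCommutativeRing)

  -- Ordered-field arithmetic on the rationals

  ring : AlmostCommutativeRing 0ℓ 0ℓ
  ring = fromCommutativeRing ℚP.+-*-commutativeRing is0
    where
    is0 : ∀ x → Maybe (0ℚ ≡ x)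
    is0 x with 0ℚ ℚ.≟ x
    ... | yes p = just p
    ... | no _ = nothing

  infixl 6 _+_ _-_
  infixl 7 _*_
  infix 8 -_
  infix 4 _≤_ _<_

  -- The field operations are opaque because the pattern-matching definitions on ℚ block unification.
  opaque
    _+_ _*_ _-_ : ℚ → ℚ → ℚ
    _+_ = ℚ._+_
    _*_ = ℚ._*_
    _-_ = ℚ._-_

    -_ : ℚ → ℚ
    -_ = ℚ.-_

    _≤_ _<_ : ℚ → ℚ → Set
    _≤_ = ℚ._≤_
    _<_ = ℚ._<_

  opaque
    unfolding _+_

    +-*-isCommutativeRing : IsCommutativeRing _≡_ _+_ _*_ -_ 0ℚ 1ℚ
    +-*-isCommutativeRing = ℚP.+-*-isCommutativeRing

    ≤-isTotalOrder : IsTotalOrder _≡_ _≤_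
    ≤-isTotalOrder = ℚP.≤-isTotalOrder

    <⇒≤ : ∀ {a b} → a < b → a ≤ b
    <⇒≤ = ℚP.<⇒≤

    ≰⇒> : ∀ {a b} → ¬ a ≤ b → b < a
    ≰⇒> = ℚP.≰⇒>

    _≤?_ : ∀ a b → Dec (a ≤ b)
    _≤?_ = ℚ._≤?_

    <-≤-trans : ∀ {a b c} → a < b → b ≤ c → a < c
    <-≤-trans = ℚP.<-≤-trans

    ≤-<-trans : ∀ {a b c} → a ≤ b → b < c → a < c
    ≤-<-trans = ℚP.≤-<-trans

    <-irrefl : ∀ {a} → ¬ a < a
    <-irrefl = ℚP.<-irrefl refl

    ≤-of-diff : ∀ {a b e} → b - a ≡ e → 0ℚ ≤ e → a ≤ b
    ≤-of-diff {a} {b} refl h = subst₂ ℚ._≤_ (ℚP.+-identityˡ a) (lem a b) (ℚP.+-monoˡ-≤ a h)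
      where
      lem : ∀ a b → b - a + a ≡ b
      lem = solve-∀ ring

    <-of-diff : ∀ {a b e} → b - a ≡ e → 0ℚ < e → a < b
    <-of-diff {a} {b} refl h = subst₂ ℚ._<_ (ℚP.+-identityˡ a) (lem a b) (ℚP.+-monoˡ-< a h)
      where
      lem : ∀ a b → b - a + a ≡ b
      lem = solve-∀ ring

    diff≥0 : ∀ {a b} → a ≤ b → 0ℚ ≤ b - a
    diff≥0 {a} {b} h = subst (λ x → x ℚ.≤ b - a) (ℚP.+-inverseʳ a) (ℚP.+-monoˡ-≤ (- a) h)

    diff>0 : ∀ {a b} → a < b → 0ℚ < b - a
    diff>0 {a} {b} h = subst (λ x → x ℚ.< b - a) (ℚP.+-inverseʳ a) (ℚP.+-monoˡ-< (- a) h)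

    0<1 : 0ℚ < 1ℚ
    0<1 = ℚ.*<* (ℤ.+<+ (ℕ.s≤s ℕ.z≤n))

    +-mono-≤ : ∀ {a b c d} → a ≤ b → c ≤ d → a + c ≤ b + d
    +-mono-≤ = ℚP.+-mono-≤

    +-mono-<-≤ : ∀ {a b c d} → a < b → c ≤ d → a + c < b + d
    +-mono-<-≤ = ℚP.+-mono-<-≤

    *-monoˡ : ∀ {a b c} → 0ℚ ≤ c → a ≤ b → c * a ≤ c * b
    *-monoˡ {c = c} h p = ℚP.*-monoˡ-≤-nonNeg c {{ℚ.nonNegative h}} p

    *-monoˡ-< : ∀ {a b c} → 0ℚ < c → a < b → c * a < c * b
    *-monoˡ-< {c = c} h p = ℚP.*-monoʳ-<-pos c {{ℚ.positive h}} p

    *-cancelˡ : ∀ {a b c} → 0ℚ < c → c * a ≤ c * b → a ≤ b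
    *-cancelˡ {c = c} h p = ℚP.*-cancelˡ-≤-pos c {{ℚ.positive h}} p

    -- inv 0 = 0
    inv : ℚ → ℚ
    inv x with x ℚ.≟ 0ℚ
    ... | yes _ = 0ℚ
    ... | no p = ℚ.1/_ x {{ℚ.≢-nonZero p}}

    inv-*ʳ : ∀ {x} → 0ℚ < x → x * inv x ≡ 1ℚ
    inv-*ʳ {x} h with x ℚ.≟ 0ℚ
    ... | yes refl = ⊥-elim (ℚP.<-irrefl refl h)
    ... | no p = ℚP.*-inverseʳ x {{ℚ.≢-nonZero p}}

    inv>0 : ∀ {x} → 0ℚ < x → 0ℚ < inv x
    inv>0 {x} h with x ℚ.≟ 0ℚ
    ... | yes refl = ⊥-elim (ℚP.<-irrefl refl h)
    ... | no p = ℚP.positive⁻¹ _ {{ℚP.1/pos⇒pos x {{ℚ.positive h}}}}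

  commutativeRing : CommutativeRing 0ℓ 0ℓ
  commutativeRing = record { isCommutativeRing = +-*-isCommutativeRing }

  open IsCommutativeRing +-*-isCommutativeRing
    using (+-identityˡ; +-identityʳ; *-identityˡ; *-identityʳ; +-comm; *-comm; +-assoc; *-assoc; distribˡ; distribʳ; zeroˡ; zeroʳ)
  open IsTotalOrder ≤-isTotalOrder
    using () renaming (refl to ≤-refl; trans to ≤-trans; reflexive to ≤-reflexive; total to ≤-total)

  import Algebra.Properties.Semiring.Sum (CommutativeRing.semiring commutativeRing) as Sum
  import Algebra.Properties.CommutativeMonoid.Sum (CommutativeRing.*-commutativeMonoid commutativeRing) as Product

  opaque
    sum product : ∀ {n} → (Fin n → ℚ) → ℚ
    sum = Sum.sum
    product = Product.sum

  opaque
    unfolding sum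

    sum-cong : ∀ {n} {f g : Fin n → ℚ} → (∀ i → f i ≡ g i) → sum f ≡ sum g
    sum-cong = Sum.sum-cong-≗

    sum-+ : ∀ {n} (f g : Fin n → ℚ) → sum (λ i → f i + g i) ≡ sum f + sum g
    sum-+ = Sum.∑-distrib-+

    sum-*ˡ : ∀ {n} c (f : Fin n → ℚ) → sum (λ i → c * f i) ≡ c * sum f
    sum-*ˡ c f = ≡-sym (Sum.*-distribˡ-sum c f)

    sum-*ʳ : ∀ {n} (f : Fin n → ℚ) c → sum (λ i → f i * c) ≡ sum f * c
    sum-*ʳ f c = ≡-sym (Sum.*-distribʳ-sum c f)

    sum-zero : (f : Fin 0 → ℚ) → sum f ≡ 0ℚ
    sum-zero f = refl

    sum-suc : ∀ {n} (f : Fin (suc n) → ℚ) → sum f ≡ f zero + sum (f ∘ suc)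
    sum-suc f = refl

    product-zero : (f : Fin 0 → ℚ) → product f ≡ 1ℚ
    product-zero f = refl

    product-suc : ∀ {n} (f : Fin (suc n) → ℚ) → product f ≡ f zero * product (f ∘ suc)
    product-suc f = refl

    product-cong : ∀ {n} {f g : Fin n → ℚ} → (∀ i → f i ≡ g i) → product f ≡ product g
    product-cong = Product.sum-cong-≗

  2ℚ : ℚ
  2ℚ = 1ℚ + 1ℚ

  0≤1 : 0ℚ ≤ 1ℚ
  0≤1 = <⇒≤ 0<1

  +≥0 : ∀ {a b} → 0ℚ ≤ a → 0ℚ ≤ b → 0ℚ ≤ a + b
  +≥0 {a} {b} p q = subst (_≤ a + b) (+-identityˡ 0ℚ) (+-mono-≤ p q)

  +>0 : ∀ {a b} → 0ℚ < a → 0ℚ ≤ b → 0ℚ < a + b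
  +>0 {a} {b} p q = subst (_< a + b) (+-identityˡ 0ℚ) (+-mono-<-≤ p q)

  x≤x+y : ∀ {x y} → 0ℚ ≤ y → x ≤ x + y
  x≤x+y {x} {y} = ≤-of-diff (lem x y)
    where
    opaque
      unfolding _+_
      lem : ∀ x y → x + y - x ≡ y
      lem = solve-∀ ring

  x≤y+x : ∀ {x y} → 0ℚ ≤ y → x ≤ y + x
  x≤y+x {x} {y} = ≤-of-diff (lem x y)
    where
    opaque
      unfolding _+_
      lem : ∀ x y → y + x - x ≡ y
      lem = solve-∀ ring

  1-x≤1 : ∀ {x} → 0ℚ ≤ x → 1ℚ - x ≤ 1ℚ
  1-x≤1 {x} = ≤-of-diff (lem x)
    where
    opaque
      unfolding _+_
      lem : ∀ x → 1ℚ - (1ℚ - x) ≡ x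
      lem = solve-∀ ring

  x-1≤x : ∀ x → x - 1ℚ ≤ x
  x-1≤x x = ≤-of-diff (lem x) 0≤1
    where
    opaque
      unfolding _+_
      lem : ∀ x → x - (x - 1ℚ) ≡ 1ℚ
      lem = solve-∀ ring

  x<1+x : ∀ x → x < 1ℚ + x
  x<1+x x = <-of-diff (lem x) 0<1
    where
    opaque
      unfolding _+_
      lem : ∀ x → 1ℚ + x - x ≡ 1ℚ
      lem = solve-∀ ring

  0≤2 : 0ℚ ≤ 2ℚ
  0≤2 = +≥0 0≤1 0≤1

  *-monoʳ : ∀ {a b c} → 0ℚ ≤ c → a ≤ b → a * c ≤ b * c
  *-monoʳ {a} {b} {c} h p = subst₂ _≤_ (*-comm c a) (*-comm c b) (*-monoˡ h p)

  *≥0 : ∀ {a b} → 0ℚ ≤ a → 0ℚ ≤ b → 0ℚ ≤ a * b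
  *≥0 {a} {b} p q = subst (_≤ a * b) (zeroʳ a) (*-monoˡ p q)

  *>0 : ∀ {a b} → 0ℚ < a → 0ℚ < b → 0ℚ < a * b
  *>0 {a} {b} p q = subst (_< a * b) (zeroʳ a) (*-monoˡ-< p q)

  *-mono : ∀ {a b c d} → 0ℚ ≤ b → 0ℚ ≤ c → a ≤ b → c ≤ d → a * c ≤ b * d
  *-mono hb hc p q = ≤-trans (*-monoʳ hc p) (*-monoˡ hb q)

  sq≥0 : ∀ a → 0ℚ ≤ a * a
  sq≥0 a with ≤-total 0ℚ a
  ... | inj₁ p = *≥0 p p
  ... | inj₂ p = subst (0ℚ ≤_) (lem a) (*≥0 (diff≥0 p) (diff≥0 p))
    where
    opaque
      unfolding _+_
      lem : ∀ a → (0ℚ - a) * (0ℚ - a) ≡ a * a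
      lem = solve-∀ ring

  <⇒≱′ : ∀ {a b} → a < b → b ≤ a → ⊥
  <⇒≱′ p q = <-irrefl (<-≤-trans p q)

  ⌜_⌝ : ℕ → ℚ
  ⌜ zero ⌝ = 0ℚ
  ⌜ suc n ⌝ = 1ℚ + ⌜ n ⌝

  opaque
    unfolding _+_

    toℚ-mk : ∀ n → toℚ n ≡ mkℚ (ℤ.+ n) 0 (sym (1-coprimeTo n))
    toℚ-mk n = ℚP.normalize-coprime (sym (1-coprimeTo n))

    toℚ≡⌜⌝ : ∀ n → toℚ n ≡ ⌜ n ⌝
    toℚ≡⌜⌝ zero = refl
    toℚ≡⌜⌝ (suc n) = trans (≡-sym 1+) (cong (λ x → 1ℚ + x) (toℚ≡⌜⌝ n))
      where
      1+ : toℚ 1 + toℚ n ≡ toℚ (suc n)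
      1+ rewrite toℚ-mk n = cong (ℚ._/ 1) (cong (λ z → ℤ.+ 1 ℤ.+ z) (ℤP.*-identityʳ (ℤ.+ n)))

  ⌜⌝-+ : ∀ a b → ⌜ a ℕ.+ b ⌝ ≡ ⌜ a ⌝ + ⌜ b ⌝
  ⌜⌝-+ zero b = ≡-sym (+-identityˡ _)
  ⌜⌝-+ (suc a) b = trans (cong (1ℚ +_) (⌜⌝-+ a b)) (≡-sym (+-assoc 1ℚ _ _))

  ⌜⌝-* : ∀ a b → ⌜ a ℕ.* b ⌝ ≡ ⌜ a ⌝ * ⌜ b ⌝
  ⌜⌝-* zero b = ≡-sym (zeroˡ _)
  ⌜⌝-* (suc a) b = trans (⌜⌝-+ b (a ℕ.* b)) (trans (cong (⌜ b ⌝ +_) (⌜⌝-* a b)) (lem ⌜ a ⌝ ⌜ b ⌝))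
    where
    opaque
      unfolding _+_
      lem : ∀ a b → b + a * b ≡ (1ℚ + a) * b
      lem = solve-∀ ring

  ⌜⌝≥0 : ∀ n → 0ℚ ≤ ⌜ n ⌝
  ⌜⌝≥0 zero = ≤-refl
  ⌜⌝≥0 (suc n) = +≥0 0≤1 (⌜⌝≥0 n)

  ⌜⌝-mono : ∀ {a b} → a ℕ.≤ b → ⌜ a ⌝ ≤ ⌜ b ⌝
  ⌜⌝-mono {b = b} ℕ.z≤n = ⌜⌝≥0 b
  ⌜⌝-mono (ℕ.s≤s p) = +-mono-≤ ≤-refl (⌜⌝-mono p)

  ⌜⌝-mono-< : ∀ {a b} → a ℕ.< b → ⌜ a ⌝ < ⌜ b ⌝
  ⌜⌝-mono-< {a} p = <-≤-trans (x<1+x ⌜ a ⌝) (⌜⌝-mono p)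

  ⌜⌝-cancel : ∀ {a b} → ⌜ a ⌝ ≤ ⌜ b ⌝ → a ℕ.≤ b
  ⌜⌝-cancel {a} {b} p with a ℕ.≤? b
  ... | yes q = q
  ... | no q = ⊥-elim (<⇒≱′ (⌜⌝-mono-< (ℕP.≰⇒> q)) p)

  ⌜⌝-cancel-< : ∀ {a b} → ⌜ a ⌝ < ⌜ b ⌝ → a ℕ.< b
  ⌜⌝-cancel-< {a} {b} p with a ℕ.<? b
  ... | yes q = q
  ... | no q = ⊥-elim (<⇒≱′ p (⌜⌝-mono (ℕP.≮⇒≥ q)))

  inv-*ˡ : ∀ {x} → 0ℚ < x → inv x * x ≡ 1ℚ
  inv-*ˡ {x} h = trans (*-comm (inv x) x) (inv-*ʳ h)

  inv≥0 : ∀ {x} → 0ℚ < x → 0ℚ ≤ inv x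
  inv≥0 h = <⇒≤ (inv>0 h)

  inv-anti : ∀ {x y} → 0ℚ < x → x ≤ y → inv y ≤ inv x
  inv-anti {x} {y} hx p = *-cancelˡ hy (*-cancelˡ hx (subst₂ _≤_ (≡-sym eq1) (≡-sym eq2) p))
    where
    hy = <-≤-trans hx p
    eq1 : x * (y * inv y) ≡ x
    eq1 = trans (cong (x *_) (inv-*ʳ hy)) (*-identityʳ x)
    opaque
      unfolding _+_
      lem : ∀ x y i → x * (y * i) ≡ x * i * y
      lem = solve-∀ ring
    eq2 : x * (y * inv x) ≡ y
    eq2 = trans (lem x y (inv x)) (trans (cong (_* y) (inv-*ʳ hx)) (*-identityˡ y))

  inv-≤ : ∀ {x y z} → 0ℚ < y → x ≤ z * y → x * inv y ≤ z
  inv-≤ {x} {y} {z} h p = subst (x * inv y ≤_) eq (*-monoʳ (inv≥0 h) p)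
    where
    eq : z * y * inv y ≡ z
    eq = trans (*-assoc z y (inv y)) (trans (cong (z *_) (inv-*ʳ h)) (*-identityʳ z))

  ≤-inv : ∀ {x y z} → 0ℚ < y → z * y ≤ x → z ≤ x * inv y
  ≤-inv {x} {y} {z} h p = subst (_≤ x * inv y) eq (*-monoʳ (inv≥0 h) p)
    where
    eq : z * y * inv y ≡ z
    eq = trans (*-assoc z y (inv y)) (trans (cong (z *_) (inv-*ʳ h)) (*-identityʳ z))

  -- Powers: Bernoulli's inequality, Taylor and tangent bounds

  infixr 8 _^_
  _^_ : ℚ → ℕ → ℚ
  x ^ zero = 1ℚ
  x ^ suc n = x * x ^ n

  ^≥0 : ∀ {x} n → 0ℚ ≤ x → 0ℚ ≤ x ^ n
  ^≥0 zero h = 0≤1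
  ^≥0 (suc n) h = *≥0 h (^≥0 n h)

  ^>0 : ∀ {x} n → 0ℚ < x → 0ℚ < x ^ n
  ^>0 zero h = 0<1
  ^>0 (suc n) h = *>0 h (^>0 n h)

  ^-mono : ∀ {x y} n → 0ℚ ≤ x → x ≤ y → x ^ n ≤ y ^ n
  ^-mono zero h p = ≤-refl
  ^-mono (suc n) h p = *-mono (≤-trans h p) (^≥0 n h) p (^-mono n h p)

  1^ : ∀ n → 1ℚ ^ n ≡ 1ℚ
  1^ zero = refl
  1^ (suc n) = trans (*-identityˡ _) (1^ n)

  ^≤1 : ∀ {x} n → 0ℚ ≤ x → x ≤ 1ℚ → x ^ n ≤ 1ℚ
  ^≤1 {x} n h p = subst (x ^ n ≤_) (1^ n) (^-mono n h p)

  1≤^ : ∀ {x} n → 1ℚ ≤ x → 1ℚ ≤ x ^ n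
  1≤^ {x} n p = subst (_≤ x ^ n) (1^ n) (^-mono n 0≤1 p)

  ^-+ : ∀ x m n → x ^ (m ℕ.+ n) ≡ x ^ m * x ^ n
  ^-+ x zero n = ≡-sym (*-identityˡ _)
  ^-+ x (suc m) n = trans (cong (x *_) (^-+ x m n)) (≡-sym (*-assoc x _ _))

  ^-*-distrib : ∀ x y n → (x * y) ^ n ≡ x ^ n * y ^ n
  ^-*-distrib x y zero = ≡-sym (*-identityˡ _)
  ^-*-distrib x y (suc n) = trans (cong (x * y *_) (^-*-distrib x y n)) (lem x y (x ^ n) (y ^ n))
    where
    opaque
      unfolding _+_
      lem : ∀ x y a b → x * y * (a * b) ≡ x * a * (y * b)
      lem = solve-∀ ring

  ^-* : ∀ x m n → x ^ (m ℕ.* n) ≡ (x ^ n) ^ m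
  ^-* x zero n = refl
  ^-* x (suc m) n = trans (^-+ x n (m ℕ.* n)) (cong (x ^ n *_) (^-* x m n))

  ^-monoʳ : ∀ {x m n} → 1ℚ ≤ x → m ℕ.≤ n → x ^ m ≤ x ^ n
  ^-monoʳ {n = n} h ℕ.z≤n = 1≤^ n h
  ^-monoʳ h (ℕ.s≤s p) = *-monoˡ (≤-trans 0≤1 h) (^-monoʳ h p)

  ^-antiʳ : ∀ {x m n} → 0ℚ ≤ x → x ≤ 1ℚ → m ℕ.≤ n → x ^ n ≤ x ^ m
  ^-antiʳ {n = n} h h1 ℕ.z≤n = ^≤1 n h h1
  ^-antiʳ h h1 (ℕ.s≤s p) = *-monoˡ h (^-antiʳ h h1 p)

  bernoulli : ∀ x n → 0ℚ ≤ x → 1ℚ + ⌜ n ⌝ * x ≤ (1ℚ + x) ^ n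
  bernoulli x zero h = ≤-reflexive (lem x)
    where
    opaque
      unfolding _+_
      lem : ∀ x → 1ℚ + 0ℚ * x ≡ 1ℚ
      lem = solve-∀ ring
  bernoulli x (suc n) h =
    ≤-trans (≤-of-diff (lem x (⌜ n ⌝)) (*≥0 (⌜⌝≥0 n) (sq≥0 x)))
      (*-monoˡ (+≥0 0≤1 h) (bernoulli x n h))
    where
    opaque
      unfolding _+_
      lem : ∀ x n → (1ℚ + x) * (1ℚ + n * x) - (1ℚ + (1ℚ + n) * x) ≡ n * (x * x)
      lem = solve-∀ ring

  bernoulli⁻ : ∀ x n → 0ℚ ≤ x → x ≤ 1ℚ → 1ℚ - ⌜ n ⌝ * x ≤ (1ℚ - x) ^ n
  bernoulli⁻ x zero h h1 = ≤-reflexive (lem x)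
    where
    opaque
      unfolding _+_
      lem : ∀ x → 1ℚ - 0ℚ * x ≡ 1ℚ
      lem = solve-∀ ring
  bernoulli⁻ x (suc n) h h1 =
    ≤-trans (≤-of-diff (lem x (⌜ n ⌝)) (*≥0 (⌜⌝≥0 n) (sq≥0 x)))
      (*-monoˡ (diff≥0 h1) (bernoulli⁻ x n h h1))
    where
    opaque
      unfolding _+_
      lem : ∀ x n → (1ℚ - x) * (1ℚ - n * x) - (1ℚ - (1ℚ + n) * x) ≡ n * (x * x)
      lem = solve-∀ ring

  -- The quadratic Taylor bound for (A + δ) ^ k, multiplied by A to avoid the exponent k - 1.
  power-taylor : ∀ k {A δ b} → 1ℚ ≤ A → - b ≤ δ → δ ≤ b → ⌜ k ⌝ * b ≤ 1ℚ →
    A * (A + δ) ^ k ≤ A ^ k * (A + ⌜ k ⌝ * δ + ⌜ k ⌝ * ⌜ k ⌝ * (b * b) * A)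
  power-taylor zero {A} {δ} {b} hA _ _ _ = ≤-reflexive (lem A δ b)
    where
    opaque
      unfolding _+_
      lem : ∀ A δ b → A * 1ℚ ≡ 1ℚ * (A + 0ℚ * δ + 0ℚ * 0ℚ * (b * b) * A)
      lem = solve-∀ ring
  power-taylor (suc k) {A} {δ} {b} hA h₁ h₂ hk =
    ≤-trans (≤-reflexive (lem₁ A δ ((A + δ) ^ k)))
    (≤-trans (*-monoˡ Aδ≥0 (power-taylor k hA h₁ h₂ kb≤1))
    (≤-of-diff (lem₂ A δ b K (A ^ k))
      (*≥0 (^≥0 k A≥0) (+≥0 (+≥0 (*≥0 K≥0 sq) (*≥0 (*≥0 K≥0 (*≥0 (sq≥0 b) A≥0)) Aiδ)) (*≥0 (sq≥0 b) (sq≥0 A))))))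
    where
    K = ⌜ k ⌝
    K≥0 = ⌜⌝≥0 k
    A≥0 = ≤-trans 0≤1 hA
    b+δ≥0 : 0ℚ ≤ b + δ
    b+δ≥0 = subst (0ℚ ≤_) (l δ b) (diff≥0 h₁)
      where
      opaque
        unfolding _+_
        l : ∀ δ b → δ - (- b) ≡ b + δ
        l = solve-∀ ring
    b-δ≥0 : 0ℚ ≤ b - δ
    b-δ≥0 = diff≥0 h₂
    b≥0 : 0ℚ ≤ b
    b≥0 = *-cancelˡ {c = 2ℚ} (+>0 0<1 0≤1) (subst₂ _≤_ (≡-sym (zeroʳ 2ℚ)) (l δ b) (+≥0 b+δ≥0 b-δ≥0))
      where
      opaque
        unfolding _+_
        l : ∀ δ b → b + δ + (b - δ) ≡ (1ℚ + 1ℚ) * b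
        l = solve-∀ ring
    kb≤1 : K * b ≤ 1ℚ
    kb≤1 = ≤-trans (*-monoʳ b≥0 (<⇒≤ (x<1+x K))) hk
    b≤1 : b ≤ 1ℚ
    b≤1 = ≤-trans (≤-of-diff (l K b) (*≥0 K≥0 b≥0)) hk
      where
      opaque
        unfolding _+_
        l : ∀ K b → (1ℚ + K) * b - b ≡ K * b
        l = solve-∀ ring
    Aδ≥0 : 0ℚ ≤ A + δ
    Aδ≥0 = subst (0ℚ ≤_) (l A δ b) (+≥0 b+δ≥0 (+≥0 (diff≥0 hA) (diff≥0 b≤1)))
      where
      opaque
        unfolding _+_
        l : ∀ A δ b → b + δ + (A - 1ℚ + (1ℚ - b)) ≡ A + δ
        l = solve-∀ ring
    sq : 0ℚ ≤ b * b * (A * A) - δ * δ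
    sq = subst (0ℚ ≤_) (l A δ b) (+≥0 (*≥0 b-δ≥0 b+δ≥0) (*≥0 (sq≥0 b) (+≥0 (*≥0 A≥0 (diff≥0 hA)) (diff≥0 hA))))
      where
      opaque
        unfolding _+_
        l : ∀ A δ b → (b - δ) * (b + δ) + b * b * (A * (A - 1ℚ) + (A - 1ℚ)) ≡ b * b * (A * A) - δ * δ
        l = solve-∀ ring
    Aiδ : 0ℚ ≤ A - K * δ
    Aiδ = subst (0ℚ ≤_) (l A δ b K) (+≥0 (diff≥0 hA) (+≥0 (diff≥0 kb≤1) (*≥0 K≥0 b-δ≥0)))
      where
      opaque
        unfolding _+_
        l : ∀ A δ b K → A - 1ℚ + (1ℚ - K * b + K * (b - δ)) ≡ A - K * δ
        l = solve-∀ ring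
    opaque
      unfolding _+_
      lem₁ : ∀ A δ p → A * ((A + δ) * p) ≡ (A + δ) * (A * p)
      lem₁ = solve-∀ ring
      lem₂ : ∀ A δ b k p → A * p * (A + (1ℚ + k) * δ + (1ℚ + k) * (1ℚ + k) * (b * b) * A)
          - (A + δ) * (p * (A + k * δ + k * k * (b * b) * A))
        ≡ p * (k * (b * b * (A * A) - δ * δ) + k * (b * b * A) * (A - k * δ) + b * b * (A * A))
      lem₂ = solve-∀ ring

  -- Convexity: the tangent at `a` lies below the power. Both sides carry a factor `a`, so that the
  -- slope involves no exponent m - 1. Averaged over `z`, this is the Jensen step of `E-z^`.
  ^-tangent : ∀ m {z a} → 0ℚ ≤ z → 0ℚ ≤ a → a ^ m * a + ⌜ m ⌝ * a ^ m * (z - a) ≤ z ^ m * a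
  ^-tangent zero {z} {a} hz ha = ≤-reflexive (lem z a)
    where
    opaque
      unfolding _+_
      lem : ∀ z a → 1ℚ * a + 0ℚ * 1ℚ * (z - a) ≡ 1ℚ * a
      lem = solve-∀ ring
  ^-tangent (suc m) {z} {a} hz ha =
    ≤-trans (≤-of-diff (lem z a (a ^ m) (⌜ m ⌝)) (*≥0 (*≥0 (⌜⌝≥0 m) (^≥0 m ha)) (sq≥0 (z - a))))
      (≤-trans (*-monoˡ hz (^-tangent m hz ha)) (≤-reflexive (≡-sym (*-assoc z _ a))))
    where
    opaque
      unfolding _+_
      lem : ∀ z a p m → z * (p * a + m * p * (z - a)) - (a * p * a + (1ℚ + m) * (a * p) * (z - a)) ≡ m * p * ((z - a) * (z - a))
      lem = solve-∀ ring

  <-resp : _<_ Respects₂ _≡_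
  <-resp = (λ { refl p → p }) , (λ { refl p → p })

  module ≤-Reasoning where
    open import Relation.Binary.Reasoning.Base.Triple
      (IsTotalOrder.isPreorder ≤-isTotalOrder) (λ p q → <-irrefl (<-≤-trans p (<⇒≤ q)))
      (λ p q → <-≤-trans p (<⇒≤ q)) <-resp <⇒≤ <-≤-trans ≤-<-trans public
      hiding (step-≈; step-≈˘; step-≈-⟩; step-≈-⟨)

  -- Indicators, finite sums and products

  𝟙 : Bool → ℚ
  𝟙 true = 1ℚ
  𝟙 false = 0ℚ

  𝟙≥0 : ∀ b → 0ℚ ≤ 𝟙 b
  𝟙≥0 true = 0≤1
  𝟙≥0 false = ≤-refl

  𝟙≤1 : ∀ b → 𝟙 b ≤ 1ℚ
  𝟙≤1 true = ≤-refl
  𝟙≤1 false = 0≤1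

  opaque
    unfolding _+_
    sum-const-identity : ∀ n c → c + n * c ≡ (1ℚ + n) * c
    sum-const-identity = solve-∀ ring
    product-lower-identity : 1ℚ - (1ℚ - 0ℚ) ≡ 0ℚ
    product-lower-identity = solve-∀ ring
    product-lower-step-identity : ∀ f g p s → f * (p - s) - (g * p - (g - f + s)) ≡ (g - f) * (1ℚ - p) + (1ℚ - f) * s
    product-lower-step-identity = solve-∀ ring
    product-weierstrass-identity : ∀ y → 1ℚ - (1ℚ - y) ≡ y
    product-weierstrass-identity = solve-∀ ring

  opaque
    unfolding sum

    sum-mono : ∀ {n} {f g : Fin n → ℚ} → (∀ i → f i ≤ g i) → sum f ≤ sum g
    sum-mono {zero} h = ≤-refl
    sum-mono {suc n} h = +-mono-≤ (h zero) (sum-mono (h ∘ suc))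

    sum-const : ∀ n c → sum {n} (λ _ → c) ≡ ⌜ n ⌝ * c
    sum-const zero c = ≡-sym (zeroˡ c)
    sum-const (suc n) c = trans (cong (c +_) (sum-const n c)) (sum-const-identity ⌜ n ⌝ c)

    sum≥0 : ∀ {n} {f : Fin n → ℚ} → (∀ i → 0ℚ ≤ f i) → 0ℚ ≤ sum f
    sum≥0 {n} {f} h = subst (_≤ sum f) (trans (sum-const n 0ℚ) (zeroʳ ⌜ n ⌝)) (sum-mono h)

    sum-≤-const : ∀ {n} {f : Fin n → ℚ} {c} → (∀ i → f i ≤ c) → sum f ≤ ⌜ n ⌝ * c
    sum-≤-const {n} {f} {c} h = subst (sum f ≤_) (sum-const n c) (sum-mono h)

    term≤sum : ∀ {n} {f : Fin n → ℚ} → (∀ i → 0ℚ ≤ f i) → ∀ i → f i ≤ sum f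
    term≤sum {f = f} h zero = subst (_≤ sum f) (+-identityʳ (f zero)) (+-mono-≤ ≤-refl (sum≥0 (h ∘ suc)))
    term≤sum {f = f} h (suc i) =
      subst (_≤ sum f) (+-identityˡ (f (suc i))) (+-mono-≤ (h zero) (term≤sum (h ∘ suc) i))

    sum-< : ∀ {n} {f g : Fin n → ℚ} → (∀ i → f i ≤ g i) → ∀ i → f i < g i → sum f < sum g
    sum-< h zero p = +-mono-<-≤ p (sum-mono (h ∘ suc))
    sum-< {f = f} {g} h (suc i) p = subst₂ _<_ (+-comm _ (f zero)) (+-comm _ (g zero))
      (+-mono-<-≤ (sum-< (h ∘ suc) i p) (h zero))

    sum-exclusive : ∀ {n} (g : Fin n → Bool) →
      (∀ i j → i ≢ j → g i ≡ true → g j ≡ true → ⊥) → sum (𝟙 ∘ g) ≤ 1ℚ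
    sum-exclusive {zero} g h = 0≤1
    sum-exclusive {suc n} g h with g zero in eq
    ... | false = subst (_≤ 1ℚ) (≡-sym (+-identityˡ _))
                    (sum-exclusive (g ∘ suc) λ i j i≢j → h (suc i) (suc j) λ { refl → i≢j refl })
    ... | true = ≤-reflexive (trans (cong (1ℚ +_) (trans (sum-cong none) (trans (sum-const n 0ℚ) (zeroʳ _))))
                    (+-identityʳ 1ℚ))
      where
      none : ∀ i → 𝟙 (g (suc i)) ≡ 0ℚ
      none i with g (suc i) in eq′
      ... | true = ⊥-elim (h zero (suc i) (λ ()) eq eq′)
      ... | false = refl

    product≥0 : ∀ {n} {f : Fin n → ℚ} → (∀ i → 0ℚ ≤ f i) → 0ℚ ≤ product f
    product≥0 {zero} h = 0≤1
    product≥0 {suc n} h = *≥0 (h zero) (product≥0 (h ∘ suc))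

    product-mono : ∀ {n} {f g : Fin n → ℚ} → (∀ i → 0ℚ ≤ f i) → (∀ i → f i ≤ g i) → product f ≤ product g
    product-mono {zero} _ _ = ≤-refl
    product-mono {suc n} h p =
      *-mono (≤-trans (h zero) (p zero)) (product≥0 (h ∘ suc)) (p zero) (product-mono (h ∘ suc) (p ∘ suc))

    product-1 : ∀ n → product {n} (λ _ → 1ℚ) ≡ 1ℚ
    product-1 zero = refl
    product-1 (suc n) = trans (*-identityˡ _) (product-1 n)

    product≤1 : ∀ {n} {f : Fin n → ℚ} → (∀ i → 0ℚ ≤ f i) → (∀ i → f i ≤ 1ℚ) → product f ≤ 1ℚ
    product≤1 {n} {f} h p = subst (product f ≤_) (product-1 n) (product-mono h p)

    product-^ : ∀ {n} (f : Fin n → ℚ) m → product (λ i → f i ^ m) ≡ product f ^ m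
    product-^ {zero} f m = ≡-sym (1^ m)
    product-^ {suc n} f m = trans (cong (f zero ^ m *_) (product-^ (f ∘ suc) m)) (≡-sym (^-*-distrib (f zero) _ m))

    -- Lowering the factors from `g i` to `f i` one at a time costs at most `g i - f i` each,
    -- because the remaining factors lie in [0, 1].
    product-lower : ∀ {n} (f g : Fin n → ℚ) → (∀ i → 0ℚ ≤ f i) → (∀ i → f i ≤ g i) → (∀ i → g i ≤ 1ℚ) →
      product g - sum (λ i → g i - f i) ≤ product f
    product-lower {zero} f g _ _ _ = ≤-of-diff product-lower-identity ≤-refl
    product-lower {suc n} f g f≥0 f≤g g≤1 =
      ≤-trans (≤-of-diff (product-lower-step-identity (f zero) (g zero) (product (g ∘ suc)) s)
         (+≥0 (*≥0 (diff≥0 (f≤g zero)) (diff≥0 (product≤1 (λ i → ≤-trans (f≥0 (suc i)) (f≤g (suc i))) (g≤1 ∘ suc))))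
              (*≥0 (diff≥0 (≤-trans (f≤g zero) (g≤1 zero))) (sum≥0 λ i → diff≥0 (f≤g (suc i))))))
        (*-monoˡ (f≥0 zero) (product-lower (f ∘ suc) (g ∘ suc) (f≥0 ∘ suc) (f≤g ∘ suc) (g≤1 ∘ suc)))
      where
      s : ℚ
      s = sum (λ i → g (suc i) - f (suc i))

    product-weierstrass : ∀ {n} (y : Fin n → ℚ) → (∀ i → 0ℚ ≤ y i) → (∀ i → y i ≤ 1ℚ) →
      1ℚ - sum y ≤ product (λ i → 1ℚ - y i)
    product-weierstrass {n} y y≥0 y≤1 =
      subst (_≤ product (λ i → 1ℚ - y i))
        (cong₂ _-_ (product-1 n) (sum-cong λ i → product-weierstrass-identity (y i)))
        (product-lower (λ i → 1ℚ - y i) (λ _ → 1ℚ) (λ i → diff≥0 (y≤1 i))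
          (λ i → 1-x≤1 (y≥0 i)) (λ _ → ≤-refl))

  -- Finite probability distributions

  record Linear {Y : Set} (L : (Y → ℚ) → ℚ) : Set where
    field
      lin-cong : ∀ {f g} → (∀ y → f y ≡ g y) → L f ≡ L g
      lin-+ : ∀ f g → L (λ y → f y + g y) ≡ L f + L g
      lin-* : ∀ c f → L (λ y → c * f y) ≡ c * L f

    lin-0 : L (λ _ → 0ℚ) ≡ 0ℚ
    lin-0 = trans (lin-cong (λ _ → ≡-sym (zeroˡ 0ℚ))) (trans (lin-* 0ℚ (λ _ → 0ℚ)) (zeroˡ _))

    lin-sum : ∀ {n} (f : Fin n → Y → ℚ) → L (λ y → sum (λ i → f i y)) ≡ sum (λ i → L (f i))
    lin-sum {zero} f = trans (lin-cong λ y → sum-zero _) (trans lin-0 (≡-sym (sum-zero _)))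
    lin-sum {suc n} f = trans (lin-cong λ y → sum-suc _) (trans (lin-+ (f zero) _)
      (trans (cong (L (f zero) +_) (lin-sum (f ∘ suc))) (≡-sym (sum-suc _))))

  -- A distribution is represented by its expectation functional. `E-swap` is Fubini against an
  -- arbitrary linear functional, and `E-pick` is what derandomises: some outcome of the support
  -- does no worse than the mean.
  record Dist (X : Set) : Set₁ where
    field
      E : (X → ℚ) → ℚ
      Supp : X → Set
      E-mono : ∀ {f g} → (∀ x → Supp x → f x ≤ g x) → E f ≤ E g
      E-+ : ∀ f g → E (λ x → f x + g x) ≡ E f + E g
      E-* : ∀ c f → E (λ x → c * f x) ≡ c * E f
      E-1 : E (λ _ → 1ℚ) ≡ 1ℚ
      E-swap : ∀ {Y : Set} {L : (Y → ℚ) → ℚ} → Linear L → ∀ (f : X → Y → ℚ) →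
        E (λ x → L (f x)) ≡ L (λ y → E (λ x → f x y))
      E-pick : ∀ f {b} → E f ≤ b → Σ X λ x → Supp x × f x ≤ b

    E-cong-Supp : ∀ {f g} → (∀ x → Supp x → f x ≡ g x) → E f ≡ E g
    E-cong-Supp h = IsTotalOrder.antisym ≤-isTotalOrder
      (E-mono λ x s → ≤-reflexive (h x s)) (E-mono λ x s → ≤-reflexive (≡-sym (h x s)))

    E-cong : ∀ {f g} → (∀ x → f x ≡ g x) → E f ≡ E g
    E-cong h = E-cong-Supp λ x _ → h x

    linear : Linear E
    linear = record { lin-cong = E-cong ; lin-+ = E-+ ; lin-* = E-* }

    open Linear linear public using () renaming (lin-sum to E-sum)

    E-const : ∀ c → E (λ _ → c) ≡ c
    E-const c = trans (E-cong λ _ → ≡-sym (*-identityʳ c))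
      (trans (E-* c (λ _ → 1ℚ)) (trans (cong (c *_) E-1) (*-identityʳ c)))

    E-*ʳ : ∀ f c → E (λ x → f x * c) ≡ E f * c
    E-*ʳ f c = trans (E-cong λ x → *-comm (f x) c) (trans (E-* c f) (*-comm c (E f)))

    E-affine : ∀ a c f → E (λ x → a + c * f x) ≡ a + c * E f
    E-affine a c f = trans (E-+ (λ _ → a) (λ x → c * f x)) (cong₂ _+_ (E-const a) (E-* c f))

    E-minus : ∀ a f → E (λ x → a - f x) ≡ a - E f
    E-minus a f = trans (E-cong λ x → ≡-sym (lem a (f x))) (trans (E-affine a (- 1ℚ) f) (lem a (E f)))
      where
      opaque
        unfolding _+_
        lem : ∀ a y → a + - 1ℚ * y ≡ a - y
        lem = solve-∀ ring

    E≥ : ∀ {f c} → (∀ x → Supp x → c ≤ f x) → c ≤ E f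
    E≥ {f} {c} h = subst (_≤ E f) (E-const c) (E-mono h)

    E≤ : ∀ {f c} → (∀ x → Supp x → f x ≤ c) → E f ≤ c
    E≤ {f} {c} h = subst (E f ≤_) (E-const c) (E-mono h)

    -- In the quadratic Taylor bound the linear term averages to at most 0, so only the second-order
    -- factor survives; the auxiliary factor `A` of `power-taylor` is cancelled at the end.
    power-step : ∀ k {A b} (δ : X → ℚ) → 1ℚ ≤ A → (∀ x → Supp x → - b ≤ δ x) → (∀ x → Supp x → δ x ≤ b) →
      ⌜ k ⌝ * b ≤ 1ℚ → E δ ≤ 0ℚ → E (λ x → (A + δ x) ^ k) ≤ A ^ k * (1ℚ + ⌜ k ⌝ * ⌜ k ⌝ * (b * b))
    power-step k {A} {b} δ hA h₁ h₂ hk hE = *-cancelˡ A>0 (begin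
      A * E (λ x → (A + δ x) ^ k)  ≡⟨ E-* A _ ⟨
      E (λ x → A * (A + δ x) ^ k)  ≤⟨ E-mono (λ x s → power-taylor k hA (h₁ x s) (h₂ x s) hk) ⟩
      E (λ x → A ^ k * (A + K * δ x + v))  ≡⟨ E-* (A ^ k) _ ⟩
      A ^ k * E (λ x → A + K * δ x + v)  ≡⟨ cong (A ^ k *_) (E-cong λ x → lem₁ A K (δ x) v) ⟩
      A ^ k * E (λ x → A + v + K * δ x)  ≡⟨ cong (A ^ k *_) (E-affine (A + v) K δ) ⟩
      A ^ k * (A + v + K * E δ)  ≤⟨ *-monoˡ (^≥0 k (≤-trans 0≤1 hA)) (+-mono-≤ ≤-refl
                                                   (subst (K * E δ ≤_) (zeroʳ K) (*-monoˡ (⌜⌝≥0 k) hE))) ⟩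
      A ^ k * (A + v + 0ℚ)  ≡⟨ lem₂ A (A ^ k) (K * K * (b * b)) ⟩
      A * (A ^ k * (1ℚ + K * K * (b * b)))     ∎)
      where
      open ≤-Reasoning
      K = ⌜ k ⌝
      v = K * K * (b * b) * A
      A>0 = <-≤-trans 0<1 hA
      opaque
        unfolding _+_
        lem₁ : ∀ A K d v → A + K * d + v ≡ A + v + K * d
        lem₁ = solve-∀ ring
        lem₂ : ∀ A p v → p * (A + v * A + 0ℚ) ≡ A * (p * (1ℚ + v))
        lem₂ = solve-∀ ring

  open Dist

  card : ∀ {n} → (Fin n → Bool) → ℚ
  card G = sum (λ c → 𝟙 (G c))

  card>0 : ∀ {n} (G : Fin n → Bool) {c} → G c ≡ true → 0ℚ < card G
  card>0 G {c} p = <-≤-trans (subst (λ b → 0ℚ < 𝟙 b) (≡-sym p) 0<1) (term≤sum (λ i → 𝟙≥0 (G i)) c)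

  uniform : ∀ {n} (G : Fin n → Bool) {c} → G c ≡ true → Dist (Fin n)
  uniform {n} G {c₀} p = record
    { E = λ f → inv (card G) * sum (λ c → 𝟙 (G c) * f c)
    ; Supp = λ c → G c ≡ true
    ; E-mono = λ {f} {g} h → *-monoˡ i≥0 (sum-mono (mono-aux {f} {g} h))
    ; E-+ = λ f g → trans (cong (i *_) (trans (sum-cong λ c → distribˡ _ (f c) (g c)) (sum-+ _ _))) (distribˡ i _ _)
    ; E-* = λ a f → trans (cong (i *_) (trans (sum-cong λ c → l₁ (𝟙 (G c)) a (f c)) (sum-*ˡ a _)))
                      (l₁ i a _)
    ; E-1 = trans (cong (i *_) (sum-cong λ c → *-identityʳ _)) (inv-*ˡ g>0)
    ; E-swap = λ {Y} {L} lin f → trans (cong (i *_) (trans (sum-cong λ c → ≡-sym (Linear.lin-* lin (𝟙 (G c)) (f c)))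
                                    (≡-sym (Linear.lin-sum lin _)))) (≡-sym (Linear.lin-* lin i _))
    ; E-pick = pick
    }
    where
    i = inv (card G)
    g>0 = card>0 G p
    i≥0 = inv≥0 g>0
    opaque
      unfolding _+_
      l₁ : ∀ i a y → i * (a * y) ≡ a * (i * y)
      l₁ = solve-∀ ring
    mono-aux : ∀ {f g} → (∀ x → G x ≡ true → f x ≤ g x) → ∀ c → 𝟙 (G c) * f c ≤ 𝟙 (G c) * g c
    mono-aux {f} {g} h c with G c in eq
    ... | true = *-monoˡ 0≤1 (h c eq)
    ... | false = ≤-reflexive (trans (zeroˡ (f c)) (≡-sym (zeroˡ (g c))))
    pick : ∀ f {b} → i * sum (λ c → 𝟙 (G c) * f c) ≤ b → Σ (Fin n) λ x → (G x ≡ true) × f x ≤ b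
    pick f {b} h with any? (λ c → (G c 𝔹.≟ true) ×-dec (f c ≤? b))
    ... | yes (c , q) = c , q
    -- If `f` exceeded `b` on the whole support, its weighted sum would exceed `b * card G`,
    -- strictly so because of the point `c₀`.
    ... | no none = ⊥-elim (<-irrefl (<-≤-trans strict (≤-trans (*-monoˡ (<⇒≤ g>0) h) (≤-reflexive (*-comm _ b)))))
      where
      S = sum (λ c → 𝟙 (G c) * f c)
      big : ∀ c → G c ≡ true → b < f c
      big c q = ≰⇒> λ r → none (c , q , r)
      le : ∀ c → 𝟙 (G c) * b ≤ 𝟙 (G c) * f c
      le = mono-aux {λ _ → b} {f} λ c q → <⇒≤ (big c q)
      lt : 𝟙 (G c₀) * b < 𝟙 (G c₀) * f c₀
      lt = subst (λ x → 𝟙 x * b < 𝟙 x * f c₀) (≡-sym p) (*-monoˡ-< 0<1 (big c₀ p))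
      strict : b * card G < card G * (i * sum (λ c → 𝟙 (G c) * f c))
      strict = subst₂ _<_ (trans (sum-*ʳ (λ c → 𝟙 (G c)) b) (*-comm _ b))
        (≡-sym (trans (≡-sym (*-assoc (card G) i S)) (trans (cong (_* S) (inv-*ʳ g>0)) (*-identityˡ S))))
        (sum-< le c₀ lt)

  infixr 5 _⊗_
  _⊗_ : ∀ {X Y : Set} → Dist X → Dist Y → Dist (X × Y)
  _⊗_ {X} {Y} d e = record
    { E = λ f → E d (λ x → E e (λ y → f (x , y)))
    ; Supp = λ z → Supp d (proj₁ z) × Supp e (proj₂ z)
    ; E-mono = λ h → E-mono d λ x s → E-mono e λ y t → h (x , y) (s , t)
    ; E-+ = λ f g → trans (E-cong d λ x → E-+ e _ _) (E-+ d _ _)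
    ; E-* = λ c f → trans (E-cong d λ x → E-* e c _) (E-* d c _)
    ; E-1 = trans (E-cong d λ x → E-1 e) (E-1 d)
    ; E-swap = λ lin f → trans (E-cong d λ x → E-swap e lin (λ y → f (x , y))) (E-swap d lin _)
    ; E-pick = pick
    }
    where
    pick : ∀ f {b} → E d (λ x → E e (λ y → f (x , y))) ≤ b → Σ (X × Y) λ z → (Supp d (proj₁ z) × Supp e (proj₂ z)) × f z ≤ b
    pick f h with E-pick d (λ x → E e (λ y → f (x , y))) h
    ... | x , s , h′ with E-pick e (λ y → f (x , y)) h′
    ... | y , t , h″ = (x , y) , (s , t) , h″

  independent : ∀ {X : Set} {n} → (Fin n → Dist X) → Dist (Vec X n)
  independent {X} {zero} ds = record
    { E = λ f → f []
    ; Supp = λ _ → ⊤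
    ; E-mono = λ h → h [] tt
    ; E-+ = λ _ _ → refl
    ; E-* = λ _ _ → refl
    ; E-1 = refl
    ; E-swap = λ lin f → Linear.lin-cong lin λ _ → refl
    ; E-pick = λ f h → [] , tt , h
    }
  independent {X} {suc n} ds = record
    { E = λ f → E d (λ x → E e (λ y → f (x ∷ y)))
    ; Supp = supp
    ; E-mono = λ h → E-mono d λ x s → E-mono e λ y t → h (x ∷ y) (s , t)
    ; E-+ = λ f g → trans (E-cong d λ x → E-+ e _ _) (E-+ d _ _)
    ; E-* = λ c f → trans (E-cong d λ x → E-* e c _) (E-* d c _)
    ; E-1 = trans (E-cong d λ x → E-1 e) (E-1 d)
    ; E-swap = λ lin f → trans (E-cong d λ x → E-swap e lin (λ y → f (x ∷ y))) (E-swap d lin _)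
    ; E-pick = pick
    }
    where
    d = ds zero
    e = independent (ds ∘ suc)
    supp : Vec X (suc n) → Set
    supp (x ∷ y) = Supp d x × Supp e y
    pick : ∀ f {b} → E d (λ x → E e (λ y → f (x ∷ y))) ≤ b →
      Σ (Vec X (suc n)) λ z → supp z × f z ≤ b
    pick f h with E-pick d (λ x → E e (λ y → f (x ∷ y))) h
    ... | x , s , h′ with E-pick e (λ y → f (x ∷ y)) h′
    ... | y , t , h″ = (x ∷ y) , (s , t) , h″

  Supp-lookup : ∀ {X : Set} {n} (ds : Fin n → Dist X) ω → Supp (independent ds) ω → ∀ i → Supp (ds i) (lookup ω i)
  Supp-lookup ds (x ∷ ω) (s , t) zero = s
  Supp-lookup ds (x ∷ ω) (s , t) (suc i) = Supp-lookup (ds ∘ suc) ω t i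

  E-marginal : ∀ {X : Set} {n} (ds : Fin n → Dist X) i f → E (independent ds) (λ ω → f (lookup ω i)) ≡ E (ds i) f
  E-marginal ds zero f = E-cong (ds zero) λ x → E-const (independent (ds ∘ suc)) (f x)
  E-marginal ds (suc i) f = trans (E-const (ds zero) _) (E-marginal (ds ∘ suc) i f)

  -- Since `f x` ignores coordinate `i` of `ω`, that coordinate can be drawn separately and passed
  -- in as `x`. This is conditioning on one pick.
  E-resample : ∀ {X : Set} {n} (ds : Fin n → Dist X) i (f : X → Vec X n → ℚ) →
    (∀ x y ω → f x (ω [ i ]≔ y) ≡ f x ω) →
    E (independent ds) (λ ω → f (lookup ω i) ω) ≡ E (ds i) (λ x → E (independent ds) (f x))
  E-resample ds zero f h = E-cong (ds zero) λ x → ≡-sym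
    (trans (E-cong (ds zero) λ y → E-cong (independent (ds ∘ suc)) λ ω → ≡-sym (h x x (y ∷ ω)))
      (E-const (ds zero) _))
  E-resample ds (suc i) f h =
    trans (E-cong (ds zero) λ y → E-resample (ds ∘ suc) i (λ x ω → f x (y ∷ ω)) λ x z ω → h x z (y ∷ ω))
      (E-swap (ds zero) (linear (ds (suc i))) λ y x → E (independent (ds ∘ suc)) λ ω → f x (y ∷ ω))

  E-pair : ∀ {X : Set} {n} (ds : Fin n → Dist X) {i j} → i ≢ j → ∀ (f : X → X → ℚ) →
    E (independent ds) (λ ω → f (lookup ω i) (lookup ω j)) ≡ E (ds i) (λ x → E (ds j) (f x))
  E-pair ds {i} {j} i≢j f =
    trans (E-resample ds i (λ x ω → f x (lookup ω j))
             λ x y ω → cong (f x) (lookup∘updateAt′ j i (i≢j ∘ ≡-sym) ω))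
      (E-cong (ds i) λ x → E-marginal ds j (f x))

  E-product : ∀ {X : Set} {n} (ds : Fin n → Dist X) (h : Fin n → X → ℚ) →
    E (independent ds) (λ ω → product (λ i → h i (lookup ω i))) ≡ product (λ i → E (ds i) (h i))
  E-product {n = zero} ds h = trans (product-zero _) (≡-sym (product-zero _))
  E-product {n = suc n} ds h =
    trans (E-cong (ds zero) λ x → trans (E-cong e λ ω → product-suc _)
        (trans (E-* e (h zero x) _) (cong (h zero x *_) (E-product (ds ∘ suc) (h ∘ suc)))))
      (trans (E-*ʳ (ds zero) (h zero) _) (≡-sym (product-suc _)))
    where
    e = independent (ds ∘ suc)

  -- Concentration through k-th powers

  growth : ℕ → ℚ → ℚ
  growth k b = 1ℚ + ⌜ k ⌝ * ⌜ k ⌝ * (b * b)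

  1≤growth : ∀ k b → 1ℚ ≤ growth k b
  1≤growth k b = x≤x+y (*≥0 (sq≥0 ⌜ k ⌝) (sq≥0 b))

  -- Azuma's inequality, with x ↦ x ^ k in place of the exponential.
  azuma : ∀ {X : Set} {n} (ds : Fin n → Dist X) k (f : Vec X n → ℚ) (b : Fin n → ℚ) → (∀ ω → 1ℚ ≤ f ω) →
    (∀ i → ⌜ k ⌝ * b i ≤ 1ℚ) → (∀ i ω x y → f (ω [ i ]≔ x) - f (ω [ i ]≔ y) ≤ b i) →
    E (independent ds) (λ ω → f ω ^ k) ≤ E (independent ds) f ^ k * product (λ i → growth k (b i))
  azuma {n = zero} ds k f b _ _ _ = ≤-reflexive (≡-sym (trans (cong (_ *_) (product-zero _)) (*-identityʳ _)))
  azuma {X} {n = suc n} ds k f b f≥1 kb≤1 lip = begin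
    E d (λ x → E e (λ ω → f (x ∷ ω) ^ k))  ≤⟨ E-mono d (λ x _ → azuma (ds ∘ suc) k (λ ω → f (x ∷ ω)) (b ∘ suc)
                                                    (λ ω → f≥1 (x ∷ ω)) (kb≤1 ∘ suc) (λ i ω → lip (suc i) (x ∷ ω))) ⟩
    E d (λ x → m x ^ k * P)  ≡⟨ E-*ʳ d _ P ⟩
    E d (λ x → m x ^ k) * P  ≤⟨ *-monoʳ (product≥0 λ i → ≤-trans 0≤1 (1≤growth k (b (suc i)))) step ⟩
    M ^ k * growth k (b zero) * P  ≡⟨ *-assoc _ _ P ⟩
    M ^ k * (growth k (b zero) * P)  ≡⟨ cong (M ^ k *_) (product-suc _) ⟨
    M ^ k * product (λ i → growth k (b i))   ∎
    where
    open ≤-Reasoning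
    d = ds zero
    e = independent (ds ∘ suc)
    P = product (λ i → growth k (b (suc i)))
    -- The conditional mean given the first coordinate inherits the Lipschitz bound, so `m x - M` is
    -- a centred step of size at most `b zero`.
    m : X → ℚ
    m x = E e (λ ω → f (x ∷ ω))
    M = E d m
    m-lip : ∀ x y → m x - m y ≤ b zero
    m-lip x y = subst (_≤ b zero) eq (E≤ e λ ω _ → lip zero (x ∷ ω) x y)
      where
      opaque
        unfolding _+_
        l : ∀ x y → x + - 1ℚ * y ≡ x - y
        l = solve-∀ ring
      eq : E e (λ ω → f (x ∷ ω) - f (y ∷ ω)) ≡ m x - m y
      eq = trans (E-cong e λ ω → ≡-sym (l _ _)) (trans (E-+ e _ _) (trans (cong (m x +_) (E-* e (- 1ℚ) _)) (l _ _)))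
    above : ∀ x → m x - M ≤ b zero
    above x = subst (_≤ b zero) (E-minus d (m x) m) (E≤ d λ y _ → m-lip x y)
    below : ∀ x → - b zero ≤ m x - M
    below x = ≤-of-diff (l₂ (m x) M (b zero)) (diff≥0 (subst (_≤ b zero) (trans (E-cong d λ y → l₁ (m y) (m x))
                (trans (E-affine d (- m x) 1ℚ m) (≡-sym (l₁ M (m x))))) (E≤ d λ y _ → m-lip y x)))
      where
      opaque
        unfolding _+_
        l₁ : ∀ y x → y - x ≡ - x + 1ℚ * y
        l₁ = solve-∀ ring
        l₂ : ∀ x y b → (x - y) - (- b) ≡ b - (y - x)
        l₂ = solve-∀ ring
    mean : E d (λ x → m x - M) ≤ 0ℚ
    mean = ≤-reflexive (trans (E-cong d λ x → l₁ (m x) M) (trans (E-affine d (- M) 1ℚ m) (l₂ M)))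
      where
      opaque
        unfolding _+_
        l₁ : ∀ y x → y - x ≡ - x + 1ℚ * y
        l₁ = solve-∀ ring
        l₂ : ∀ x → - x + 1ℚ * x ≡ 0ℚ
        l₂ = solve-∀ ring
    step : E d (λ x → m x ^ k) ≤ M ^ k * growth k (b zero)
    step = subst (_≤ M ^ k * growth k (b zero)) (E-cong d λ x → cong (_^ k) (l M (m x)))
      (power-step d k (λ x → m x - M) (E≥ d λ x _ → E≥ e λ ω _ → f≥1 (x ∷ ω))
        (λ x _ → below x) (λ x _ → above x) (kb≤1 zero) mean)
      where
      opaque
        unfolding _+_
        l : ∀ M x → M + (x - M) ≡ x
        l = solve-∀ ring

  -- Subsets of the palette

  _∩_ : ∀ {q} → (Fin q → Bool) → (Fin q → Bool) → Fin q → Bool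
  (F ∩ H) x = F x ∧ H x

  _∖_ : ∀ {q} → (Fin q → Bool) → Fin q → Fin q → Bool
  (F ∖ c) x = F x ∧ not ⌊ x Fin.≟ c ⌋

  𝟙-∧ : ∀ a b → 𝟙 (a ∧ b) ≡ 𝟙 a * 𝟙 b
  𝟙-∧ true b = ≡-sym (*-identityˡ _)
  𝟙-∧ false b = ≡-sym (zeroˡ _)

  𝟙-not : ∀ a → 𝟙 (not a) ≡ 1ℚ - 𝟙 a
  𝟙-not true = lem
    where
    opaque
      unfolding _+_
      lem : 0ℚ ≡ 1ℚ - 1ℚ
      lem = solve-∀ ring
  𝟙-not false = lem
    where
    opaque
      unfolding _+_
      lem : 1ℚ ≡ 1ℚ - 0ℚ
      lem = solve-∀ ring

  sum-δ : ∀ {n} (c : Fin n) (f : Fin n → ℚ) → sum (λ x → 𝟙 ⌊ x Fin.≟ c ⌋ * f x) ≡ f c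
  sum-δ {suc n} zero f = trans (sum-suc _) (trans (cong₂ _+_ (*-identityˡ (f zero))
    (trans (sum-cong λ i → zeroˡ _) (trans (sum-const n 0ℚ) (zeroʳ _)))) (+-identityʳ _))
  sum-δ {suc n} (suc c) f = trans (sum-suc _) (trans (cong₂ _+_ (zeroˡ (f zero))
    (trans (sum-cong λ i → cong (λ b → 𝟙 b * f (suc i)) (lem i)) (sum-δ c (f ∘ suc)))) (+-identityˡ _))
    where
    lem : ∀ i → ⌊ suc i Fin.≟ suc c ⌋ ≡ ⌊ i Fin.≟ c ⌋
    lem i with i Fin.≟ c
    ... | yes refl = refl
    ... | no _ = refl

  card≥0 : ∀ {n} (F : Fin n → Bool) → 0ℚ ≤ card F
  card≥0 F = sum≥0 λ x → 𝟙≥0 (F x)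

  card-cong : ∀ {n} {F H : Fin n → Bool} → (∀ x → F x ≡ H x) → card F ≡ card H
  card-cong h = sum-cong λ x → cong 𝟙 (h x)

  card-∩≤ : ∀ {q} (F H : Fin q → Bool) → card (F ∩ H) ≤ card F
  card-∩≤ F H = sum-mono λ x → subst (_≤ 𝟙 (F x)) (≡-sym (𝟙-∧ (F x) (H x)))
    (subst (𝟙 (F x) * 𝟙 (H x) ≤_) (*-identityʳ _) (*-monoˡ (𝟙≥0 (F x)) (𝟙≤1 (H x))))

  ∩-comm : ∀ {q} (F H : Fin q → Bool) x → (F ∩ H) x ≡ (H ∩ F) x
  ∩-comm F H x = 𝔹P.∧-comm (F x) (H x)

  card-∖∩ : ∀ {q} (F H : Fin q → Bool) c → F c ≡ true → card ((F ∖ c) ∩ H) ≡ card (F ∩ H) - 𝟙 (H c)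
  card-∖∩ F H c Fc = trans (sum-cong pointwise) (trans (sum-+ _ _) (trans (cong (card (F ∩ H) +_)
      (trans (sum-*ˡ (- 1ℚ) _) (cong (- 1ℚ *_) (trans (sum-δ c (λ x → 𝟙 (F x ∧ H x))) (cong (λ b → 𝟙 (b ∧ H c)) Fc)))))
      (lem (card (F ∩ H)) (𝟙 (H c)))))
    where
    opaque
      unfolding _+_
      lem : ∀ a b → a + - 1ℚ * b ≡ a - b
      lem = solve-∀ ring
      l₁ : ∀ f h → f * (1ℚ - 1ℚ) * h ≡ f * h + - 1ℚ * (1ℚ * (f * h))
      l₁ = solve-∀ ring
      l₂ : ∀ f h → f * (1ℚ - 0ℚ) * h ≡ f * h + - 1ℚ * (0ℚ * (f * h))
      l₂ = solve-∀ ring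
    pointwise : ∀ x → 𝟙 (((F ∖ c) ∩ H) x) ≡ 𝟙 ((F ∩ H) x) + - 1ℚ * (𝟙 ⌊ x Fin.≟ c ⌋ * 𝟙 (F x ∧ H x))
    pointwise x rewrite 𝟙-∧ (F x ∧ not ⌊ x Fin.≟ c ⌋) (H x) | 𝟙-∧ (F x) (not ⌊ x Fin.≟ c ⌋)
      | 𝟙-∧ (F x) (H x) | 𝟙-not ⌊ x Fin.≟ c ⌋ with x Fin.≟ c
    ... | yes _ = l₁ _ _
    ... | no _ = l₂ _ _

  card-∩-true : ∀ {q} (F : Fin q → Bool) → card (F ∩ λ _ → true) ≡ card F
  card-∩-true F = sum-cong λ x → cong 𝟙 (𝔹P.∧-identityʳ (F x))

  card-∖ : ∀ {q} (F : Fin q → Bool) c → F c ≡ true → card (F ∖ c) ≡ card F - 1ℚ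
  card-∖ F c Fc = trans (≡-sym (card-∩-true (F ∖ c)))
    (trans (card-∖∩ F (λ _ → true) c Fc) (cong (_- 1ℚ) (card-∩-true F)))

  count : ∀ {n} → (Fin n → Bool) → ℕ
  count {zero} S = 0
  count {suc n} S = (if S zero then 1 else 0) ℕ.+ count (S ∘ suc)

  card≡count : ∀ {n} (S : Fin n → Bool) → card S ≡ ⌜ count S ⌝
  card≡count {zero} S = sum-zero _
  card≡count {suc n} S = trans (sum-suc _) (trans (cong₂ _+_ (lem (S zero)) (card≡count (S ∘ suc)))
    (≡-sym (⌜⌝-+ (if S zero then 1 else 0) _)))
    where
    lem : ∀ b → 𝟙 b ≡ ⌜ if b then 1 else 0 ⌝
    lem true = ≡-sym (+-identityʳ 1ℚ)
    lem false = refl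

  product-if : ∀ {n} (S : Fin n → Bool) x → product (λ i → if S i then x else 1ℚ) ≡ x ^ count S
  product-if {zero} S x = product-zero _
  product-if {suc n} S x = trans (product-suc _) (trans (cong ((if S zero then x else 1ℚ) *_) (product-if (S ∘ suc) x)) (lem (S zero)))
    where
    lem : ∀ b → (if b then x else 1ℚ) * x ^ count (S ∘ suc) ≡ x ^ ((if b then 1 else 0) ℕ.+ count (S ∘ suc))
    lem true = refl
    lem false = *-identityˡ _

  -- The normalised intersection size of two palettes: a martingale, close to 1 for independent random palettes.
  overlapRatio : ∀ {q} → (F H : Fin q → Bool) → ℚ
  overlapRatio {q} F H = ⌜ q ⌝ * (card (F ∩ H) * (inv (card F) * inv (card H)))

  overlapRatio-comm : ∀ {q} (F H : Fin q → Bool) → overlapRatio F H ≡ overlapRatio H F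
  overlapRatio-comm {q} F H = cong (⌜ q ⌝ *_) (cong₂ _*_ (card-cong (∩-comm F H)) (*-comm _ _))

  overlapRatio≥0 : ∀ {q} (F H : Fin q → Bool) → 0ℚ < card F → 0ℚ < card H → 0ℚ ≤ overlapRatio F H
  overlapRatio≥0 {q} F H f h = *≥0 (⌜⌝≥0 q) (*≥0 (card≥0 (F ∩ H)) (*≥0 (inv≥0 f) (inv≥0 h)))

  -- Removing a uniform element of `F` scales both |F| and the mean of |F ∩ H| by 1 - 1/|F|, so the
  -- ratio keeps its mean. The change `δ c` equals q / ((|F| - 1) |H|) times |F ∩ H| / |F| - 𝟙 (H
  -- c); the second factor lies in [-1, 1] and the first is at most q / g², hence at most `b`.
  module _ {q} (F H : Fin q → Bool) {c₀} (Fc₀ : F c₀ ≡ true) {g b : ℚ} (g>0 : 0ℚ < g)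
    (F≥ : g ≤ card F - 1ℚ) (H≥ : g ≤ card H) (q≤b : ⌜ q ⌝ ≤ b * (g * g)) where

    private
      f = card F
      h = card H
      a = card (F ∩ H)
      f′ = f - 1ℚ
      Q = ⌜ q ⌝
      ih = inv h
      iF = inv f
      iF′ = inv f′

      f′>0 : 0ℚ < f′
      f′>0 = <-≤-trans g>0 F≥
      f>0 : 0ℚ < f
      f>0 = <-≤-trans f′>0 (x-1≤x f)
      h>0 : 0ℚ < h
      h>0 = <-≤-trans g>0 H≥

      opaque
        unfolding _+_
        f-f′ : ∀ f i → f * i ≡ (f - 1ℚ) * i + i
        f-f′ = solve-∀ ring
      iF′-eq : f * iF′ ≡ 1ℚ + iF′
      iF′-eq = trans (f-f′ f iF′) (cong (_+ iF′) (inv-*ʳ f′>0))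

      iF′≥iF : iF ≤ iF′
      iF′≥iF = inv-anti f′>0 (x-1≤x f)

      δ : Fin q → ℚ
      δ c = Q * ((a - 𝟙 (H c)) * (iF′ * ih)) - overlapRatio F H

      small : Q * (iF′ * ih) ≤ b
      small = ≤-trans (*-monoʳ (*≥0 (inv≥0 f′>0) (inv≥0 h>0)) q≤b)
        (≤-trans (*-monoˡ b*g²≥0 (*-mono (inv≥0 g>0) (inv≥0 h>0) (inv-anti g>0 F≥) (inv-anti g>0 H≥)))
          (≤-reflexive (trans (l b g (inv g)) (trans (cong (λ x → b * (x * x)) (inv-*ʳ g>0)) (l₁ b)))))
        where
        b*g²≥0 = ≤-trans (⌜⌝≥0 q) q≤b
        opaque
          unfolding _+_
          l : ∀ b g i → b * (g * g) * (i * i) ≡ b * ((g * i) * (g * i))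
          l = solve-∀ ring
          l₁ : ∀ b → b * (1ℚ * 1ℚ) ≡ b
          l₁ = solve-∀ ring

      Qi≥0 : 0ℚ ≤ Q * (iF′ * ih)
      Qi≥0 = *≥0 (⌜⌝≥0 q) (*≥0 (inv≥0 f′>0) (inv≥0 h>0))

      δ≤ : ∀ c → δ c ≤ b
      δ≤ c = ≤-trans (≤-of-diff
        (trans (l Q a f iF iF′ ih (𝟙 (H c)))
          (cong₂ (λ x y → Q * (iF′ * ih) * (1ℚ - a * iF) + Q * ih * (a * ((1ℚ + iF′ - x) * iF + (y - 1ℚ) * iF′)) + 𝟙 (H c) * (Q * (iF′ * ih)))
            iF′-eq (inv-*ʳ f>0)))
        (+≥0 (+≥0 (*≥0 Qi≥0 (diff≥0 (inv-≤ f>0 (subst (a ≤_) (≡-sym (*-identityˡ f)) (card-∩≤ F H)))))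
          (≤-reflexive (l₀ Q ih a iF iF′))) (*≥0 (𝟙≥0 (H c)) Qi≥0))) small
        where
        opaque
          unfolding _+_
          l : ∀ Q a f i i′ h x → Q * (i′ * h) - (Q * ((a - x) * (i′ * h)) - Q * (a * (i * h))) ≡
                  Q * (i′ * h) * (1ℚ - a * i) + Q * h * (a * ((1ℚ + i′ - f * i′) * i + (f * i - 1ℚ) * i′)) + x * (Q * (i′ * h))
          l = solve-∀ ring
          l₀ : ∀ Q h a i i′ → 0ℚ ≡ Q * h * (a * ((1ℚ + i′ - (1ℚ + i′)) * i + (1ℚ - 1ℚ) * i′))
          l₀ = solve-∀ ring

      δ≥ : ∀ c → - b ≤ δ c
      δ≥ c = ≤-of-diff (l Q a iF iF′ ih b (𝟙 (H c)))
        (+≥0 (+≥0 (diff≥0 small) (*≥0 Qi≥0 (diff≥0 (𝟙≤1 (H c)))))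
          (*≥0 (*≥0 (⌜⌝≥0 q) (inv≥0 h>0)) (*≥0 (card≥0 (F ∩ H)) (diff≥0 iF′≥iF))))
        where
        opaque
          unfolding _+_
          l : ∀ Q a i i′ h b x → Q * ((a - x) * (i′ * h)) - Q * (a * (i * h)) - (- b) ≡
                  b - Q * (i′ * h) + Q * (i′ * h) * (1ℚ - x) + Q * h * (a * (i′ - i))
          l = solve-∀ ring

      mean : E (uniform F Fc₀) δ ≤ 0ℚ
      mean = ≤-reflexive (trans (E-cong u λ c → l₁ Q a iF iF′ ih (𝟙 (H c)))
        (trans (E-affine u (Q * (a * (iF′ * ih)) - Q * (a * (iF * ih))) (- (Q * (iF′ * ih))) (λ c → 𝟙 (H c)))
        (trans (cong (λ e → Q * (a * (iF′ * ih)) - Q * (a * (iF * ih)) + - (Q * (iF′ * ih)) * (iF * e)) (sum-cong λ c → ≡-sym (𝟙-∧ (F c) (H c))))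
        (trans (l₂ Q a f iF iF′ ih) (trans (cong₂ (λ x y → Q * ih * (a * ((x - 1ℚ - iF′) * iF + (1ℚ - y) * iF′))) iF′-eq (inv-*ʳ f>0)) (l₃ Q ih a iF iF′))))))
        where
        u = uniform F Fc₀
        opaque
          unfolding _+_
          l₁ : ∀ Q a i i′ h x → Q * ((a - x) * (i′ * h)) - Q * (a * (i * h)) ≡ Q * (a * (i′ * h)) - Q * (a * (i * h)) + - (Q * (i′ * h)) * x
          l₁ = solve-∀ ring
          l₂ : ∀ Q a f i i′ h → Q * (a * (i′ * h)) - Q * (a * (i * h)) + - (Q * (i′ * h)) * (i * a) ≡
                   Q * h * (a * ((f * i′ - 1ℚ - i′) * i + (1ℚ - f * i) * i′))
          l₂ = solve-∀ ring
          l₃ : ∀ Q h a i i′ → Q * h * (a * ((1ℚ + i′ - 1ℚ - i′) * i + (1ℚ - 1ℚ) * i′)) ≡ 0ℚ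
          l₃ = solve-∀ ring

    -- The summand 1 keeps the base of the power at least 1, as `power-step` demands.
    overlapRatio-step : ∀ k → ⌜ k ⌝ * b ≤ 1ℚ →
      E (uniform F Fc₀) (λ c → (1ℚ + overlapRatio (F ∖ c) H) ^ k) ≤ (1ℚ + overlapRatio F H) ^ k * growth k b
    overlapRatio-step k kb≤1 = subst (_≤ (1ℚ + overlapRatio F H) ^ k * growth k b) (E-cong-Supp (uniform F Fc₀) λ c Fc → cong (_^ k) (eq c Fc))
      (power-step (uniform F Fc₀) k δ (x≤x+y (overlapRatio≥0 F H f>0 h>0))
        (λ c _ → δ≥ c) (λ c _ → δ≤ c) kb≤1 mean)
      where
      opaque
        unfolding _+_
        l₁ : ∀ o m → 1ℚ + o + (m - o) ≡ 1ℚ + m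
        l₁ = solve-∀ ring
      eq : ∀ c → F c ≡ true → 1ℚ + overlapRatio F H + δ c ≡ 1ℚ + overlapRatio (F ∖ c) H
      eq c Fc = trans (l₁ (overlapRatio F H) _) (cong (1ℚ +_)
        (≡-sym (cong₂ (λ x y → Q * (x * (inv y * ih))) (card-∖∩ F H c Fc) (card-∖ F c Fc))))

  -- Loss probability at one arrival

  ∧-true : ∀ {a b} → a ∧ b ≡ true → a ≡ true × b ≡ true
  ∧-true {true} {true} _ = refl , refl

  ⌊⌋-true : ∀ {P : Set} (d : Dec P) → P → ⌊ d ⌋ ≡ true
  ⌊⌋-true (yes _) _ = refl
  ⌊⌋-true (no ¬p) p = ⊥-elim (¬p p)

  true-⌊⌋ : ∀ {P : Set} (d : Dec P) → ⌊ d ⌋ ≡ true → P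
  true-⌊⌋ (yes p) _ = p

  ⌊⌋-false : ∀ {P : Set} (d : Dec P) → ¬ P → ⌊ d ⌋ ≡ false
  ⌊⌋-false (yes p) ¬p = ⊥-elim (¬p p)
  ⌊⌋-false (no _) _ = refl

  not-true : ∀ {a} → not a ≡ true → a ≡ false
  not-true {false} _ = refl

  -- A colour and a priority; lower priorities win, and ties lose on both sides.
  Pick : ℕ → ℕ → Set
  Pick q R = Fin q × Fin R

  -- At a node with neighbourhood S, the pick y of u′ makes u lose its pick x.
  beats : ∀ {n q R} → (Fin n → Bool) → Fin n → Fin n → Pick q R → Pick q R → Bool
  beats S u u′ x y = (not ⌊ u′ Fin.≟ u ⌋ ∧ S u′) ∧ (⌊ proj₁ y Fin.≟ proj₁ x ⌋ ∧ ⌊ toℕ (proj₂ y) ℕ.≤? toℕ (proj₂ x) ⌋)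

  lost : ∀ {n q R} → (Fin n → Bool) → Fin n → Vec (Pick q R) n → Bool
  lost S u ω = ⌊ any? (λ u′ → beats S u u′ (lookup ω u) (lookup ω u′) 𝔹.≟ true) ⌋

  -- The pick `x` of `u` is a separate argument, although it will be `lookup ω u`: as `u` is not its
  -- own rival, the product then ignores coordinate `u` of `ω`, which is the hypothesis of
  -- `E-resample`.
  survive : ∀ {n q R} → (Fin n → Bool) → Fin n → Pick q R → Vec (Pick q R) n → ℚ
  survive S u x ω = product (λ u′ → 1ℚ - 𝟙 (beats S u u′ x (lookup ω u′)))

  1-𝟙≥0 : ∀ b → 0ℚ ≤ 1ℚ - 𝟙 b
  1-𝟙≥0 b = diff≥0 (𝟙≤1 b)

  product-0 : ∀ {n} (f : Fin n → ℚ) i → f i ≡ 0ℚ → product f ≡ 0ℚ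
  product-0 f zero h = trans (product-suc f) (trans (cong (_* product (f ∘ suc)) h) (zeroˡ _))
  product-0 f (suc i) h = trans (product-suc f) (trans (cong (f zero *_) (product-0 (f ∘ suc) i h)) (zeroʳ _))

  opaque
    unfolding _+_
    1-1 : 1ℚ - 1ℚ ≡ 0ℚ
    1-1 = solve-∀ ring
    1-0 : 1ℚ - 0ℚ ≡ 1ℚ
    1-0 = solve-∀ ring

  survive≡ : ∀ {n q R} (S : Fin n → Bool) u (ω : Vec (Pick q R) n) →
    survive S u (lookup ω u) ω ≡ 1ℚ - 𝟙 (lost S u ω)
  survive≡ {n} S u ω with any? (λ u′ → beats S u u′ (lookup ω u) (lookup ω u′) 𝔹.≟ true)
  ... | yes (u′ , p) = trans (product-0 _ u′ (trans (cong (λ b → 1ℚ - 𝟙 b) p) 1-1)) (≡-sym 1-1)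
  ... | no none = trans (product-cong one) (trans (product-1 n) (≡-sym 1-0))
    where
    one : ∀ u′ → 1ℚ - 𝟙 (beats S u u′ (lookup ω u) (lookup ω u′)) ≡ 1ℚ
    one u′ with beats S u u′ (lookup ω u) (lookup ω u′) in eq
    ... | true = ⊥-elim (none (u′ , eq))
    ... | false = 1-0

  sum-≤ᵇ : ∀ R m → m ℕ.< R → sum {R} (λ j → 𝟙 ⌊ toℕ j ℕ.≤? m ⌋) ≡ ⌜ suc m ⌝
  sum-≤ᵇ (suc R) zero p = trans (sum-suc _) (cong (1ℚ +_) (trans (sum-cong λ j → cong 𝟙 (⌊⌋-false (suc (toℕ j) ℕ.≤? 0) λ ()))
    (trans (sum-const R 0ℚ) (zeroʳ _))))
  sum-≤ᵇ (suc R) (suc m) (ℕ.s≤s p) = trans (sum-suc _) (cong (1ℚ +_) (trans (sum-cong λ j → cong 𝟙 (lem j)) (sum-≤ᵇ R m p)))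
    where
    lem : ∀ (j : Fin R) → ⌊ suc (toℕ j) ℕ.≤? suc m ⌋ ≡ ⌊ toℕ j ℕ.≤? m ⌋
    lem j with toℕ j ℕ.≤? m
    ... | yes p = ⌊⌋-true (suc (toℕ j) ℕ.≤? suc m) (ℕ.s≤s p)
    ... | no ¬p = ⌊⌋-false (suc (toℕ j) ℕ.≤? suc m) λ { (ℕ.s≤s p) → ¬p p }

  geometric : ∀ a R → (1ℚ - a) * sum {R} (λ j → a ^ suc (toℕ j)) ≡ a * (1ℚ - a ^ R)
  geometric a zero = trans (cong ((1ℚ - a) *_) (sum-zero _)) (lem a)
    where
    opaque
      unfolding _+_
      lem : ∀ a → (1ℚ - a) * 0ℚ ≡ a * (1ℚ - 1ℚ)
      lem = solve-∀ ring
  geometric a (suc R) = trans (cong ((1ℚ - a) *_) (trans (sum-suc _) (cong (a * 1ℚ +_) (sum-*ˡ a _))))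
    (trans (l₁ a _) (trans (cong (λ x → a * (1ℚ - a) + a * x) (geometric a R)) (l₂ a (a ^ R))))
    where
    opaque
      unfolding _+_
      l₁ : ∀ a s → (1ℚ - a) * (a * 1ℚ + a * s) ≡ a * (1ℚ - a) + a * ((1ℚ - a) * s)
      l₁ = solve-∀ ring
      l₂ : ∀ a p → a * (1ℚ - a) + a * (a * (1ℚ - p)) ≡ a * (1ℚ - a * p)
      l₂ = solve-∀ ring

  all-true : ∀ {n} → Fin n → Bool
  all-true _ = true

  card-all : ∀ n → card (all-true {n}) ≡ ⌜ n ⌝
  card-all n = trans (sum-const n 1ℚ) (*-identityʳ _)

  pickDist : ∀ {q} R (F : Fin q → Bool) {c} → F c ≡ true → Dist (Pick q (suc R))
  pickDist R F p = uniform F p ⊗ uniform all-true {zero} refl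

  uniform-δ : ∀ {n} (F : Fin n → Bool) {c₀} (p : F c₀ ≡ true) c → E (uniform F p) (λ x → 𝟙 ⌊ x Fin.≟ c ⌋) ≡ 𝟙 (F c) * inv (card F)
  uniform-δ F p c = trans (cong (inv (card F) *_) (trans (sum-cong λ x → *-comm (𝟙 (F x)) _) (sum-δ c (λ x → 𝟙 (F x)))))
    (*-comm _ _)

  module Loss {n q} (R′ : ℕ) (F : Fin n → Fin q → Bool) (w : Fin n → Fin q) (Fw : ∀ u → F u (w u) ≡ true)
    (S : Fin n → Bool) {D : ℕ} (S≤D : card S ≤ ⌜ D ⌝) {g ε : ℚ} (1≤g : 1ℚ ≤ g) (F≥g : ∀ u → g ≤ card (F u))
    (q>0 : 0ℚ < ⌜ q ⌝) (D≤q : (1ℚ + ε) * ⌜ D ⌝ ≤ ⌜ q ⌝) (1+ε≥0 : 0ℚ ≤ 1ℚ + ε)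
    (overlap≤ : ∀ u u′ → u ≢ u′ → overlapRatio (F u) (F u′) ≤ 1ℚ + ε) where

    private
      R = suc R′
      iR = inv ⌜ R ⌝
      a = 1ℚ - iR
      ig = inv g
      g>0 = <-≤-trans 0<1 1≤g
      F>0 : ∀ u → 0ℚ < card (F u)
      F>0 u = <-≤-trans g>0 (F≥g u)
      R>0 : 0ℚ < ⌜ R ⌝
      R>0 = +>0 0<1 (⌜⌝≥0 R′)

      prio : Dist (Fin R)
      prio = uniform all-true {zero} refl

    picks : Fin n → Dist (Pick q R)
    picks u = pickDist R′ (F u) (Fw u)

    private
      iR≤1 : iR ≤ 1ℚ
      iR≤1 = subst (_≤ 1ℚ) (*-identityˡ iR) (inv-≤ R>0 (≤-of-diff (l ⌜ R′ ⌝) (⌜⌝≥0 R′)))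
        where
        opaque
          unfolding _+_
          l : ∀ r → 1ℚ * (1ℚ + r) - 1ℚ ≡ r
          l = solve-∀ ring
      iR≥0 = inv≥0 R>0

      rival : Fin n → Fin n → Bool
      rival u u′ = not ⌊ u′ Fin.≟ u ⌋ ∧ S u′

      -- The probability that `u′` competes with `u` and draws the colour `c`.
      p : Fin n → Fin n → Fin q → ℚ
      p u u′ c = 𝟙 (rival u u′) * (𝟙 (F u′ c) * inv (card (F u′)))

      p≥0 : ∀ u u′ c → 0ℚ ≤ p u u′ c
      p≥0 u u′ c = *≥0 (𝟙≥0 (rival u u′)) (*≥0 (𝟙≥0 (F u′ c)) (inv≥0 (F>0 u′)))

      p≤ : ∀ u u′ c → p u u′ c ≤ 𝟙 (S u′) * ig
      p≤ u u′ c = *-mono (𝟙≥0 (S u′)) (*≥0 (𝟙≥0 (F u′ c)) (inv≥0 (F>0 u′)))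
        (subst (_≤ 𝟙 (S u′)) (≡-sym (𝟙-∧ (not ⌊ u′ Fin.≟ u ⌋) (S u′))) (subst (𝟙 (not ⌊ u′ Fin.≟ u ⌋) * 𝟙 (S u′) ≤_) (*-identityˡ _)
          (*-monoʳ (𝟙≥0 (S u′)) (𝟙≤1 (not ⌊ u′ Fin.≟ u ⌋)))))
        (subst (𝟙 (F u′ c) * inv (card (F u′)) ≤_) (*-identityˡ _)
          (*-mono 0≤1 (inv≥0 (F>0 u′)) (𝟙≤1 (F u′ c)) (inv-anti g>0 (F≥g u′))))

      ig≤1 : ig ≤ 1ℚ
      ig≤1 = subst (_≤ 1ℚ) (*-identityˡ ig) (inv-≤ g>0 (subst (1ℚ ≤_) (≡-sym (*-identityˡ g)) 1≤g))

      p≤1 : ∀ u u′ c → p u u′ c ≤ 1ℚ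
      p≤1 u u′ c = ≤-trans (p≤ u u′ c) (subst (𝟙 (S u′) * ig ≤_) (*-identityˡ 1ℚ) (*-mono 0≤1 (inv≥0 g>0) (𝟙≤1 (S u′)) ig≤1))

      -- Colour and priority are independent, and if `x` has priority number τ, then τ + 1 of the
      -- `R` priorities beat or tie it.
      E-beats : ∀ u u′ x → E (picks u′) (λ y → 1ℚ - 𝟙 (beats S u u′ x y)) ≡
        1ℚ - ⌜ suc (toℕ (proj₂ x)) ⌝ * (p u u′ (proj₁ x) * iR)
      E-beats u u′ x = trans (E-minus (picks u′) 1ℚ _) (cong (λ t → 1ℚ - t) (trans (E-cong (picks u′) λ y →
          trans (𝟙-∧ (rival u u′) _) (cong (𝟙 (rival u u′) *_) (𝟙-∧ ⌊ proj₁ y Fin.≟ proj₁ x ⌋ _)))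
        (trans (E-* (picks u′) (𝟙 (rival u u′)) _) (trans (cong (𝟙 (rival u u′) *_)
          (trans (E-cong uc λ c′ → E-* prio (𝟙 ⌊ c′ Fin.≟ proj₁ x ⌋) _)
          (trans (E-*ʳ uc _ _) (cong₂ _*_ (uniform-δ (F u′) (Fw u′) (proj₁ x)) E-prio))))
          (l _ (𝟙 (F u′ (proj₁ x))) (inv (card (F u′))) iR ⌜ suc (toℕ (proj₂ x)) ⌝)))))
        where
        uc = uniform (F u′) (Fw u′)
        opaque
          unfolding _+_
          l : ∀ t f i r m → t * (f * i * (r * m)) ≡ m * (t * (f * i) * r)
          l = solve-∀ ring
        E-prio : E prio (λ τ → 𝟙 ⌊ toℕ τ ℕ.≤? toℕ (proj₂ x) ⌋) ≡ iR * ⌜ suc (toℕ (proj₂ x)) ⌝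
        E-prio = cong₂ _*_ (cong inv (card-all R)) (trans (sum-cong λ τ → *-identityˡ _)
          (sum-≤ᵇ R (toℕ (proj₂ x)) (FinP.toℕ<n (proj₂ x))))

      -- The survival probability of a draw of `c` at the best priority. For priority number m - 1
      -- it is nearly the power `z u c ^ m`, and powers of a single random quantity are accessible
      -- to Jensen's inequality.
      z : Fin n → Fin q → ℚ
      z u c = product (λ u′ → 1ℚ - p u u′ c * iR)

      y≥0 : ∀ u u′ c → 0ℚ ≤ p u u′ c * iR
      y≥0 u u′ c = *≥0 (p≥0 u u′ c) iR≥0
      y≤1 : ∀ u u′ c → p u u′ c * iR ≤ 1ℚ
      y≤1 u u′ c = subst (p u u′ c * iR ≤_) (*-identityˡ 1ℚ) (*-mono 0≤1 iR≥0 (p≤1 u u′ c) iR≤1)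

      z≥0 : ∀ u c → 0ℚ ≤ z u c
      z≥0 u c = product≥0 λ u′ → diff≥0 (y≤1 u u′ c)

      err : ℚ
      err = ⌜ D ⌝ * (ig * ig)

      -- Factor by factor, (1 - y)^m exceeds 1 - m y by at most (m y)², where m y ≤ p ≤ 𝟙 (S u′) /
      -- g. At most D rivals contribute, and `product-lower` adds up the differences.
      survive-lower : ∀ u c m → m ℕ.≤ R → z u c ^ m - err ≤ product (λ u′ → 1ℚ - ⌜ m ⌝ * (p u u′ c * iR))
      survive-lower u c m m≤R = ≤-trans
        (≤-trans (≤-of-diff (l₁ (z u c ^ m) err _) (diff≥0 sum≤)) (≤-reflexive (cong₂ _-_ (≡-sym (product-^ _ m)) refl)))
        (product-lower (λ u′ → 1ℚ - ⌜ m ⌝ * (p u u′ c * iR)) (λ u′ → (1ℚ - p u u′ c * iR) ^ m)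
          (λ u′ → diff≥0 (≤-trans (my≤p u′) (p≤1 u u′ c))) (λ u′ → bernoulli⁻ _ m (y≥0 u u′ c) (y≤1 u u′ c))
          (λ u′ → ^≤1 m (diff≥0 (y≤1 u u′ c)) (1-x≤1 (y≥0 u u′ c))))
        where
        opaque
          unfolding _+_
          l₁ : ∀ z e s → z - s - (z - e) ≡ e - s
          l₁ = solve-∀ ring
        my≤p : ∀ u′ → ⌜ m ⌝ * (p u u′ c * iR) ≤ p u u′ c
        my≤p u′ = subst (_≤ p u u′ c) (l (p u u′ c) iR ⌜ m ⌝) (inv-≤ R>0 (*-monoˡ (p≥0 u u′ c) (⌜⌝-mono m≤R)))
          where
          opaque
            unfolding _+_
            l : ∀ p i m → p * m * i ≡ m * (p * i)
            l = solve-∀ ring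
        taylor : ∀ u′ → (1ℚ - p u u′ c * iR) ^ m - (1ℚ - ⌜ m ⌝ * (p u u′ c * iR)) ≤ 𝟙 (S u′) * (ig * ig)
        taylor u′ = ≤-trans (≤-of-diff (l₃ (y) ⌜ m ⌝ ((1ℚ - y) ^ m)) (diff≥0 (subst₂ _≤_ (trans (*-identityˡ _) (cong (_^ m) (l₁′ y))) (trans (cong₂ _*_ (1^ m) refl) (*-identityˡ _))
            (power-taylor m {1ℚ} { - y} {y} ≤-refl ≤-refl (≤-of-diff (l₂ y) (+≥0 (y≥0 u u′ c) (y≥0 u u′ c))) (≤-trans (my≤p u′) (p≤1 u u′ c))))))
          (≤-trans (*-mono (p≥0 u u′ c) (*≥0 (⌜⌝≥0 m) (y≥0 u u′ c)) (my≤p u′) (my≤p u′))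
          (≤-trans (*-mono (*≥0 (𝟙≥0 (S u′)) (inv≥0 g>0)) (p≥0 u u′ c) (p≤ u u′ c) (p≤ u u′ c)) (idem (S u′))))
          where
          y = p u u′ c * iR
          opaque
            unfolding _+_
            l₁′ : ∀ y → 1ℚ + - y ≡ 1ℚ - y
            l₁′ = solve-∀ ring
            l₂ : ∀ y → y - (- y) ≡ y + y
            l₂ = solve-∀ ring
            l₃ : ∀ y m t → m * y * (m * y) - (t - (1ℚ - m * y)) ≡ (1ℚ + m * - y + m * m * (y * y) * 1ℚ) - t
            l₃ = solve-∀ ring
            l₄ : ∀ i → 1ℚ * i * (1ℚ * i) ≡ 1ℚ * (i * i)
            l₄ = solve-∀ ring
            l₅ : ∀ i → 0ℚ * i * (0ℚ * i) ≡ 0ℚ * (i * i)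
            l₅ = solve-∀ ring
          idem : ∀ b → 𝟙 b * ig * (𝟙 b * ig) ≤ 𝟙 b * (ig * ig)
          idem true = ≤-reflexive (l₄ ig)
          idem false = ≤-reflexive (l₅ ig)
        sum≤ : sum (λ u′ → (1ℚ - p u u′ c * iR) ^ m - (1ℚ - ⌜ m ⌝ * (p u u′ c * iR))) ≤ err
        sum≤ = ≤-trans (sum-mono taylor) (subst (_≤ err) (≡-sym (sum-*ʳ (λ u′ → 𝟙 (S u′)) (ig * ig)))
          (*-monoʳ (*≥0 (inv≥0 g>0) (inv≥0 g>0)) S≤D))

      -- By Weierstrass' inequality it suffices that the mean number `X` of rivals drawing the
      -- colour of `u` is at most 1. Each rival hits a uniform colour of `F u` with probability
      -- `overlapRatio` / q ≤ (1 + ε) / q, and there are at most D ≤ q / (1 + ε) of them.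
      E-z : ∀ u → a ≤ E (uniform (F u) (Fw u)) (z u)
      E-z u = ≤-trans (≤-of-diff (l iR X) (*≥0 iR≥0 (diff≥0 X≤1)))
        (≤-trans (≤-reflexive (≡-sym (trans (E-minus uc 1ℚ _)
            (cong (λ t → 1ℚ - t) (trans (E-cong uc λ c → sum-*ʳ (λ u′ → p u u′ c) iR) (E-*ʳ uc _ iR))))))
          (E-mono uc λ c _ → product-weierstrass _ (λ u′ → y≥0 u u′ c) (λ u′ → y≤1 u u′ c)))
        where
        uc = uniform (F u) (Fw u)
        X = E uc (λ c → sum (λ u′ → p u u′ c))
        Q = ⌜ q ⌝
        opaque
          unfolding _+_
          l : ∀ i X → 1ℚ - X * i - (1ℚ - i) ≡ i * (1ℚ - X)
          l = solve-∀ ring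
          l₁ : ∀ s i j → i * s * j ≡ s * (i * j)
          l₁ = solve-∀ ring
          l₂ : ∀ m t Q j → m * (t * j) * Q ≡ m * (t * (j * Q))
          l₂ = solve-∀ ring
        E-p : ∀ u′ → E uc (p u u′) ≡ 𝟙 (rival u u′) * (card (F u ∩ F u′) * (inv (card (F u)) * inv (card (F u′))))
        E-p u′ = trans (E-* uc (𝟙 (rival u u′)) _) (cong (𝟙 (rival u u′) *_) (trans (E-*ʳ uc _ _)
          (trans (l₁ _ (inv (card (F u))) (inv (card (F u′)))) (cong₂ _*_ (sum-cong λ c → ≡-sym (𝟙-∧ (F u c) (F u′ c))) refl))))
        term : ∀ u′ → E uc (p u u′) ≤ 𝟙 (S u′) * ((1ℚ + ε) * inv Q)
        term u′ rewrite E-p u′ with u′ Fin.≟ u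
        ... | yes _ = subst (_≤ 𝟙 (S u′) * ((1ℚ + ε) * inv Q)) (≡-sym (zeroˡ _)) (*≥0 (𝟙≥0 (S u′)) (*≥0 1+ε≥0 (inv≥0 q>0)))
        ... | no u′≢u = *-monoˡ (𝟙≥0 (S u′)) (≤-inv q>0 (subst (_≤ 1ℚ + ε) (*-comm Q _) (overlap≤ u u′ (u′≢u ∘ ≡-sym))))
        X≤1 : X ≤ 1ℚ
        X≤1 = begin
          X  ≡⟨ E-sum uc (λ u′ c → p u u′ c) ⟩
          sum (λ u′ → E uc (p u u′))  ≤⟨ sum-mono term ⟩
          sum (λ u′ → 𝟙 (S u′) * ((1ℚ + ε) * inv Q))  ≡⟨ sum-*ʳ (λ u′ → 𝟙 (S u′)) _ ⟩
          card S * ((1ℚ + ε) * inv Q)  ≤⟨ *-monoʳ (*≥0 1+ε≥0 (inv≥0 q>0)) S≤D ⟩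
          ⌜ D ⌝ * ((1ℚ + ε) * inv Q)  ≡⟨ trans (≡-sym (*-assoc _ _ _)) (cong (_* inv Q) (*-comm _ _)) ⟩
          (1ℚ + ε) * ⌜ D ⌝ * inv Q  ≤⟨ inv-≤ q>0 (subst (_ ≤_) (≡-sym (*-identityˡ Q)) D≤q) ⟩
          1ℚ                                               ∎
          where open ≤-Reasoning

      -- Jensen's inequality: the tangent at `a` has nonnegative slope, and the mean of `z u` is at
      -- least `a`.
      E-z^ : ∀ u m → 0ℚ < a → a ^ m ≤ E (uniform (F u) (Fw u)) (λ c → z u c ^ m)
      E-z^ u m a>0 = *-cancelˡ a>0 (subst₂ _≤_ (*-comm (a ^ m) a) (*-comm _ a) (begin
        a ^ m * a  ≤⟨ ≤-of-diff (l₀ (a ^ m * a) t (E uc (z u)) a)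
                                                                  (*≥0 (*≥0 (⌜⌝≥0 m) (^≥0 m (<⇒≤ a>0))) (diff≥0 (E-z u))) ⟩
        a ^ m * a + t * (E uc (z u) - a)  ≡⟨ l (a ^ m * a) t (E uc (z u)) a ⟩
        a ^ m * a - t * a + t * E uc (z u)  ≡⟨ E-affine uc _ t (z u) ⟨
        E uc (λ c → a ^ m * a - t * a + t * z u c)  ≤⟨ E-mono uc (λ c _ → ≤-trans (≤-reflexive (≡-sym (l (a ^ m * a) t (z u c) a)))
                                                                  (^-tangent m (z≥0 u c) (<⇒≤ a>0))) ⟩
        E uc (λ c → z u c ^ m * a)  ≡⟨ E-*ʳ uc _ a ⟩
        E uc (λ c → z u c ^ m) * a                           ∎))
        where
        open ≤-Reasoning
        uc = uniform (F u) (Fw u)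
        t = ⌜ m ⌝ * a ^ m
        opaque
          unfolding _+_
          l₀ : ∀ x t e a → x + t * (e - a) - x ≡ t * (e - a)
          l₀ = solve-∀ ring
          l : ∀ x t e a → x + t * (e - a) ≡ x - t * a + t * e
          l = solve-∀ ring

    -- Since 1 - a = 1 / R, the average of a^m over m = 1, ..., R telescopes to a (1 - a^R). The
    -- complement of a (1 - a^R) - err is at most 1 / R + a^R + err.
    E-lost : 0ℚ < a → ∀ {ρ} → iR + a ^ R + err ≤ ρ → ∀ u → E (independent picks) (λ ω → 𝟙 (lost S u ω)) ≤ ρ
    E-lost a>0 {ρ} ρ≥ u = ≤-trans (≤-reflexive (trans (≡-sym (E-cong d λ ω → l₀ (𝟙 (lost S u ω)))) (E-minus d 1ℚ _)))
      (≤-trans (≤-of-diff (l₁ W iR (a ^ R) err) (+≥0 (diff≥0 main) (*≥0 iR≥0 (^≥0 R (<⇒≤ a>0))))) ρ≥)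
      where
      open ≤-Reasoning
      d = independent picks
      uc = uniform (F u) (Fw u)
      W = E d (λ ω → 1ℚ - 𝟙 (lost S u ω))
      opaque
        unfolding _+_
        l₀ : ∀ x → 1ℚ - (1ℚ - x) ≡ x
        l₀ = solve-∀ ring
        l₁ : ∀ W i p e → i + p + e - (1ℚ - W) ≡ W - ((1ℚ - i) * (1ℚ - p) - e) + i * p
        l₁ = solve-∀ ring
        l₂ : ∀ i s → (1ℚ - (1ℚ - i)) * s ≡ i * s
        l₂ = solve-∀ ring
      insensitive : ∀ x y ω → survive S u x (ω [ u ]≔ y) ≡ survive S u x ω
      insensitive x y ω = product-cong same
        where
        same : ∀ u′ → 1ℚ - 𝟙 (beats S u u′ x (lookup (ω [ u ]≔ y) u′)) ≡ 1ℚ - 𝟙 (beats S u u′ x (lookup ω u′))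
        same u′ with u′ Fin.≟ u
        ... | yes refl = refl
        ... | no u′≢u rewrite lookup∘updateAt′ u′ u {λ _ → y} u′≢u ω = refl
      W≡ : W ≡ E uc (λ c → E prio (λ τ → product (λ u′ → 1ℚ - ⌜ suc (toℕ τ) ⌝ * (p u u′ c * iR))))
      W≡ = trans (E-cong d λ ω → ≡-sym (survive≡ S u ω)) (trans (E-resample picks u (survive S u) insensitive)
        (E-cong uc λ c → E-cong prio λ τ → trans (E-product picks (λ u′ y → 1ℚ - 𝟙 (beats S u u′ (c , τ) y)))
          (product-cong λ u′ → E-beats u u′ (c , τ))))
      main : a * (1ℚ - a ^ R) - err ≤ W
      main = begin
        a * (1ℚ - a ^ R) - err  ≡⟨ cong (_- err) (≡-sym (trans (≡-sym (l₂ iR _)) (geometric a R))) ⟩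
        iR * sum {R} (λ τ → a ^ suc (toℕ τ)) - err  ≡⟨ cong (_- err) (cong₂ _*_ (cong inv (≡-sym (card-all R))) (sum-cong λ τ → ≡-sym (*-identityˡ _))) ⟩
        E prio (λ τ → a ^ suc (toℕ τ)) - err  ≤⟨ ≤-of-diff (l₃ _ _ err) (diff≥0 (E-mono prio λ τ _ → E-z^ u (suc (toℕ τ)) a>0)) ⟩
        E prio (λ τ → E uc (λ c → z u c ^ suc (toℕ τ))) - err  ≡⟨ cong (_- err) (E-swap prio (linear uc) _) ⟩
        E uc (λ c → E prio (λ τ → z u c ^ suc (toℕ τ))) - err  ≡⟨ l₅ ⟩
        E uc (λ c → E prio (λ τ → z u c ^ suc (toℕ τ) - err))  ≤⟨ E-mono uc (λ c _ → E-mono prio λ τ _ → survive-lower u c (suc (toℕ τ)) (FinP.toℕ<n τ)) ⟩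
        E uc (λ c → E prio (λ τ → product (λ u′ → 1ℚ - ⌜ suc (toℕ τ) ⌝ * (p u u′ c * iR)))) ≡⟨ W≡ ⟨
        W ∎
        where
        opaque
          unfolding _+_
          l₃ : ∀ x y e → y - e - (x - e) ≡ y - x
          l₃ = solve-∀ ring
          l₄ : ∀ x e → x - e ≡ - e + 1ℚ * x
          l₄ = solve-∀ ring
        minus : ∀ {X : Set} (d : Dist X) (f : X → ℚ) e → E d f - e ≡ E d (λ x → f x - e)
        minus d f e = trans (l₄ (E d f) e) (trans (≡-sym (E-affine d (- e) 1ℚ f)) (E-cong d λ x → ≡-sym (l₄ (f x) e)))
        l₅ : E uc (λ c → E prio (λ τ → z u c ^ suc (toℕ τ))) - err ≡ E uc (λ c → E prio (λ τ → z u c ^ suc (toℕ τ) - err))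
        l₅ = trans (minus uc _ err) (E-cong uc λ c → minus prio _ err)

  -- Sensitivity of the losses to a single pick

  losses : ∀ {n q R} → (Fin n → Bool) → Vec (Pick q R) n → Fin n → Bool
  losses S ω u = S u ∧ lost S u ω

  -- Besides `i` itself, at most one node loses only because of the new pick `x`. Such a node is
  -- beaten by `i` alone and so shares the colour of `x`; two such nodes would compete with each
  -- other under `ω₂` as well, and one of them would lose there already.
  losses-lipschitz : ∀ {n q R} (S : Fin n → Bool) i (ω : Vec (Pick q R) n) x y →
    card (losses S (ω [ i ]≔ x)) - card (losses S (ω [ i ]≔ y)) ≤ 𝟙 (S i) * 2ℚ
  losses-lipschitz {n} {q} {R} S i ω x y = begin
    card (losses S ω₁) - card (losses S ω₂)  ≤⟨ ≤-of-diff (l₁ _ _ _) (diff≥0 (sum-mono term)) ⟩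
    sum (λ u → 𝟙 (losses S ω₂ u) + (𝟙 ⌊ u Fin.≟ i ⌋ * 𝟙 (S i) + 𝟙 (g u))) - card (losses S ω₂)
                                                        ≡⟨ cong (_- card (losses S ω₂)) (trans (sum-+ _ _) (cong (card (losses S ω₂) +_)
                                                             (trans (sum-+ _ _) (cong₂ _+_ (sum-δ i (λ _ → 𝟙 (S i))) refl)))) ⟩
    card (losses S ω₂) + (𝟙 (S i) + card g) - card (losses S ω₂)
                                                        ≤⟨ ≤-of-diff (l₂ (card (losses S ω₂)) (𝟙 (S i)) (card g)) (diff≥0 g≤) ⟩
    𝟙 (S i) * 2ℚ ∎
    where
    open ≤-Reasoning
    ω₁ = ω [ i ]≔ x
    ω₂ = ω [ i ]≔ y
    opaque
      unfolding _+_
      l₁ : ∀ a b c → b - c - (a - c) ≡ b - a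
      l₁ = solve-∀ ring
      l₂ : ∀ a s g → s * 2ℚ - (a + (s + g) - a) ≡ s - g
      l₂ = solve-∀ ring
    g : Fin n → Bool
    g u = S u ∧ (not ⌊ u Fin.≟ i ⌋ ∧ (lost S u ω₁ ∧ not (lost S u ω₂)))
    off : ∀ {u} → u ≢ i → lookup ω₁ u ≡ lookup ω₂ u
    off {u} u≢i = trans (lookup∘updateAt′ u i {λ _ → x} u≢i ω) (≡-sym (lookup∘updateAt′ u i {λ _ → y} u≢i ω))
    beaten : ∀ u → g u ≡ true → u ≢ i × S u ≡ true × S i ≡ true × proj₁ (lookup ω₂ u) ≡ proj₁ (lookup ω₁ i) ×
      (∀ u′ → beats S u u′ (lookup ω₂ u) (lookup ω₂ u′) ≢ true)
    beaten u gu with ∧-true {S u} gu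
    ... | Su , h with ∧-true {not ⌊ u Fin.≟ i ⌋} h
    ... | u≢i′ , h′ with ∧-true {lost S u ω₁} h′
    ... | l1 , nl2 = u≢i , Su , Si , colour≡ , unbeaten
      where
      u≢i : u ≢ i
      u≢i refl with trans (≡-sym (not-true u≢i′)) (⌊⌋-true (u Fin.≟ u) refl)
      ... | ()
      unbeaten : ∀ u′ → beats S u u′ (lookup ω₂ u) (lookup ω₂ u′) ≢ true
      unbeaten u′ p with trans (≡-sym (not-true nl2)) (⌊⌋-true (any? _) (u′ , p))
      ... | ()
      rival : Σ (Fin n) λ u′ → beats S u u′ (lookup ω₁ u) (lookup ω₁ u′) ≡ true
      rival = true-⌊⌋ (any? _) l1
      is-i : proj₁ rival ≡ i
      is-i with proj₁ rival Fin.≟ i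
      ... | yes p = p
      ... | no ¬p = ⊥-elim (unbeaten (proj₁ rival)
                      (subst₂ (λ a b → beats S u (proj₁ rival) a b ≡ true) (off u≢i) (off ¬p) (proj₂ rival)))
      b-i : beats S u i (lookup ω₁ u) (lookup ω₁ i) ≡ true
      b-i = subst (λ v → beats S u v (lookup ω₁ u) (lookup ω₁ v) ≡ true) is-i (proj₂ rival)
      Si = proj₂ (∧-true {not ⌊ i Fin.≟ u ⌋} (proj₁ (∧-true {not ⌊ i Fin.≟ u ⌋ ∧ S i} b-i)))
      colour≡ : proj₁ (lookup ω₂ u) ≡ proj₁ (lookup ω₁ i)
      colour≡ = trans (cong proj₁ (≡-sym (off u≢i)))
        (≡-sym (true-⌊⌋ (_ Fin.≟ _) (proj₁ (∧-true {⌊ _ Fin.≟ _ ⌋} (proj₂ (∧-true {not ⌊ i Fin.≟ u ⌋ ∧ S i} b-i))))))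
    beats-intro : ∀ u v → u ≢ v → S v ≡ true → proj₁ (lookup ω₂ v) ≡ proj₁ (lookup ω₂ u) →
      toℕ (proj₂ (lookup ω₂ v)) ℕ.≤ toℕ (proj₂ (lookup ω₂ u)) → beats S u v (lookup ω₂ u) (lookup ω₂ v) ≡ true
    beats-intro u v u≢v Sv c≡ τ≤ rewrite ⌊⌋-false (v Fin.≟ u) (u≢v ∘ ≡-sym) | Sv
      | ⌊⌋-true (proj₁ (lookup ω₂ v) Fin.≟ proj₁ (lookup ω₂ u)) c≡
      | ⌊⌋-true (toℕ (proj₂ (lookup ω₂ v)) ℕ.≤? toℕ (proj₂ (lookup ω₂ u))) τ≤ = refl
    exclusive : ∀ u v → u ≢ v → g u ≡ true → g v ≡ true → ⊥
    exclusive u v u≢v gu gv with beaten u gu | beaten v gv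
    ... | _ , Su , _ , cu , nu | _ , Sv , _ , cv , nv
      with ℕP.≤-total (toℕ (proj₂ (lookup ω₂ u))) (toℕ (proj₂ (lookup ω₂ v)))
    ... | inj₁ p = nv u (beats-intro v u (u≢v ∘ ≡-sym) Su (trans cu (≡-sym cv)) p)
    ... | inj₂ p = nu v (beats-intro u v u≢v Sv (trans cv (≡-sym cu)) p)
    g≤ : card g ≤ 𝟙 (S i)
    g≤ with S i in eq
    ... | true = sum-exclusive g exclusive
    ... | false = subst (card g ≤_) (zeroʳ ⌜ n ⌝) (sum-≤-const zero-term)
      where
      zero-term : ∀ u → 𝟙 (g u) ≤ 0ℚ
      zero-term u with g u in gu
      ... | false = ≤-refl
      ... | true with trans (≡-sym eq) (proj₁ (proj₂ (proj₂ (beaten u gu))))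
      ... | ()
    term : ∀ u → 𝟙 (losses S ω₁ u) ≤ 𝟙 (losses S ω₂ u) + (𝟙 ⌊ u Fin.≟ i ⌋ * 𝟙 (S i) + 𝟙 (g u))
    term u with u Fin.≟ i
    ... | yes refl = ≤-trans (𝟙-∧≤ (S u) (lost S u ω₁)) (≤-of-diff (l (𝟙 (S u)) (𝟙 (losses S ω₂ u)) (𝟙 (S u ∧ false)))
                       (+≥0 (𝟙≥0 (losses S ω₂ u)) (𝟙≥0 (S u ∧ false))))
      where
      opaque
        unfolding _+_
        l : ∀ s t z → t + (1ℚ * s + z) - s ≡ t + z
        l = solve-∀ ring
      𝟙-∧≤ : ∀ a b → 𝟙 (a ∧ b) ≤ 𝟙 a
      𝟙-∧≤ true b = 𝟙≤1 b
      𝟙-∧≤ false b = ≤-refl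
    ... | no _ = bool (S u) (lost S u ω₁) (lost S u ω₂) (𝟙 (S i))
      where
      opaque
        unfolding _+_
        l : ∀ s → (0ℚ + (0ℚ * s + 1ℚ)) - 1ℚ ≡ 0ℚ
        l = solve-∀ ring
        l′ : ∀ s → (1ℚ + (0ℚ * s + 0ℚ)) - 1ℚ ≡ 0ℚ
        l′ = solve-∀ ring
        l″ : ∀ s t → (t + (0ℚ * s + 0ℚ)) - 0ℚ ≡ t
        l″ = solve-∀ ring
      bool : ∀ a b c s → 𝟙 (a ∧ b) ≤ 𝟙 (a ∧ c) + (0ℚ * s + 𝟙 (a ∧ (b ∧ not c)))
      bool true true true s = ≤-of-diff (l′ s) ≤-refl
      bool true true false s = ≤-of-diff (l s) ≤-refl
      bool true false true s = ≤-of-diff (l″ s 1ℚ) 0≤1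
      bool true false false s = ≤-of-diff (l″ s 0ℚ) ≤-refl
      bool false b c s = ≤-of-diff (l″ s 0ℚ) ≤-refl

  sum-cond-≤ : ∀ {n} (S : Fin n → Bool) (f : Fin n → ℚ) {c} → (∀ u → f u ≤ c) → sum (λ u → 𝟙 (S u) * f u) ≤ card S * c
  sum-cond-≤ S f {c} h = subst (sum (λ u → 𝟙 (S u) * f u) ≤_) (sum-*ʳ (λ u → 𝟙 (S u)) c) (sum-mono λ u → *-monoˡ (𝟙≥0 (S u)) (h u))

  -- State and potential of one phase

  remove : ∀ {q} → Bool → (Fin q → Bool) → Fin q → Fin q → Bool
  remove s F c = if s then F ∖ c else F

  -- The palette of a node holds the colours it has not drawn yet.
  record State (n q : ℕ) : Set where
    field
      palette : Fin n → Fin q → Bool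
      lossCount : Fin n → ℕ
      remaining : Fin n → ℕ
  open State

  next : ∀ {n q R} → State n q → (Fin n → Bool) → Vec (Pick q R) n → State n q
  next st S ω = record
    { palette = λ u → remove (S u) (palette st u) (proj₁ (lookup ω u))
    ; lossCount = λ u → if losses S ω u then suc (lossCount st u) else lossCount st u
    -- The truncation of `ℕ.pred` is harmless: a neighbour of an arriving node has `remaining`
    -- positive, by `rem>0`.
    ; remaining = λ u → if S u then ℕ.pred (remaining st u) else remaining st u
    }

  -- D bounds the degrees, g is the excess of the palette size over D, suc R′ the number of priorities, ρ a bound on the
  -- probability of a loss, σ the tolerated proportion of losses, ε the tolerated deviation of overlap ratios from 1, and b
  -- bounds the change of every tracked quantity in one step.
  module Potential (D g R′ k : ℕ) (ρ σ ε b : ℚ) where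

    iD = inv ⌜ D ⌝
    Gr = growth k b
    q = D ℕ.+ g

    -- The Markov bound, with k-th powers, for the event that the overlap exceeds 1 + ε. The factor
    -- `Gr ^ r` prepays the growth caused by the `r` removals still to come, so the weight is a
    -- supermartingale.
    pairWeight : (F H : Fin q → Bool) → ℕ → ℚ
    pairWeight F H r = (1ℚ + overlapRatio F H) ^ k * (inv (2ℚ + ε) ^ k * Gr ^ r)

    -- The same for the final losses exceeding σ D: after `l` losses and with `r` arrivals ahead, at
    -- most l + ρ r losses are expected in total.
    lossWeight : ℕ → ℕ → ℚ
    lossWeight l r = (1ℚ + (⌜ l ⌝ + ρ * ⌜ r ⌝) * iD) ^ k * (inv (1ℚ + σ) ^ k * Gr ^ r)

    -- The diagonal is excluded because the ratio of a palette with itself is q / |F|, which does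
    -- not stay near 1.
    pairTerm : ∀ {n} → State n q → Fin n → Fin n → ℚ
    pairTerm st u u′ = if ⌊ u Fin.≟ u′ ⌋ then 0ℚ else
      pairWeight (palette st u) (palette st u′) (remaining st u ℕ.+ remaining st u′)

    lossTerm : ∀ {n} → State n q → Fin n → ℚ
    lossTerm st u = lossWeight (lossCount st u) (remaining st u)

    Φ : ∀ {n} → State n q → ℚ
    Φ st = sum (λ u → sum (pairTerm st u)) + sum (lossTerm st)

    record Regular {n} (st : State n q) : Set where
      field
        palette-size : ∀ u → card (palette st u) ≡ ⌜ remaining st u ⌝ + ⌜ g ⌝

    -- `q≤b` controls the change of an overlap ratio, and `2≤b` the change of the number of losses,
    -- which is 2-Lipschitz, divided by D. `R′>0` makes 1 - 1 / (R′ + 1) positive, and `loss≤ρ` has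
    -- the form of the hypothesis of `E-lost`.
    record Conditions : Set where
      field
        D>0 : 0ℚ < ⌜ D ⌝
        1≤g : 1ℚ ≤ ⌜ g ⌝
        R′>0 : 0 ℕ.< R′
        q≤b : ⌜ q ⌝ ≤ b * (⌜ g ⌝ * ⌜ g ⌝)
        2≤b : 2ℚ * iD ≤ b
        kb≤1 : ⌜ k ⌝ * b ≤ 1ℚ
        ε≥0 : 0ℚ ≤ ε
        D≤q : (1ℚ + ε) * ⌜ D ⌝ ≤ ⌜ q ⌝
        ρ≥0 : 0ℚ ≤ ρ
        ρ≤1 : ρ ≤ 1ℚ
        σ≥0 : 0ℚ ≤ σ
        loss≤ρ : inv ⌜ suc R′ ⌝ + (1ℚ - inv ⌜ suc R′ ⌝) ^ suc R′ + ⌜ D ⌝ * (inv ⌜ g ⌝ * inv ⌜ g ⌝) ≤ ρ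

    module Step (cond : Conditions) {n} (st : State n q) (reg : Regular st) (w : Fin n → Fin q)
      (Fw : ∀ u → palette st u (w u) ≡ true) where
      open Conditions cond
      open Regular reg
      private
        F = palette st
        rem = remaining st
        loss = lossCount st
        g>0 : 0ℚ < ⌜ g ⌝
        g>0 = <-≤-trans 0<1 1≤g
        Gr≥1 = 1≤growth k b
        Gr≥0 = ≤-trans 0≤1 Gr≥1
        wp = inv (2ℚ + ε) ^ k
        wl = inv (1ℚ + σ) ^ k
        2+ε>0 : 0ℚ < 2ℚ + ε
        2+ε>0 = +>0 (+>0 0<1 0≤1) ε≥0
        1+σ>0 : 0ℚ < 1ℚ + σ
        1+σ>0 = +>0 0<1 σ≥0
        wp≥0 = ^≥0 k (inv≥0 2+ε>0)
        wl≥0 = ^≥0 k (inv≥0 1+σ>0)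
        F≥g : ∀ u → ⌜ g ⌝ ≤ card (F u)
        F≥g u = subst (⌜ g ⌝ ≤_) (≡-sym (palette-size u)) (x≤y+x (⌜⌝≥0 (rem u)))

        ratio≥0 : ∀ (F H : Fin q → Bool) → ⌜ g ⌝ ≤ card F → ⌜ g ⌝ ≤ card H → 0ℚ ≤ 1ℚ + overlapRatio F H
        ratio≥0 F H p r = +≥0 0≤1 (overlapRatio≥0 F H (<-≤-trans g>0 p) (<-≤-trans g>0 r))

        pairWeight≥0 : ∀ F H r → ⌜ g ⌝ ≤ card F → ⌜ g ⌝ ≤ card H → 0ℚ ≤ pairWeight F H r
        pairWeight≥0 F H r p s = *≥0 (^≥0 k (ratio≥0 F H p s)) (*≥0 wp≥0 (^≥0 r Gr≥0))

        pairTerm≥0 : ∀ u u′ → 0ℚ ≤ pairTerm st u u′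
        pairTerm≥0 u u′ with u Fin.≟ u′
        ... | yes _ = ≤-refl
        ... | no _ = pairWeight≥0 (F u) (F u′) (rem u ℕ.+ rem u′) (F≥g u) (F≥g u′)

        lossWeight≥0 : ∀ l r → 0ℚ ≤ lossWeight l r
        lossWeight≥0 l r = *≥0 (^≥0 k (+≥0 0≤1 (*≥0 (+≥0 (⌜⌝≥0 l) (*≥0 ρ≥0 (⌜⌝≥0 r))) (inv≥0 D>0)))) (*≥0 wl≥0 (^≥0 r Gr≥0))

      pair≤Φ : ∀ u u′ → pairTerm st u u′ ≤ Φ st
      pair≤Φ u u′ = ≤-trans (term≤sum (pairTerm≥0 u) u′) (≤-trans (term≤sum (λ v → sum≥0 (pairTerm≥0 v)) u)
        (x≤x+y (sum≥0 λ u → lossWeight≥0 (loss u) (rem u))))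

      loss≤Φ : ∀ u → lossTerm st u ≤ Φ st
      loss≤Φ u = ≤-trans (term≤sum (λ v → lossWeight≥0 (loss v) (rem v)) u)
        (x≤y+x (sum≥0 λ v → sum≥0 (pairTerm≥0 v)))

      private
        weight≥1 : ∀ {x y} r → 0ℚ < y → y ≤ x → 1ℚ ≤ x ^ k * (inv y ^ k * Gr ^ r)
        weight≥1 {x} {y} r y>0 y≤x = ≤-trans (1≤^ r Gr≥1) (≤-trans (≤-reflexive (≡-sym (*-identityˡ _)))
          (≤-trans (*-monoʳ (^≥0 r Gr≥0) (subst (_≤ x ^ k * inv y ^ k) (1^ k)
            (subst (1ℚ ^ k ≤_) (^-*-distrib x (inv y) k) (^-mono k 0≤1 (≤-inv y>0 (subst (_≤ x) (≡-sym (*-identityˡ y)) y≤x))))))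
          (≤-reflexive (*-assoc _ _ _))))

        -- Markov's inequality read backwards: beyond its threshold `y`, a tracked quantity alone
        -- would contribute at least 1.
        dichotomy : ∀ {x y z} r → 0ℚ < y → x ^ k * (inv y ^ k * Gr ^ r) ≤ z → z < 1ℚ → x ≤ y
        dichotomy {x} {y} r y>0 h z<1 with x ≤? y
        ... | yes p = p
        ... | no ¬p = ⊥-elim (<-irrefl (<-≤-trans z<1 (≤-trans (weight≥1 r y>0 (<⇒≤ (≰⇒> ¬p))) h)))

      overlap-bound : Φ st < 1ℚ → ∀ u u′ → u ≢ u′ → overlapRatio (F u) (F u′) ≤ 1ℚ + ε
      overlap-bound Φ<1 u u′ u≢u′ = ≤-of-diff (l _ ε) (diff≥0 (dichotomy (rem u ℕ.+ rem u′) 2+ε>0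
        (subst (_≤ Φ st) (cong (if_then 0ℚ else pairWeight (F u) (F u′) (rem u ℕ.+ rem u′)) (⌊⌋-false (u Fin.≟ u′) u≢u′)) (pair≤Φ u u′)) Φ<1))
        where
        opaque
          unfolding _+_
          l : ∀ x e → 1ℚ + e - x ≡ 2ℚ + e - (1ℚ + x)
          l = solve-∀ ring

      -- The allowance ρ · `rem u` for future losses only enlarges the tracked quantity, so the
      -- bound holds at any time and not just at the end.
      loss-bound : Φ st < 1ℚ → ∀ u → ⌜ loss u ⌝ ≤ σ * ⌜ D ⌝
      loss-bound Φ<1 u = ≤-trans (x≤x+y (*≥0 ρ≥0 (⌜⌝≥0 (rem u))))
        (subst (_≤ σ * ⌜ D ⌝) (trans (*-assoc _ iD ⌜ D ⌝) (trans (cong (_ *_) (inv-*ˡ D>0)) (*-identityʳ _)))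
        (*-monoʳ (<⇒≤ D>0) (≤-of-diff (l₁ _ σ) (diff≥0 (dichotomy (rem u) 1+σ>0 (loss≤Φ u) Φ<1)))))
        where
        opaque
          unfolding _+_
          l₁ : ∀ x s → s - x ≡ 1ℚ + s - (1ℚ + x)
          l₁ = solve-∀ ring

      module Arrival (S : Fin n → Bool) (count≤D : count S ℕ.≤ D) (rem>0 : ∀ u → S u ≡ true → 0 ℕ.< rem u)
        (Φ<1 : Φ st < 1ℚ) where

        private
          S≤D : card S ≤ ⌜ D ⌝
          S≤D = subst (_≤ ⌜ D ⌝) (≡-sym (card≡count S)) (⌜⌝-mono count≤D)
          q>0 : 0ℚ < ⌜ q ⌝
          q>0 = subst (0ℚ <_) (≡-sym (⌜⌝-+ D g)) (+>0 D>0 (⌜⌝≥0 g))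
          1+ε≥0 : 0ℚ ≤ 1ℚ + ε
          1+ε≥0 = +≥0 0≤1 ε≥0

        open Loss R′ F w Fw S {D} S≤D {⌜ g ⌝} {ε} 1≤g F≥g q>0 D≤q 1+ε≥0 (overlap-bound Φ<1) using (picks; E-lost)

        d : Dist (Vec (Pick q (suc R′)) n)
        d = independent picks

        private
          rem′ : Fin n → ℕ
          rem′ u = if S u then ℕ.pred (rem u) else rem u

          a>0 : 0ℚ < 1ℚ - inv ⌜ suc R′ ⌝
          a>0 = <-≤-trans (inv>0 R>0) (≤-of-diff (trans (l i) (cong (_- 2ℚ * i) (≡-sym (inv-*ʳ R>0))))
            (subst (0ℚ ≤_) (l₁ ⌜ R′ ⌝ i) (*≥0 (diff≥0 (⌜⌝-mono R′>0)) (inv≥0 R>0))))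
            where
            R>0 = +>0 0<1 (⌜⌝≥0 R′)
            i = inv ⌜ suc R′ ⌝
            opaque
              unfolding _+_
              l : ∀ i → 1ℚ - i - i ≡ 1ℚ - 2ℚ * i
              l = solve-∀ ring
              l₁ : ∀ r i → (r - (1ℚ + 0ℚ)) * i ≡ (1ℚ + r) * i - 2ℚ * i
              l₁ = solve-∀ ring

          lost≤ρ : ∀ u → E d (λ ω → 𝟙 (lost S u ω)) ≤ ρ
          lost≤ρ = E-lost a>0 loss≤ρ

          remove-≥ : ∀ u c → F u c ≡ true → ⌜ g ⌝ ≤ card (remove (S u) (F u) c)
          remove-≥ u c Fc with S u in Su
          ... | false = F≥g u
          ... | true = ≤-of-diff (trans (cong (_- ⌜ g ⌝) (trans (card-∖ (F u) c Fc) (cong (_- 1ℚ) (palette-size u)))) (l ⌜ rem u ⌝ ⌜ g ⌝))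
                         (diff≥0 (⌜⌝-mono (rem>0 u Su)))
            where
            opaque
              unfolding _+_
              l : ∀ r g → r + g - 1ℚ - g ≡ r - (1ℚ + 0ℚ)
              l = solve-∀ ring

          -- If `u` takes part in the arrival, one prepaid factor `Gr` is spent on the growth of
          -- `overlapRatio-step`; otherwise nothing changes. `H` is arbitrary, so that the other
          -- palette may already have been modified.
          one-step : ∀ u H → ⌜ g ⌝ ≤ card H →
            E (picks u) (λ x → (1ℚ + overlapRatio (remove (S u) (F u) (proj₁ x)) H) ^ k) * Gr ^ rem′ u
              ≤ (1ℚ + overlapRatio (F u) H) ^ k * Gr ^ rem u
          one-step u H H≥g with S u in Su
          ... | false = ≤-reflexive (cong (_* Gr ^ rem u) (E-const (picks u) _))
          ... | true with rem u in rem≡ | rem>0 u Su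
          ... | suc r | _ = ≤-trans (*-monoʳ (^≥0 r Gr≥0) (≤-trans (≤-reflexive (E-cong (uniform (F u) (Fw u)) λ c → E-const prio _))
                  (overlapRatio-step (F u) H (Fw u) g>0 F-1≥g H≥g q≤b k kb≤1))) (≤-reflexive (*-assoc _ Gr (Gr ^ r)))
            where
            prio = uniform (all-true {suc R′}) {zero} refl
            F-1≥g : ⌜ g ⌝ ≤ card (F u) - 1ℚ
            F-1≥g = ≤-of-diff (trans (cong (λ x → x - 1ℚ - ⌜ g ⌝) (trans (palette-size u) (cong (λ m → ⌜ m ⌝ + ⌜ g ⌝) rem≡))) (l ⌜ r ⌝ ⌜ g ⌝)) (⌜⌝≥0 r)
              where
              opaque
                unfolding _+_
                l : ∀ r g → 1ℚ + r + g - 1ℚ - g ≡ r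
                l = solve-∀ ring

          opaque
            unfolding _+_
            shuffle : ∀ x p q r → x * (p * (q * r)) ≡ p * r * (x * q)
            shuffle = solve-∀ ring
            shuffle′ : ∀ x p q r → x * (p * (q * r)) ≡ p * q * (x * r)
            shuffle′ = solve-∀ ring

          -- The picks of `u` and `u′` are independent. With the pick `x` of `u` fixed, the removal
          -- at `u′` is averaged against the palette `P u x`; the average over `x` is then a second
          -- `one-step`.
          pair-step : ∀ u u′ → E d (λ ω → pairTerm (next st S ω) u u′) ≤ pairTerm st u u′
          pair-step u u′ with u Fin.≟ u′
          ... | yes _ = ≤-reflexive (E-const d 0ℚ)
          ... | no u≢u′ = begin
            E d (λ ω → pairWeight (P u (lookup ω u)) (P u′ (lookup ω u′)) (rem′ u ℕ.+ rem′ u′))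
              ≡⟨ E-pair picks u≢u′ (λ x y → pairWeight (P u x) (P u′ y) (rem′ u ℕ.+ rem′ u′)) ⟩
            E du (λ x → E du′ (λ y → pairWeight (P u x) (P u′ y) (rem′ u ℕ.+ rem′ u′)))
              ≤⟨ E-mono du (λ x s → second x (proj₁ s)) ⟩
            E du (λ x → (1ℚ + overlapRatio (P u x) (F u′)) ^ k * (wp * (Gr ^ rem′ u * Gr ^ rem u′)))
              ≡⟨ E-*ʳ du _ _ ⟩
            E du (λ x → (1ℚ + overlapRatio (P u x) (F u′)) ^ k) * (wp * (Gr ^ rem′ u * Gr ^ rem u′))
              ≡⟨ shuffle _ wp (Gr ^ rem′ u) _ ⟩
            wp * Gr ^ rem u′ * (E du (λ x → (1ℚ + overlapRatio (P u x) (F u′)) ^ k) * Gr ^ rem′ u)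
              ≤⟨ *-monoˡ (*≥0 wp≥0 (^≥0 (rem u′) Gr≥0)) (one-step u (F u′) (F≥g u′)) ⟩
            wp * Gr ^ rem u′ * ((1ℚ + overlapRatio (F u) (F u′)) ^ k * Gr ^ rem u)
              ≡⟨ shuffle _ wp (Gr ^ rem u) _ ⟨
            (1ℚ + overlapRatio (F u) (F u′)) ^ k * (wp * (Gr ^ rem u * Gr ^ rem u′))
              ≡⟨ cong (λ x → (1ℚ + overlapRatio (F u) (F u′)) ^ k * (wp * x)) (^-+ Gr (rem u) (rem u′)) ⟨
            pairWeight (F u) (F u′) (rem u ℕ.+ rem u′) ∎
            where
            open ≤-Reasoning
            du = picks u
            du′ = picks u′
            P : Fin n → Pick q (suc R′) → Fin q → Bool
            P v x = remove (S v) (F v) (proj₁ x)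
            second : ∀ x → F u (proj₁ x) ≡ true →
              E du′ (λ y → pairWeight (P u x) (P u′ y) (rem′ u ℕ.+ rem′ u′)) ≤
                (1ℚ + overlapRatio (P u x) (F u′)) ^ k * (wp * (Gr ^ rem′ u * Gr ^ rem u′))
            second x Fx = begin
              E du′ (λ y → pairWeight (P u x) (P u′ y) (rem′ u ℕ.+ rem′ u′))
                ≡⟨ E-*ʳ du′ _ _ ⟩
              E du′ (λ y → (1ℚ + overlapRatio (P u x) (P u′ y)) ^ k) * (wp * Gr ^ (rem′ u ℕ.+ rem′ u′))
                ≡⟨ cong₂ (λ s t → s * (wp * t)) (E-cong du′ λ y → cong (λ o → (1ℚ + o) ^ k) (overlapRatio-comm (P u x) (P u′ y))) (^-+ Gr (rem′ u) (rem′ u′)) ⟩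
              E du′ (λ y → (1ℚ + overlapRatio (P u′ y) (P u x)) ^ k) * (wp * (Gr ^ rem′ u * Gr ^ rem′ u′))
                ≡⟨ shuffle′ _ wp (Gr ^ rem′ u) _ ⟩
              wp * Gr ^ rem′ u * (E du′ (λ y → (1ℚ + overlapRatio (P u′ y) (P u x)) ^ k) * Gr ^ rem′ u′)
                ≤⟨ *-monoˡ (*≥0 wp≥0 (^≥0 (rem′ u) Gr≥0)) (one-step u′ (P u x) (remove-≥ u (proj₁ x) Fx)) ⟩
              wp * Gr ^ rem′ u * ((1ℚ + overlapRatio (F u′) (P u x)) ^ k * Gr ^ rem u′)
                ≡⟨ shuffle′ _ wp (Gr ^ rem′ u) _ ⟨
              (1ℚ + overlapRatio (F u′) (P u x)) ^ k * (wp * (Gr ^ rem′ u * Gr ^ rem u′))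
                ≡⟨ cong (λ o → (1ℚ + o) ^ k * (wp * (Gr ^ rem′ u * Gr ^ rem u′))) (overlapRatio-comm (F u′) (P u x)) ⟩
              (1ℚ + overlapRatio (P u x) (F u′)) ^ k * (wp * (Gr ^ rem′ u * Gr ^ rem u′)) ∎

          iD≤b : iD ≤ b
          iD≤b = ≤-trans (≤-of-diff (l iD) (inv≥0 D>0)) 2≤b
            where
            opaque
              unfolding _+_
              l : ∀ i → 2ℚ * i - i ≡ i
              l = solve-∀ ring

          -- An arrival replaces one allowance ρ by the actual outcome, so the change δ = (𝟙 lost -
          -- ρ) / D has mean at most 0.
          loss-step : ∀ u → E d (λ ω → lossTerm (next st S ω) u) ≤ lossTerm st u
          loss-step u with S u in Su
          ... | false = ≤-reflexive (E-const d _)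
          ... | true with rem u in rem≡ | rem>0 u Su
          ... | suc r | _ = begin
            E d (λ ω → lossWeight (if lost S u ω then suc (loss u) else loss u) r)
              ≡⟨ E-cong d (λ ω → cong (λ x → x ^ k * (wl * Gr ^ r)) (shift (lost S u ω))) ⟩
            E d (λ ω → (A + δ ω) ^ k * (wl * Gr ^ r))
              ≡⟨ E-*ʳ d _ _ ⟩
            E d (λ ω → (A + δ ω) ^ k) * (wl * Gr ^ r)
              ≤⟨ *-monoʳ (*≥0 wl≥0 (^≥0 r Gr≥0)) (power-step d k δ A≥1 (λ ω _ → δ≥ (lost S u ω)) (λ ω _ → δ≤ (lost S u ω)) kb≤1 mean) ⟩
            A ^ k * Gr * (wl * Gr ^ r)
              ≡⟨ l₀ (A ^ k) Gr wl (Gr ^ r) ⟩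
            lossWeight (loss u) (suc r) ∎
            where
            open ≤-Reasoning
            A = 1ℚ + (⌜ loss u ⌝ + ρ * ⌜ suc r ⌝) * iD
            δ : Vec (Pick q (suc R′)) n → ℚ
            δ ω = - (ρ * iD) + iD * 𝟙 (lost S u ω)
            opaque
              unfolding _+_
              l₀ : ∀ a g w p → a * g * (w * p) ≡ a * (w * (g * p))
              l₀ = solve-∀ ring
              l₁ : ∀ l p r i → 1ℚ + (1ℚ + l + p * r) * i ≡ 1ℚ + (l + p * (1ℚ + r)) * i + (- (p * i) + i * 1ℚ)
              l₁ = solve-∀ ring
              l₂ : ∀ l p r i → 1ℚ + (l + p * r) * i ≡ 1ℚ + (l + p * (1ℚ + r)) * i + (- (p * i) + i * 0ℚ)
              l₂ = solve-∀ ring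
            shift : ∀ x → 1ℚ + (⌜ if x then suc (loss u) else loss u ⌝ + ρ * ⌜ r ⌝) * iD ≡ A + (- (ρ * iD) + iD * 𝟙 x)
            shift true = l₁ ⌜ loss u ⌝ ρ ⌜ r ⌝ iD
            shift false = l₂ ⌜ loss u ⌝ ρ ⌜ r ⌝ iD
            A≥1 : 1ℚ ≤ A
            A≥1 = x≤x+y (*≥0 (+≥0 (⌜⌝≥0 (loss u)) (*≥0 ρ≥0 (⌜⌝≥0 (suc r)))) (inv≥0 D>0))
            opaque
              unfolding _+_
              l₃ : ∀ p i b x → - (p * i) + i * x - (- b) ≡ b - i + i * (1ℚ - p) + i * x
              l₃ = solve-∀ ring
              l₄ : ∀ p i b x → b - (- (p * i) + i * x) ≡ b - i + i * (1ℚ - x) + p * i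
              l₄ = solve-∀ ring
            δ≥ : ∀ x → - b ≤ - (ρ * iD) + iD * 𝟙 x
            δ≥ x = ≤-of-diff (l₃ ρ iD b (𝟙 x)) (+≥0 (+≥0 (diff≥0 iD≤b) (*≥0 (inv≥0 D>0) (diff≥0 ρ≤1))) (*≥0 (inv≥0 D>0) (𝟙≥0 x)))
            δ≤ : ∀ x → - (ρ * iD) + iD * 𝟙 x ≤ b
            δ≤ x = ≤-of-diff (l₄ ρ iD b (𝟙 x)) (+≥0 (+≥0 (diff≥0 iD≤b) (*≥0 (inv≥0 D>0) (1-𝟙≥0 x))) (*≥0 ρ≥0 (inv≥0 D>0)))
            mean : E d δ ≤ 0ℚ
            mean = ≤-trans (≤-reflexive (E-affine d (- (ρ * iD)) iD _)) (≤-of-diff (l₅ ρ iD _) (*≥0 (inv≥0 D>0) (diff≥0 (lost≤ρ u))))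
              where
              opaque
                unfolding _+_
                l₅ : ∀ p i e → 0ℚ - (- (p * i) + i * e) ≡ i * (p - e)
                l₅ = solve-∀ ring

          Φ-step : E d (λ ω → Φ (next st S ω)) ≤ Φ st
          Φ-step = begin
            E d (λ ω → Φ (next st S ω))
              ≡⟨ E-+ d (λ ω → sum (λ u → sum (pairTerm (next st S ω) u))) (λ ω → sum (lossTerm (next st S ω))) ⟩
            E d (λ ω → sum (λ u → sum (pairTerm (next st S ω) u))) + E d (λ ω → sum (lossTerm (next st S ω)))
              ≡⟨ cong₂ _+_ (E-sum d (λ u ω → sum (pairTerm (next st S ω) u))) (E-sum d (λ u ω → lossTerm (next st S ω) u)) ⟩
            sum (λ u → E d (λ ω → sum (pairTerm (next st S ω) u))) + sum (λ u → E d (λ ω → lossTerm (next st S ω) u))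
              ≤⟨ +-mono-≤ (sum-mono pairs) (sum-mono loss-step) ⟩
            Φ st ∎
            where
            open ≤-Reasoning
            pairs : ∀ u → E d (λ ω → sum (pairTerm (next st S ω) u)) ≤ sum (pairTerm st u)
            pairs u = ≤-trans (≤-reflexive (E-sum d (λ u′ ω → pairTerm (next st S ω) u u′))) (sum-mono (pair-step u))

          L : Vec (Pick q (suc R′)) n → ℚ
          L ω = card (losses S ω)

          E-L : E d L ≤ ρ * ⌜ D ⌝
          E-L = begin
            E d L  ≡⟨ E-sum d (λ u ω → 𝟙 (losses S ω u)) ⟩
            sum (λ u → E d (λ ω → 𝟙 (losses S ω u)))  ≡⟨ sum-cong (λ u → trans (E-cong d λ ω → 𝟙-∧ (S u) _) (E-* d (𝟙 (S u)) _)) ⟩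
            sum (λ u → 𝟙 (S u) * E d (λ ω → 𝟙 (lost S u ω)))  ≤⟨ sum-cond-≤ S _ lost≤ρ ⟩
            card S * ρ  ≤⟨ *-monoʳ ρ≥0 S≤D ⟩
            ⌜ D ⌝ * ρ  ≡⟨ *-comm _ ρ ⟩
            ρ * ⌜ D ⌝                                         ∎
            where open ≤-Reasoning

          f : Vec (Pick q (suc R′)) n → ℚ
          f ω = 1ℚ + iD * L ω

          f-lipschitz : ∀ i ω x y → f (ω [ i ]≔ x) - f (ω [ i ]≔ y) ≤ (if S i then b else 0ℚ)
          f-lipschitz i ω x y = ≤-trans (≤-reflexive (l iD _ _)) (≤-trans (*-monoˡ (inv≥0 D>0) (losses-lipschitz S i ω x y)) (bool (S i)))
            where
            opaque
              unfolding _+_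
              l : ∀ i x y → 1ℚ + i * x - (1ℚ + i * y) ≡ i * (x - y)
              l = solve-∀ ring
              l₁ : ∀ i → i * (1ℚ * 2ℚ) ≡ 2ℚ * i
              l₁ = solve-∀ ring
              l₂ : ∀ i → i * (0ℚ * 2ℚ) ≡ 0ℚ
              l₂ = solve-∀ ring
            bool : ∀ s → iD * (𝟙 s * 2ℚ) ≤ (if s then b else 0ℚ)
            bool true = ≤-trans (≤-reflexive (l₁ iD)) 2≤b
            bool false = ≤-reflexive (l₂ iD)

          -- Only picks of nodes in `S` influence the losses; the other coordinates have Lipschitz
          -- constant 0 and growth factor 1, which leaves at most D factors `Gr`.
          f-tail : E d (λ ω → f ω ^ k) ≤ (1ℚ + ρ) ^ k * Gr ^ D
          f-tail = ≤-trans (azuma picks k f (λ i → if S i then b else 0ℚ)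
              (λ ω → x≤x+y (*≥0 (inv≥0 D>0) (card≥0 (losses S ω)))) (λ i → kb (S i)) f-lipschitz)
            (*-mono (^≥0 k (+≥0 0≤1 ρ≥0)) (product≥0 λ i → ≤-trans 0≤1 (1≤growth k _))
              (^-mono k (E≥ d λ ω _ → +≥0 0≤1 (*≥0 (inv≥0 D>0) (card≥0 (losses S ω)))) E-f)
              (≤-trans (≤-reflexive (trans (product-cong λ i → gr (S i)) (product-if S Gr))) (^-monoʳ Gr≥1 count≤D)))
            where
            kb : ∀ s → ⌜ k ⌝ * (if s then b else 0ℚ) ≤ 1ℚ
            kb true = kb≤1
            kb false = subst (_≤ 1ℚ) (≡-sym (zeroʳ _)) 0≤1
            opaque
              unfolding _+_
              l : ∀ k → 1ℚ + k * k * (0ℚ * 0ℚ) ≡ 1ℚ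
              l = solve-∀ ring
            gr : ∀ s → growth k (if s then b else 0ℚ) ≡ (if s then Gr else 1ℚ)
            gr true = refl
            gr false = l ⌜ k ⌝
            E-f : E d f ≤ 1ℚ + ρ
            E-f = ≤-trans (≤-reflexive (E-affine d 1ℚ iD L)) (+-mono-≤ ≤-refl
              (≤-trans (*-monoˡ (inv≥0 D>0) E-L) (≤-reflexive (trans (l₁ iD ρ ⌜ D ⌝) (trans (cong (ρ *_) (inv-*ʳ D>0)) (*-identityʳ ρ))))))
              where
              opaque
                unfolding _+_
                l₁ : ∀ i r d → i * (r * d) ≡ r * (d * i)
                l₁ = solve-∀ ring

        private
          -- The second summand is the Markov weight of too many losses at the arriving node. The
          -- factor `Gr ^ 0` only gives it the shape that `dichotomy` expects.
          Ψ : Vec (Pick q (suc R′)) n → ℚ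
          Ψ ω = Φ (next st S ω) + f ω ^ k * (wl * Gr ^ 0)

          Ψ-mean : ∀ {B τ} → Φ st ≤ B → (1ℚ + ρ) ^ k * (wl * Gr ^ D) ≤ τ → E d Ψ ≤ B + τ
          Ψ-mean {B} {τ} Φ≤B tail≤τ = begin
            E d Ψ
              ≡⟨ E-+ d (λ ω → Φ (next st S ω)) (λ ω → f ω ^ k * (wl * Gr ^ 0)) ⟩
            E d (λ ω → Φ (next st S ω)) + E d (λ ω → f ω ^ k * (wl * Gr ^ 0))
              ≡⟨ cong (E d (λ ω → Φ (next st S ω)) +_) (E-*ʳ d (λ ω → f ω ^ k) (wl * Gr ^ 0)) ⟩
            E d (λ ω → Φ (next st S ω)) + E d (λ ω → f ω ^ k) * (wl * Gr ^ 0)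
              ≤⟨ +-mono-≤ (≤-trans Φ-step Φ≤B) (*-monoʳ (*≥0 wl≥0 0≤1) f-tail) ⟩
            B + (1ℚ + ρ) ^ k * Gr ^ D * (wl * Gr ^ 0)
              ≡⟨ cong (B +_) (l ((1ℚ + ρ) ^ k) wl (Gr ^ D)) ⟩
            B + (1ℚ + ρ) ^ k * (wl * Gr ^ D)
              ≤⟨ +-mono-≤ ≤-refl tail≤τ ⟩
            B + τ ∎
            where
            open ≤-Reasoning
            opaque
              unfolding _+_
              l : ∀ a w g → a * g * (w * 1ℚ) ≡ a * (w * g)
              l = solve-∀ ring

          conclude : ∀ {B τ} → B + τ < 1ℚ → ∀ ω → Supp d ω → Ψ ω ≤ B + τ → (∀ u → palette st u (proj₁ (lookup ω u)) ≡ true) ×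
            Φ (next st S ω) ≤ B + τ × card (losses S ω) ≤ σ * ⌜ D ⌝
          conclude B+τ<1 ω supp h =
            Fω , ≤-trans (x≤x+y tail≥0) h , L≤
            where
            tail = f ω ^ k * (wl * Gr ^ 0)
            opaque
              unfolding _+_
              l₃ : ∀ s x → s - x ≡ 1ℚ + s - (1ℚ + x)
              l₃ = solve-∀ ring
            Fω : ∀ u → palette st u (proj₁ (lookup ω u)) ≡ true
            Fω u = proj₁ (Supp-lookup picks ω supp u)
            f≥0 : 0ℚ ≤ f ω
            f≥0 = +≥0 0≤1 (*≥0 (inv≥0 D>0) (card≥0 (losses S ω)))
            tail≥0 : 0ℚ ≤ tail
            tail≥0 = *≥0 (^≥0 k f≥0) (*≥0 wl≥0 0≤1)
            next-size : ∀ u → ⌜ g ⌝ ≤ card (palette (next st S ω) u)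
            next-size u = remove-≥ u (proj₁ (lookup ω u)) (Fω u)
            next-pair≥0 : ∀ u u′ → 0ℚ ≤ pairTerm (next st S ω) u u′
            next-pair≥0 u u′ with u Fin.≟ u′
            ... | yes _ = ≤-refl
            ... | no _ = pairWeight≥0 (palette (next st S ω) u) (palette (next st S ω) u′) (rem′ u ℕ.+ rem′ u′) (next-size u) (next-size u′)
            Φ′≥0 : 0ℚ ≤ Φ (next st S ω)
            Φ′≥0 = +≥0 (sum≥0 λ u → sum≥0 (next-pair≥0 u))
              (sum≥0 λ u → lossWeight≥0 (lossCount (next st S ω) u) (rem′ u))
            L≤ : L ω ≤ σ * ⌜ D ⌝
            L≤ = subst (_≤ σ * ⌜ D ⌝) (trans (cong (_* ⌜ D ⌝) (*-comm iD (L ω))) (trans (*-assoc (L ω) iD ⌜ D ⌝)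
                (trans (cong (L ω *_) (inv-*ˡ D>0)) (*-identityʳ _))))
              (*-monoʳ (<⇒≤ D>0) (≤-of-diff (l₃ σ _) (diff≥0 (dichotomy 0 1+σ>0 (≤-trans (x≤y+x Φ′≥0) h) B+τ<1))))

        -- One outcome must serve both purposes, hence the sum `Ψ`. Its mean is at most `B + τ`;
        -- after the choice the tail summand is dropped, but the bound on `Φ` stays raised by `τ`.
        choose : ∀ {B τ} → Φ st ≤ B → B + τ < 1ℚ → (1ℚ + ρ) ^ k * (wl * Gr ^ D) ≤ τ →
          Σ (Vec (Pick q (suc R′)) n) λ ω → (∀ u → palette st u (proj₁ (lookup ω u)) ≡ true) ×
            Φ (next st S ω) ≤ B + τ × card (losses S ω) ≤ σ * ⌜ D ⌝
        choose {B} {τ} Φ≤B B+τ<1 tail≤τ = proj₁ pick , conclude {B} {τ} B+τ<1 (proj₁ pick) (proj₁ (proj₂ pick)) (proj₂ (proj₂ pick))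
          where
          pick : Σ (Vec (Pick q (suc R′)) n) λ ω → Supp d ω × Ψ ω ≤ B + τ
          pick = E-pick d Ψ (Ψ-mean Φ≤B tail≤τ)

        next-regular : ∀ (ω : Vec (Pick q (suc R′)) n) → (∀ u → palette st u (proj₁ (lookup ω u)) ≡ true) → Regular (next st S ω)
        next-regular ω Fω = record { palette-size = size }
          where
          size : ∀ u → card (palette (next st S ω) u) ≡ ⌜ remaining (next st S ω) u ⌝ + ⌜ g ⌝
          size u with S u in Su
          ... | false = palette-size u
          ... | true with rem u in rem≡ | rem>0 u Su
          ... | suc r | _ = trans (card-∖ (F u) _ (Fω u)) (trans (cong (_- 1ℚ) (trans (palette-size u) (cong (λ m → ⌜ m ⌝ + ⌜ g ⌝) rem≡))) (l ⌜ r ⌝ ⌜ g ⌝))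
            where
            opaque
              unfolding _+_
              l : ∀ r g → 1ℚ + r + g - 1ℚ ≡ r + g
              l = solve-∀ ring

  -- Online partial edge colouring

  record Round (n : ℕ) : Set where
    constructor round
    field
      nbrs left : Fin n → Bool
      col : Fin n → ℕ
  open Round

  Coloured : ∀ {n} → Round n → Fin n → Set
  Coloured r u = nbrs r u ≡ true × left r u ≡ false

  degree : ∀ {n} → List (Fin n → Bool) → Fin n → ℕ
  degree [] u = 0
  degree (S ∷ Ss) u = (if S u then 1 else 0) ℕ.+ degree Ss u

  record Valid {n} (D : ℕ) (Ss : List (Fin n → Bool)) : Set where
    constructor valid
    field
      length≤ : length Ss ℕ.≤ n
      online≤ : All (λ S → count S ℕ.≤ D) Ss
      offline≤ : ∀ u → degree Ss u ℕ.≤ D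
  open Valid

  record SoundRound {n} (D′ K : ℕ) (r : Round n) : Set where
    constructor soundRound
    field
      left⊆ : ∀ u → left r u ≡ true → nbrs r u ≡ true
      col< : ∀ u → Coloured r u → col r u ℕ.< K
      col≢ : ∀ u u′ → u ≢ u′ → Coloured r u → Coloured r u′ → col r u ≢ col r u′
      left≤ : count (left r) ℕ.≤ D′
  open SoundRound

  Compatible : ∀ {n} → Round n → Round n → Set
  Compatible r r′ = ∀ u → Coloured r u → Coloured r′ u → col r u ≢ col r′ u

  record Sound {n} (D′ K : ℕ) (h : List (Round n)) : Set where
    constructor sound
    field
      rounds : All (SoundRound D′ K) h
      compatible : AllPairs Compatible h
      leftDegree : ∀ u → degree (map left h) u ℕ.≤ D′
  open Sound

  -- A strategy that colours all edges of a graph of maximum degree at most D with K colours,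
  -- except for a subgraph of maximum degree at most D′. Histories list the latest round first.
  record Strategy (n D D′ K : ℕ) : Set₁ where
    field
      Inv : List (Round n) → Set
      start : Inv []
      extend : ∀ {h} → Inv h → ∀ S → Valid D (S ∷ map nbrs h) → Σ (Round n) λ r → nbrs r ≡ S × Inv (r ∷ h)
      sound-Inv : ∀ {h} → Inv h → Sound D′ K h

  true≢false : ∀ {b : Bool} → b ≡ true → b ≡ false → ⊥
  true≢false refl ()

  module _ {n D D′ D″ K K′ : ℕ} (A : Strategy n D D′ K) (B : Strategy n D′ D″ K′) where
    private
      module A = Strategy A
      module B = Strategy B

      merge : Round n × Round n → Round n
      merge (r , s) = round (nbrs r) (left s) (λ u → if left r u then K ℕ.+ col s u else col r u)

      Linked : Round n × Round n → Set
      Linked (r , s) = nbrs s ≡ left r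

      -- Merged rounds forget their two components, so the invariant stores them.
      record Inv (h : List (Round n)) : Set where
        field
          pairs : List (Round n × Round n)
          merged : h ≡ map merge pairs
          inv-A : A.Inv (map proj₁ pairs)
          inv-B : B.Inv (map proj₂ pairs)
          linked : All Linked pairs
      open Inv

      linked-nbrs : ∀ {ps} → All Linked ps → map nbrs (map proj₂ ps) ≡ map left (map proj₁ ps)
      linked-nbrs [] = refl
      linked-nbrs (e ∷ l) = cong₂ _∷_ e (linked-nbrs l)

      merge-nbrs : ∀ ps → map nbrs (map merge ps) ≡ map nbrs (map proj₁ ps)
      merge-nbrs [] = refl
      merge-nbrs (_ ∷ ps) = cong (_ ∷_) (merge-nbrs ps)

      merge-left : ∀ ps → map left (map merge ps) ≡ map left (map proj₂ ps)
      merge-left [] = refl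
      merge-left (_ ∷ ps) = cong (_ ∷_) (merge-left ps)

      data ColouredBy (p : Round n × Round n) (u : Fin n) : Set where
        first : Coloured (proj₁ p) u → col (merge p) u ≡ col (proj₁ p) u → ColouredBy p u
        second : Coloured (proj₂ p) u → col (merge p) u ≡ K ℕ.+ col (proj₂ p) u → ColouredBy p u

      colouredBy : ∀ p u → Linked p → Coloured (merge p) u → ColouredBy p u
      colouredBy (r , s) u e (x , y) with left r u in eq
      ... | true = second (trans (cong (λ f → f u) e) eq , y) (cong (if_then K ℕ.+ col s u else col r u) eq)
      ... | false = first (x , eq) (cong (if_then K ℕ.+ col s u else col r u) eq)

      <-≢ : ∀ {x y} → x ℕ.< K → x ≢ K ℕ.+ y
      <-≢ p refl = ℕP.<⇒≱ p (ℕP.m≤m+n K _)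

      merge-round : ∀ {p} → Linked p → SoundRound D′ K (proj₁ p) → SoundRound D″ K′ (proj₂ p) →
        SoundRound D″ (K ℕ.+ K′) (merge p)
      merge-round {p@(r , s)} e a b = soundRound
        (λ u h → left⊆ a u (trans (cong (λ f → f u) (≡-sym e)) (left⊆ b u h))) lt ne (left≤ b)
        where
        lt : ∀ u → Coloured (merge p) u → col (merge p) u ℕ.< K ℕ.+ K′
        lt u c with colouredBy p u e c
        ... | first d eq rewrite eq = ℕP.<-≤-trans (col< a u d) (ℕP.m≤m+n K K′)
        ... | second d eq rewrite eq = ℕP.+-monoʳ-< K (col< b u d)
        ne : ∀ u u′ → u ≢ u′ → Coloured (merge p) u → Coloured (merge p) u′ → col (merge p) u ≢ col (merge p) u′
        ne u u′ u≢u′ c c′ with colouredBy p u e c | colouredBy p u′ e c′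
        ... | first d eq | first d′ eq′ rewrite eq | eq′ = col≢ a u u′ u≢u′ d d′
        ... | first d eq | second d′ eq′ rewrite eq | eq′ = <-≢ (col< a u d)
        ... | second d eq | first d′ eq′ rewrite eq | eq′ = <-≢ (col< a u′ d′) ∘ ≡-sym
        ... | second d eq | second d′ eq′ rewrite eq | eq′ = col≢ b u u′ u≢u′ d d′ ∘ ℕP.+-cancelˡ-≡ K _ _

      merge-rounds : ∀ {ps} → All Linked ps → All (SoundRound D′ K) (map proj₁ ps) → All (SoundRound D″ K′) (map proj₂ ps) →
        All (SoundRound D″ (K ℕ.+ K′)) (map merge ps)
      merge-rounds [] _ _ = []
      merge-rounds (e ∷ l) (a ∷ as) (b ∷ bs) = merge-round e a b ∷ merge-rounds l as bs

      merge-compatible : ∀ {p p′} → Linked p → Linked p′ → SoundRound D′ K (proj₁ p) → SoundRound D′ K (proj₁ p′) →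
        Compatible (proj₁ p) (proj₁ p′) → Compatible (proj₂ p) (proj₂ p′) → Compatible (merge p) (merge p′)
      merge-compatible {p} {p′} e e′ s s′ a b u c c′ with colouredBy p u e c | colouredBy p′ u e′ c′
      ... | first d eq | first d′ eq′ rewrite eq | eq′ = a u d d′
      ... | first d eq | second d′ eq′ rewrite eq | eq′ = <-≢ (col< s u d)
      ... | second d eq | first d′ eq′ rewrite eq | eq′ = <-≢ (col< s′ u d′) ∘ ≡-sym
      ... | second d eq | second d′ eq′ rewrite eq | eq′ = b u d d′ ∘ ℕP.+-cancelˡ-≡ K _ _

      merge-pairs : ∀ {ps} → All Linked ps → All (SoundRound D′ K) (map proj₁ ps) →
        AllPairs Compatible (map proj₁ ps) → AllPairs Compatible (map proj₂ ps) → AllPairs Compatible (map merge ps)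
      merge-pairs [] _ _ _ = []
      merge-pairs {p ∷ _} (e ∷ l) (s ∷ ss) (a ∷ as) (b ∷ bs) = go l ss a b ∷ merge-pairs l ss as bs
        where
        go : ∀ {qs} → All Linked qs → All (SoundRound D′ K) (map proj₁ qs) → All (Compatible (proj₁ p)) (map proj₁ qs) →
          All (Compatible (proj₂ p)) (map proj₂ qs) → All (Compatible (merge p)) (map merge qs)
        go [] _ _ _ = []
        go (e′ ∷ l) (s′ ∷ ss) (a ∷ as) (b ∷ bs) = merge-compatible e e′ s s′ a b ∷ go l ss as bs

    -- The colours of `B` are shifted by `K` and cannot clash with those of `A`. Soundness of `A`
    -- bounds the degrees of its leftover graph on both sides by D′, which makes that graph a valid
    -- input for `B`.
    compose : Strategy n D D″ (K ℕ.+ K′)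
    compose = record
      { Inv = Inv
      ; start = record { pairs = [] ; merged = refl ; inv-A = A.start ; inv-B = B.start ; linked = [] }
      ; extend = ext
      ; sound-Inv = snd
      }
      where
      ext : ∀ {h} → Inv h → ∀ S → Valid D (S ∷ map nbrs h) → Σ (Round n) λ r → nbrs r ≡ S × Inv (r ∷ h)
      ext {h} inv S v with A.extend (inv-A inv) S (subst (λ l → Valid D (S ∷ l)) (trans (cong (map nbrs) (merged inv)) (merge-nbrs (pairs inv))) v)
      ... | r , refl , inv-r with B.extend (inv-B inv) (left r) (subst (λ l → Valid D′ (left r ∷ l)) (≡-sym (linked-nbrs (linked inv))) v′)
        where
        s = A.sound-Inv inv-r
        v′ : Valid D′ (left r ∷ map left (map proj₁ (pairs inv)))
        v′ = valid (subst (ℕ._≤ n) (cong suc (trans (ListP.length-map nbrs h) (trans (cong length (merged inv))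
                (trans (ListP.length-map merge (pairs inv)) (≡-sym (trans (ListP.length-map left (map proj₁ (pairs inv))) (ListP.length-map proj₁ (pairs inv)))))))) (length≤ v))
              (AllP.map⁺ (All.map left≤ (rounds s))) (leftDegree s)
      ... | r′ , eq , inv-r′ = merge (r , r′) , refl , record
        { pairs = (r , r′) ∷ pairs inv ; merged = cong (merge (r , r′) ∷_) (merged inv) ; inv-A = inv-r ; inv-B = inv-r′
        ; linked = eq ∷ linked inv }
      snd : ∀ {h} → Inv h → Sound D″ (K ℕ.+ K′) h
      snd inv rewrite merged inv = sound
        (merge-rounds (linked inv) (rounds s) (rounds s′))
        (merge-pairs (linked inv) (rounds s) (compatible s) (compatible s′))
        (λ u → subst (λ l → degree l u ℕ.≤ D″) (≡-sym (merge-left (pairs inv))) (leftDegree s′ u))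
        where
        s = A.sound-Inv (inv-A inv)
        s′ = B.sound-Inv (inv-B inv)

  -- The greedy strategy

  -- Pigeonhole: the `length xs` + 1 smallest candidates cannot all occur in `xs`.
  fresh : ∀ (xs : List ℕ) → Σ ℕ λ c → c ℕ.≤ length xs × c ∉ xs
  fresh xs with FinP.¬∀⟶∃¬ (suc (length xs)) (λ i → toℕ i ∈ xs) (λ i → DecMem._∈?_ ℕ._≟_ (toℕ i) xs) notAll
    where
    notAll : ¬ (∀ (i : Fin (suc (length xs))) → toℕ i ∈ xs)
    notAll f with FinP.pigeonhole (ℕP.n<1+n (length xs)) (λ i → index (f i))
    ... | i , j , i<j , eq = ℕP.<⇒≢ i<j (trans (lookup-index (f i)) (trans (cong (List.lookup xs) eq) (≡-sym (lookup-index (f j)))))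
  ... | i , p = toℕ i , ℕ.s≤s⁻¹ (FinP.toℕ<n i) , p

  -- `forbidden u` holds the colours at the offline endpoint, and `taken` those given earlier in the
  -- same arrival. Fewer than D of the former and at most D of the latter leave a colour below D +
  -- D.
  greedy-colours : ∀ {n} D (S : Fin n → Bool) (forbidden : Fin n → List ℕ) (taken : List ℕ) →
    length taken ℕ.+ count S ℕ.≤ D → (∀ u → S u ≡ true → length (forbidden u) ℕ.< D) →
    Σ (Fin n → ℕ) λ c → (∀ u → S u ≡ true → c u ℕ.< D ℕ.+ D × c u ∉ forbidden u × c u ∉ taken) ×
      (∀ u u′ → u ≢ u′ → S u ≡ true → S u′ ≡ true → c u ≢ c u′)
  greedy-colours {zero} D S forbidden taken _ _ = (λ ()) , (λ ()) , (λ ())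
  greedy-colours {suc n} D S forbidden taken t≤ f< with S zero in S0
  ... | false with greedy-colours D (S ∘ suc) (forbidden ∘ suc) taken t≤ (f< ∘ suc)
  ... | c , ok , ne = c′ , ok′ , ne′
    where
    c′ : Fin (suc n) → ℕ
    c′ zero = 0
    c′ (suc u) = c u
    ok′ : ∀ u → S u ≡ true → c′ u ℕ.< D ℕ.+ D × c′ u ∉ forbidden u × c′ u ∉ taken
    ok′ zero p = ⊥-elim (true≢false p S0)
    ok′ (suc u) p = ok u p
    ne′ : ∀ u u′ → u ≢ u′ → S u ≡ true → S u′ ≡ true → c′ u ≢ c′ u′
    ne′ zero _ _ p _ = ⊥-elim (true≢false p S0)
    ne′ (suc u) zero _ _ p = ⊥-elim (true≢false p S0)
    ne′ (suc u) (suc u′) u≢u′ = ne u u′ λ { refl → u≢u′ refl }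
  greedy-colours {suc n} D S forbidden taken t≤ f< | true with fresh (forbidden zero ++ taken)
  ... | c₀ , c₀≤ , c₀∉ with greedy-colours D (S ∘ suc) (forbidden ∘ suc) (c₀ ∷ taken)
    (subst (ℕ._≤ D) (ℕP.+-suc (length taken) _) t≤) (f< ∘ suc)
  ... | c , ok , ne = c′ , ok′ , ne′
    where
    c′ : Fin (suc n) → ℕ
    c′ zero = c₀
    c′ (suc u) = c u
    ok′ : ∀ u → S u ≡ true → c′ u ℕ.< D ℕ.+ D × c′ u ∉ forbidden u × c′ u ∉ taken
    ok′ zero p = ℕP.≤-<-trans (subst (c₀ ℕ.≤_) (ListP.length-++ (forbidden zero)) c₀≤)
        (ℕP.+-mono-<-≤ (f< zero p) (ℕP.≤-trans (ℕP.m≤m+n _ _) t≤)) ,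
      (λ q → c₀∉ (∈-++⁺ˡ q)) , (λ q → c₀∉ (∈-++⁺ʳ (forbidden zero) q))
    ok′ (suc u) p = let x , y , z = ok u p in x , y , z ∘ there
    ne′ : ∀ u u′ → u ≢ u′ → S u ≡ true → S u′ ≡ true → c′ u ≢ c′ u′
    ne′ zero zero u≢u′ _ _ = ⊥-elim (u≢u′ refl)
    ne′ zero (suc u′) _ _ p e = proj₂ (proj₂ (ok u′ p)) (here (≡-sym e))
    ne′ (suc u) zero _ p _ e = proj₂ (proj₂ (ok u p)) (here e)
    ne′ (suc u) (suc u′) u≢u′ = ne u u′ λ { refl → u≢u′ refl }

  module _ {n : ℕ} where
    private
      none : Fin n → Bool
      none _ = false

      used : List (Round n) → Fin n → List ℕ
      used [] u = []
      used (r ∷ h) u = if nbrs r u then col r u ∷ used h u else used h u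

      used-length : ∀ h u → length (used h u) ≡ degree (map nbrs h) u
      used-length [] u = refl
      used-length (r ∷ h) u with nbrs r u
      ... | true = cong suc (used-length h u)
      ... | false = used-length h u

      unused-compatible : ∀ r h → (∀ u → nbrs r u ≡ true → col r u ∉ used h u) → All (Compatible r) h
      unused-compatible r [] _ = []
      unused-compatible r (s ∷ h) f = head ∷ unused-compatible r h λ u p q → f u p (keep u q)
        where
        keep : ∀ u {c} → c ∈ used h u → c ∈ used (s ∷ h) u
        keep u q with nbrs s u
        ... | true = there q
        ... | false = q
        head : Compatible r s
        head u (p , _) (p′ , _) e = f u p (subst (λ b → col r u ∈ (if b then col s u ∷ used h u else used h u)) (≡-sym p′) (here e))

      count-none : ∀ {m} → count {m} (λ _ → false) ≡ 0
      count-none {zero} = refl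
      count-none {suc m} = count-none {m}

      degree-left : ∀ {h} → All (λ r → left r ≡ none) h → ∀ u → degree (map left h) u ≡ 0
      degree-left [] u = refl
      degree-left {r ∷ _} (e ∷ es) u rewrite e = degree-left es u

    greedy : ∀ D → Strategy n D 0 (D ℕ.+ D)
    greedy D = record
      { Inv = λ h → Sound 0 (D ℕ.+ D) h × All (λ r → left r ≡ none) h
      ; start = sound [] [] (λ _ → ℕ.z≤n) , []
      ; extend = ext
      ; sound-Inv = proj₁
      }
      where
      ext : ∀ {h} → Sound 0 (D ℕ.+ D) h × All (λ r → left r ≡ none) h → ∀ S → Valid D (S ∷ map nbrs h) →
        Σ (Round n) λ r → nbrs r ≡ S × (Sound 0 (D ℕ.+ D) (r ∷ h) × All (λ r → left r ≡ none) (r ∷ h))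
      ext {h} (s , l) S v with greedy-colours D S (used h) [] (All.head (online≤ v)) forbidden<
        where
        forbidden< : ∀ u → S u ≡ true → length (used h u) ℕ.< D
        forbidden< u p rewrite used-length h u = subst (λ b → (if b then 1 else 0) ℕ.+ degree (map nbrs h) u ℕ.≤ D) p (offline≤ v u)
      ... | c , ok , ne = r , refl , sound
          (soundRound (λ u ()) (λ u p → proj₁ (ok u (proj₁ p))) (λ u u′ u≢u′ p p′ → ne u u′ u≢u′ (proj₁ p) (proj₁ p′))
            (ℕP.≤-reflexive (count-none {n})) ∷ rounds s)
          (unused-compatible r h (λ u p → proj₁ (proj₂ (ok u p))) ∷ compatible s)
          (λ u → ℕP.≤-reflexive (degree-left {r ∷ h} (refl ∷ l) u)) , refl ∷ l
        where
        r = round S none c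

  -- The randomised phase as a strategy

  nonempty : ∀ {q} (F : Fin q → Bool) → 0ℚ < card F → Σ (Fin q) λ c → F c ≡ true
  nonempty {q} F h with any? (λ c → F c 𝔹.≟ true)
  ... | yes p = p
  ... | no none = ⊥-elim (<-irrefl (<-≤-trans h (≤-reflexive (trans (sum-cong zero-term) (trans (sum-const q 0ℚ) (zeroʳ _))))))
    where
    zero-term : ∀ c → 𝟙 (F c) ≡ 0ℚ
    zero-term c with F c in eq
    ... | true = ⊥-elim (none (c , eq))
    ... | false = refl

  loses-intro : ∀ {n q R} (S : Fin n → Bool) (ω : Vec (Pick q R) n) u u′ → u′ ≢ u → S u ≡ true → S u′ ≡ true →
    proj₁ (lookup ω u′) ≡ proj₁ (lookup ω u) → toℕ (proj₂ (lookup ω u′)) ℕ.≤ toℕ (proj₂ (lookup ω u)) → losses S ω u ≡ true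
  loses-intro S ω u u′ u′≢u Su Su′ c≡ τ≤ = cong₂ _∧_ Su (⌊⌋-true (any? _) (u′ , beaten))
    where
    beaten : beats S u u′ (lookup ω u) (lookup ω u′) ≡ true
    beaten rewrite ⌊⌋-false (u′ Fin.≟ u) u′≢u | Su′
      | ⌊⌋-true (proj₁ (lookup ω u′) Fin.≟ proj₁ (lookup ω u)) c≡
      | ⌊⌋-true (toℕ (proj₂ (lookup ω u′)) ℕ.≤? toℕ (proj₂ (lookup ω u))) τ≤ = refl

  module Phase (n D T g R′ k : ℕ) (ρ σ ε b τ : ℚ) where
    open Potential D g R′ k ρ σ ε b

    -- `loss-init` serves twice: it bounds the initial loss terms and, being the same expression,
    -- the tail weight at each arrival. Accordingly `budget` charges `τ` for n² ordered pairs, n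
    -- offline nodes and n arrivals.
    record PhaseConditions : Set where
      field
        conditions : Conditions
        σD<T+1 : σ * ⌜ D ⌝ < ⌜ suc T ⌝
        pair-init : (1ℚ + 1ℚ) ^ k * (inv (2ℚ + ε) ^ k * Gr ^ (D ℕ.+ D)) ≤ τ
        loss-init : (1ℚ + ρ) ^ k * (inv (1ℚ + σ) ^ k * Gr ^ D) ≤ τ
        budget : ⌜ n ⌝ * (⌜ n ⌝ * τ) + ⌜ n ⌝ * τ + ⌜ n ⌝ * τ < 1ℚ

    module _ (pc : PhaseConditions) where
      open PhaseConditions pc
      open Conditions conditions

      private
        B₀ = ⌜ n ⌝ * (⌜ n ⌝ * τ) + ⌜ n ⌝ * τ

        -- Rounds record colours as natural numbers while palettes live on `Fin q`, hence the
        -- quantification over `x`.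
        Burned : State n q → Fin n → ℕ → Set
        Burned st u c = ∀ x → toℕ x ≡ c → palette st u x ≡ false

        record Inv (h : List (Round n)) : Set where
          field
            st : State n q
            regular : Regular st
            Φ≤ : Φ st ≤ B₀ + ⌜ length h ⌝ * τ
            length≤n : length h ℕ.≤ n
            remaining+degree : ∀ u → remaining st u ℕ.+ degree (map nbrs h) u ≡ D
            loss≡degree : ∀ u → lossCount st u ≡ degree (map left h) u
            burned : All (λ r → ∀ u → nbrs r u ≡ true → Burned st u (col r u)) h
            rounds-ok : All (SoundRound T q) h
            compat : AllPairs Compatible h
        open Inv

        τ≥0 : 0ℚ ≤ τ
        τ≥0 = ≤-trans (*≥0 (^≥0 k (+≥0 0≤1 ρ≥0)) (*≥0 (^≥0 k (inv≥0 (+>0 0<1 σ≥0))) (^≥0 D (≤-trans 0≤1 (1≤growth k b))))) loss-init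

        within-budget : ∀ {m} → m ℕ.≤ n → B₀ + ⌜ m ⌝ * τ < 1ℚ
        within-budget m≤n = ≤-<-trans (+-mono-≤ ≤-refl (*-monoʳ τ≥0 (⌜⌝-mono m≤n))) budget

        ≤T : ∀ {m} → ⌜ m ⌝ ≤ σ * ⌜ D ⌝ → m ℕ.≤ T
        ≤T h = ℕ.s≤s⁻¹ (⌜⌝-cancel-< (≤-<-trans h σD<T+1))

        initial : State n q
        initial = record { palette = λ _ → all-true ; lossCount = λ _ → 0 ; remaining = λ _ → D }

        Φ-initial : Φ initial ≤ B₀ + 0ℚ * τ
        Φ-initial = ≤-trans (+-mono-≤ (sum-≤-const λ u → sum-≤-const (pair u)) (sum-≤-const loss)) (≤-reflexive (l B₀ τ))
          where
          opaque
            unfolding _+_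
            l : ∀ x t → x ≡ x + 0ℚ * t
            l = solve-∀ ring
          q>0 : 0ℚ < ⌜ q ⌝
          q>0 = subst (0ℚ <_) (≡-sym (⌜⌝-+ D g)) (+>0 D>0 (⌜⌝≥0 g))
          ratio : overlapRatio (all-true {q}) all-true ≡ 1ℚ
          ratio = trans (cong₂ (λ x y → ⌜ q ⌝ * (x * (inv y * inv y))) (card-all q) (card-all q))
            (trans (l₁ ⌜ q ⌝ (inv ⌜ q ⌝)) (trans (cong₂ _*_ (inv-*ʳ q>0) (inv-*ʳ q>0)) (*-identityˡ 1ℚ)))
            where
            opaque
              unfolding _+_
              l₁ : ∀ q i → q * (q * (i * i)) ≡ q * i * (q * i)
              l₁ = solve-∀ ring
          pair : ∀ u u′ → pairTerm initial u u′ ≤ τ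
          pair u u′ with u Fin.≟ u′
          ... | yes _ = τ≥0
          ... | no _ = subst (λ x → (1ℚ + x) ^ k * (inv (2ℚ + ε) ^ k * Gr ^ (D ℕ.+ D)) ≤ τ) (≡-sym ratio) pair-init
          loss : ∀ u → lossTerm initial u ≤ τ
          loss u = subst (λ x → (1ℚ + x) ^ k * (inv (1ℚ + σ) ^ k * Gr ^ D) ≤ τ)
            (≡-sym (trans (l₂ ρ ⌜ D ⌝ iD) (trans (cong (ρ *_) (inv-*ʳ D>0)) (*-identityʳ ρ)))) loss-init
            where
            opaque
              unfolding _+_
              l₂ : ∀ r d i → (0ℚ + r * d) * i ≡ r * (d * i)
              l₂ = solve-∀ ring

        start-Inv : Inv []
        start-Inv = record
          { st = initial
          ; regular = record { palette-size = λ _ → trans (card-all q) (⌜⌝-+ D g) }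
          ; Φ≤ = Φ-initial
          ; length≤n = ℕ.z≤n
          ; remaining+degree = λ _ → ℕP.+-identityʳ D
          ; loss≡degree = λ _ → refl
          ; burned = [] ; rounds-ok = [] ; compat = []
          }

        module Extend {h} (inv : Inv h) (S : Fin n → Bool) (v : Valid D (S ∷ map nbrs h)) where
          private
            s = st inv
            len< : length h ℕ.< n
            len< = subst (λ m → suc m ℕ.≤ n) (ListP.length-map nbrs h) (length≤ v)
            Φ<1 : Φ s < 1ℚ
            Φ<1 = ≤-<-trans (Φ≤ inv) (within-budget (length≤n inv))
            witness : ∀ u → Σ (Fin q) λ c → palette s u c ≡ true
            witness u = nonempty (palette s u) (subst (0ℚ <_) (≡-sym (Regular.palette-size (regular inv) u))
              (subst (0ℚ <_) (+-comm ⌜ g ⌝ ⌜ remaining s u ⌝) (+>0 (<-≤-trans 0<1 1≤g) (⌜⌝≥0 (remaining s u)))))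
            rem>0 : ∀ u → S u ≡ true → 0 ℕ.< remaining s u
            rem>0 u Su = ℕP.+-cancelʳ-≤ (degree (map nbrs h) u) 1 (remaining s u)
              (subst (suc (degree (map nbrs h) u) ℕ.≤_) (≡-sym (remaining+degree inv u))
                (subst (λ x → (if x then 1 else 0) ℕ.+ degree (map nbrs h) u ℕ.≤ D) Su (offline≤ v u)))
            open Step conditions s (regular inv) (λ u → proj₁ (witness u)) (λ u → proj₂ (witness u))
            open Arrival S (All.head (online≤ v)) rem>0 Φ<1

            opaque
              unfolding _+_
              suc-budget : ∀ B m t → B + m * t + t ≡ B + (1ℚ + m) * t
              suc-budget = solve-∀ ring

            chosen : Σ (Vec (Pick q (suc R′)) n) λ ω → (∀ u → palette s u (proj₁ (lookup ω u)) ≡ true) ×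
              Φ (next s S ω) ≤ B₀ + ⌜ length h ⌝ * τ + τ × card (losses S ω) ≤ σ * ⌜ D ⌝
            chosen = choose (Φ≤ inv) (subst (_< 1ℚ) (≡-sym (suc-budget B₀ ⌜ length h ⌝ τ)) (within-budget len<)) loss-init

          module Picked (ω : Vec (Pick q (suc R′)) n) (Fω : ∀ u → palette s u (proj₁ (lookup ω u)) ≡ true)
            (Φ′≤ : Φ (next s S ω) ≤ B₀ + ⌜ length h ⌝ * τ + τ) (L≤ : card (losses S ω) ≤ σ * ⌜ D ⌝) where

            r : Round n
            r = round S (losses S ω) (λ u → toℕ (proj₁ (lookup ω u)))

            private
              s′ = next s S ω

              shrink : ∀ u x → palette s u x ≡ false → palette s′ u x ≡ false
              shrink u x e with S u
              ... | true = cong (_∧ not ⌊ x Fin.≟ proj₁ (lookup ω u) ⌋) e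
              ... | false = e

              burned-new : ∀ u → S u ≡ true → Burned s′ u (col r u)
              burned-new u Su x e rewrite Su | ⌊⌋-true (x Fin.≟ proj₁ (lookup ω u)) (FinP.toℕ-injective e) = 𝔹P.∧-zeroʳ (palette s u x)

              rem-step : ∀ u → remaining s′ u ℕ.+ ((if S u then 1 else 0) ℕ.+ degree (map nbrs h) u) ≡ D
              rem-step u with S u in Su
              ... | false = remaining+degree inv u
              ... | true with remaining s u | rem>0 u Su | remaining+degree inv u
              ... | suc m | _ | e = trans (ℕP.+-suc m _) e

              loss-deg : ∀ u → lossCount s′ u ≡ (if losses S ω u then 1 else 0) ℕ.+ degree (map left h) u
              loss-deg u with losses S ω u
              ... | true = cong suc (loss≡degree inv u)
              ... | false = loss≡degree inv u

              winners-differ : ∀ u u′ → u ≢ u′ → S u ≡ true × losses S ω u ≡ false → S u′ ≡ true × losses S ω u′ ≡ false →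
                proj₁ (lookup ω u) ≢ proj₁ (lookup ω u′)
              winners-differ u u′ u≢u′ (Su , wu) (Su′ , wu′) e
                with ℕP.≤-total (toℕ (proj₂ (lookup ω u))) (toℕ (proj₂ (lookup ω u′)))
              ... | inj₁ p = true≢false (loses-intro S ω u′ u u≢u′ Su′ Su e p) wu′
              ... | inj₂ p = true≢false (loses-intro S ω u u′ (u≢u′ ∘ ≡-sym) Su Su′ (≡-sym e) p) wu

              round-ok : SoundRound T q r
              round-ok = soundRound (λ u e → proj₁ (∧-true {S u} e)) (λ u _ → FinP.toℕ<n (proj₁ (lookup ω u)))
                (λ u u′ u≢u′ c c′ e → winners-differ u u′ u≢u′ c c′ (FinP.toℕ-injective e))
                (≤T (subst (_≤ σ * ⌜ D ⌝) (card≡count (losses S ω)) L≤))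

              new-compat : ∀ {h′} → All (λ r′ → ∀ u → nbrs r′ u ≡ true → Burned s u (col r′ u)) h′ → All (Compatible r) h′
              new-compat [] = []
              new-compat (x ∷ xs) = (λ u c c′ e → true≢false (Fω u) (x u (proj₁ c′) (proj₁ (lookup ω u)) e)) ∷ new-compat xs

            extended : Inv (r ∷ h)
            extended = record
              { st = s′
              ; regular = next-regular ω Fω
              ; Φ≤ = subst (Φ s′ ≤_) (suc-budget B₀ ⌜ length h ⌝ τ) Φ′≤
              ; length≤n = len<
              ; remaining+degree = rem-step
              ; loss≡degree = loss-deg
              ; burned = burned-new ∷ All.map (λ f u Su x e → shrink u x (f u Su x e)) (burned inv)
              ; rounds-ok = round-ok ∷ rounds-ok inv
              ; compat = new-compat (burned inv) ∷ compat inv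
              }

          result : Σ (Round n) λ r → nbrs r ≡ S × Inv (r ∷ h)
          result = P.r , refl , P.extended
            where
            module P = Picked (proj₁ chosen) (proj₁ (proj₂ chosen)) (proj₁ (proj₂ (proj₂ chosen))) (proj₂ (proj₂ (proj₂ chosen)))

        sound-phase : ∀ {h} → Inv h → Sound T q h
        sound-phase {h} inv = sound (rounds-ok inv) (compat inv) λ u → subst (ℕ._≤ T) (loss≡degree inv u) (≤T (bound u))
          where
          s = st inv
          witness : ∀ u → Σ (Fin q) λ c → palette s u c ≡ true
          witness u = nonempty (palette s u) (subst (0ℚ <_) (≡-sym (Regular.palette-size (regular inv) u))
            (subst (0ℚ <_) (+-comm ⌜ g ⌝ ⌜ remaining s u ⌝) (+>0 (<-≤-trans 0<1 1≤g) (⌜⌝≥0 (remaining s u)))))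
          bound : ∀ u → ⌜ lossCount s u ⌝ ≤ σ * ⌜ D ⌝
          bound = Step.loss-bound conditions s (regular inv) (λ u → proj₁ (witness u)) (λ u → proj₂ (witness u))
            (≤-<-trans (Φ≤ inv) (within-budget (length≤n inv)))

      phase : Strategy n D T q
      phase = record
        { Inv = Inv
        ; start = start-Inv
        ; extend = λ inv S v → Extend.result inv S v
        ; sound-Inv = sound-phase
        }

  -- From strategies to online algorithms

  -- An online algorithm is total on histories, whereas `extend` accepts valid inputs only; the
  -- replay therefore tests validity.
  valid? : ∀ {n} D (Ss : List (Fin n → Bool)) → Dec (Valid D Ss)
  valid? {n} D Ss = map′ (λ (x , y , z) → valid x y z) (λ v → length≤ v , online≤ v , offline≤ v)
    ((length Ss ℕ.≤? n) ×-dec All.all? (λ S → count S ℕ.≤? D) Ss ×-dec FinP.all? λ u → degree Ss u ℕ.≤? D)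

  degree-++ : ∀ {n} (Ss Ts : List (Fin n → Bool)) u → degree (Ss ++ Ts) u ≡ degree Ss u ℕ.+ degree Ts u
  degree-++ [] Ts u = refl
  degree-++ (S ∷ Ss) Ts u = trans (cong ((if S u then 1 else 0) ℕ.+_) (degree-++ Ss Ts u))
    (≡-sym (ℕP.+-assoc (if S u then 1 else 0) (degree Ss u) (degree Ts u)))

  Valid-++⁻ʳ : ∀ {n D} (Ss : List (Fin n → Bool)) {Ts} → Valid D (Ss ++ Ts) → Valid D Ts
  Valid-++⁻ʳ Ss {Ts} v = valid
    (ℕP.≤-trans (ℕP.m≤n+m _ (length Ss)) (subst (ℕ._≤ _) (ListP.length-++ Ss) (length≤ v)))
    (AllP.++⁻ʳ Ss (online≤ v))
    (λ u → ℕP.≤-trans (ℕP.m≤n+m _ (degree Ss u)) (subst (ℕ._≤ _) (degree-++ Ss Ts u) (offline≤ v u)))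

  degree-reverse : ∀ {n} (Ss : List (Fin n → Bool)) u → degree (reverse Ss) u ≡ degree Ss u
  degree-reverse [] u = refl
  degree-reverse (S ∷ Ss) u = trans (cong (λ l → degree l u) (ListP.unfold-reverse S Ss))
    (trans (degree-++ (reverse Ss) (S ∷ []) u) (trans (ℕP.+-comm _ (degree (S ∷ []) u))
      (cong₂ ℕ._+_ (ℕP.+-identityʳ _) (degree-reverse Ss u))))

  Valid-reverse : ∀ {n D} (Ss : List (Fin n → Bool)) → Valid D Ss → Valid D (reverse Ss)
  Valid-reverse {D = D} Ss v = valid (subst (ℕ._≤ _) (≡-sym (ListP.length-reverse Ss)) (length≤ v))
    (all (online≤ v)) (λ u → subst (ℕ._≤ _) (≡-sym (degree-reverse Ss u)) (offline≤ v u))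
    where
    all : ∀ {Ss} → All (λ S → count S ℕ.≤ D) Ss → All (λ S → count S ℕ.≤ D) (reverse Ss)
    all [] = []
    all {S ∷ Ss} (p ∷ ps) = subst (All _) (≡-sym (ListP.unfold-reverse S Ss)) (AllP.++⁺ (all ps) (p ∷ []))

  ∣∣≡count : ∀ {n} (S : Subset n) → Subset.∣ S ∣ ≡ count (lookup S)
  ∣∣≡count [] = refl
  ∣∣≡count (true ∷ S) = cong suc (∣∣≡count S)
  ∣∣≡count (false ∷ S) = ∣∣≡count S

  degree≡∣∣ : ∀ {n m} (ins : Vec (Subset n) m) u →
    degree (map lookup (toList ins)) u ≡ Subset.∣ tabulate (λ t → lookup (lookup ins t) u) ∣
  degree≡∣∣ [] u = refl
  degree≡∣∣ (S ∷ ins) u with lookup S u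
  ... | true = cong suc (degree≡∣∣ ins u)
  ... | false = degree≡∣∣ ins u

  MaxDegree⇒Valid : ∀ {n Δ} (ins : Input n) → MaxDegree ins Δ → Valid Δ (map lookup (toList ins))
  MaxDegree⇒Valid {n} {Δ} ins (on , off , _) = valid
    (ℕP.≤-reflexive (trans (ListP.length-map lookup (toList ins)) (VecP.length-toList ins)))
    (AllP.map⁺ (all ins on)) (λ u → subst (ℕ._≤ Δ) (≡-sym (degree≡∣∣ ins u)) (off u))
    where
    all : ∀ {m} (v : Vec (Subset n) m) → (∀ t → Subset.∣ lookup v t ∣ ℕ.≤ Δ) → All (λ S → count (lookup S) ℕ.≤ Δ) (toList v)
    all [] _ = []
    all (S ∷ v) h = subst (ℕ._≤ Δ) (∣∣≡count S) (h zero) ∷ all v (h ∘ suc)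

  take-split : ∀ {A : Set} {m} (v : Vec A m) t → Σ (List A) λ zs → toList v ≡ take (toℕ t) (toList v) ++ lookup v t ∷ zs
  take-split (x ∷ v) zero = toList v , refl
  take-split (x ∷ v) (suc t) = let zs , e = take-split v t in zs , cong (x ∷_) e

  take-take-split : ∀ {A : Set} {m} (v : Vec A m) t k → toℕ t ℕ.< k →
    Σ (List A) λ zs → take k (toList v) ≡ take (toℕ t) (toList v) ++ lookup v t ∷ zs
  take-take-split (x ∷ v) zero (suc k) _ = take k (toList v) , refl
  take-take-split (x ∷ v) (suc t) (suc k) (ℕ.s≤s p) = let zs , e = take-take-split v t k p in zs , cong (x ∷_) e

  reverse-split : ∀ {A : Set} (xs : List A) y zs → reverse (xs ++ y ∷ zs) ≡ reverse zs ++ y ∷ reverse xs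
  reverse-split xs y zs = trans (ListP.reverse-++ xs (y ∷ zs)) (trans (cong (_++ reverse xs) (ListP.unfold-reverse y zs))
    (ListP.++-assoc (reverse zs) (y ∷ []) (reverse xs)))

  All-split : ∀ {A : Set} {P : A → Set} xs {x y ys zs} → x ∷ ys ≡ xs ++ y ∷ zs → xs ≢ [] → All P ys → P y
  All-split [] _ ne _ = ⊥-elim (ne refl)
  All-split (_ ∷ xs) refl _ a = All.head (AllP.++⁻ʳ xs a)

  -- The algorithm keeps no memory: at each arrival it replays the strategy on the whole history,
  -- stored with the latest node first.
  module Run {n Δ K : ℕ} (s : Strategy n Δ 0 K) where
    open Strategy s

    record Result (Ss : List (Subset n)) : Set where
      constructor result
      field
        hist : List (Round n)
        hist-inv : Inv hist
        faithful : map nbrs hist ≡ map lookup Ss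
    open Result

    step : ∀ {Ss} S → Result Ss → Dec (Valid Δ (map lookup (S ∷ Ss))) → Maybe (Result (S ∷ Ss))
    step S r (no _) = nothing
    step S (result h i f) (yes v) with extend i (lookup S) (subst (λ l → Valid Δ (lookup S ∷ l)) (≡-sym f) v)
    ... | r , e , i′ = just (result (r ∷ h) i′ (cong₂ _∷_ e f))

    run : (Ss : List (Subset n)) → Maybe (Result Ss)
    run [] = just (result [] start refl)
    run (S ∷ Ss) with run Ss
    ... | nothing = nothing
    ... | just r = step S r (valid? Δ (map lookup (S ∷ Ss)))

    lastColour : ∀ {Ss} → Maybe (Result Ss) → Fin n → ℕ
    -- A default for invalid histories; `run-valid` excludes this case for inputs of maximum degree
    -- Δ.
    lastColour nothing u = 0
    lastColour (just (result [] _ _)) u = 0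
    lastColour (just (result (r ∷ _) _ _)) u = col r u

    colourer : List (Subset n) → Subset n → Fin n → ℕ
    colourer past S = lastColour (run (S ∷ reverse past))

    run-valid : ∀ Ss → Valid Δ (map lookup Ss) → Σ (Result Ss) λ r → run Ss ≡ just r
    run-valid [] v = _ , refl
    run-valid (S ∷ Ss) v with run Ss | run-valid Ss (Valid-++⁻ʳ (lookup S ∷ []) v)
    ... | just r | _ with valid? Δ (map lookup (S ∷ Ss))
    ... | no ¬v = ⊥-elim (¬v v)
    ... | yes v′ = _ , refl

    step-hist : ∀ {Ss} S (r : Result Ss) d {r′} → step S r d ≡ just r′ → Σ (Round n) λ ρ → hist r′ ≡ ρ ∷ hist r
    step-hist S (result h i f) (yes v) refl = _ , refl

    -- Replays at different times agree: a later one extends the history built by an earlier one, so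
    -- it reproduces the colours already given.
    run-suffix : ∀ Ss {Ts} {r : Result (Ss ++ Ts)} → run (Ss ++ Ts) ≡ just r →
      Σ (List (Round n)) λ h₁ → Σ (Result Ts) λ r₂ → hist r ≡ h₁ ++ hist r₂ × run Ts ≡ just r₂
    run-suffix [] {r = r} e = [] , r , refl , e
    run-suffix (S ∷ Ss) {Ts} {r} e with run (Ss ++ Ts) in eq
    ... | just r′ =
      let h₁ , r₂ , e₁ , e₂ = run-suffix Ss eq
          ρ , e₃ = step-hist S r′ (valid? Δ (map lookup (S ∷ (Ss ++ Ts)))) e
      in ρ ∷ h₁ , r₂ , trans e₃ (cong (ρ ∷_) e₁) , e₂

    Cons : ∀ {S Ss} → Result (S ∷ Ss) → Set
    Cons {S} r = Σ (Round n) λ ρ → Σ (List (Round n)) λ h → hist r ≡ ρ ∷ h × nbrs ρ ≡ lookup S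

    cons : ∀ {S Ss} (r : Result (S ∷ Ss)) → Cons r
    cons (result (ρ ∷ h) _ f) = ρ , h , refl , ListP.∷-injectiveˡ f

    lastColour-cons : ∀ {S Ss} (r : Result (S ∷ Ss)) u → lastColour (just r) u ≡ col (proj₁ (cons r)) u
    lastColour-cons (result (ρ ∷ h) _ f) u = refl

    module _ (ins : Input n) (md : MaxDegree ins Δ) where
      private
        L = toList ins

        prefix : Fin n → List (Subset n)
        prefix t = lookup ins t ∷ reverse (take (toℕ t) L)

        prefix-valid : ∀ t → Valid Δ (map lookup (prefix t))
        prefix-valid t with take-split ins t
        ... | zs , e = Valid-++⁻ʳ (map lookup (reverse zs)) (subst (Valid Δ) eq (Valid-reverse (map lookup L) (MaxDegree⇒Valid ins md)))
          where
          eq : reverse (map lookup L) ≡ map lookup (reverse zs) ++ map lookup (prefix t)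
          eq = trans (≡-sym (ListP.reverse-map lookup L)) (trans (cong (map lookup ∘ reverse) e)
            (trans (cong (map lookup) (reverse-split (take (toℕ t) L) (lookup ins t) zs)) (ListP.map-++ lookup (reverse zs) (prefix t))))

        result-at : ∀ t → Σ (Result (prefix t)) λ r → run (prefix t) ≡ just r
        result-at t = run-valid (prefix t) (prefix-valid t)

        round-at : Fin n → Round n
        round-at t = proj₁ (cons (proj₁ (result-at t)))

        hist-at : ∀ t → hist (proj₁ (result-at t)) ≡ round-at t ∷ proj₁ (proj₂ (cons (proj₁ (result-at t))))
        hist-at t = proj₁ (proj₂ (proj₂ (cons (proj₁ (result-at t)))))

        sound-at : ∀ t → Sound 0 K (round-at t ∷ proj₁ (proj₂ (cons (proj₁ (result-at t)))))
        sound-at t = subst (Sound 0 K) (hist-at t) (sound-Inv (hist-inv (proj₁ (result-at t))))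

        none-left : ∀ {m} (S : Fin m → Bool) → count S ℕ.≤ 0 → ∀ u → S u ≡ false
        none-left S p zero with S zero
        ... | false = refl
        none-left S p (suc u) = none-left (S ∘ suc) (ℕP.≤-trans (ℕP.m≤n+m _ (if S zero then 1 else 0)) p) u

        coloured : ∀ t u → u Subset.∈ lookup ins t → Coloured (round-at t) u
        coloured t u p = trans (cong (λ f → f u) (proj₂ (proj₂ (proj₂ (cons (proj₁ (result-at t))))))) (VecP.[]=⇒lookup p) ,
          none-left (left (round-at t)) (left≤ (All.head (rounds (sound-at t)))) u

        -- The replay at `t′` contains the round of `t` as a proper predecessor, so compatibility
        -- within that one sound history applies.
        later : ∀ t t′ → toℕ t ℕ.< toℕ t′ → Compatible (round-at t′) (round-at t)
        later t t′ t<t′ = All-split (proj₁ suffix) hist-eq longer (AllPairs.head (compatible (sound-at t′)))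
          where
          zs = proj₁ (take-take-split ins t (toℕ t′) t<t′)
          e = proj₂ (take-take-split ins t (toℕ t′) t<t′)
          split : prefix t′ ≡ (lookup ins t′ ∷ reverse zs) ++ prefix t
          split = cong (lookup ins t′ ∷_) (trans (cong reverse e) (reverse-split (take (toℕ t) L) (lookup ins t) zs))
          transport : ∀ {Ss} (eq : prefix t′ ≡ Ss) → Σ (Result Ss) λ r → run Ss ≡ just r × hist r ≡ hist (proj₁ (result-at t′))
          transport refl = proj₁ (result-at t′) , proj₂ (result-at t′) , refl
          moved = transport split
          suffix = run-suffix (lookup ins t′ ∷ reverse zs) {prefix t} (proj₁ (proj₂ moved))
          same : proj₁ (proj₂ suffix) ≡ proj₁ (result-at t)
          same = just-injective (trans (≡-sym (proj₂ (proj₂ (proj₂ suffix)))) (proj₂ (result-at t)))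
          h′ = proj₁ (proj₂ (cons (proj₁ (result-at t′))))
          hist-eq : round-at t′ ∷ h′ ≡ proj₁ suffix ++ (round-at t ∷ proj₁ (proj₂ (cons (proj₁ (result-at t)))))
          hist-eq = trans (≡-sym (hist-at t′)) (trans (≡-sym (proj₂ (proj₂ moved)))
            (trans (proj₁ (proj₂ (proj₂ suffix))) (cong (proj₁ suffix ++_) (trans (cong hist same) (hist-at t)))))
          longer : proj₁ suffix ≢ []
          longer p = ℕP.<⇒≢ len (trans (cong (length ∘ hist) (≡-sym same)) (trans (cong (λ l → length (l ++ hist (proj₁ (proj₂ suffix)))) (≡-sym p))
              (trans (cong length (≡-sym (proj₁ (proj₂ (proj₂ suffix))))) (cong length (proj₂ (proj₂ moved))))))
            where
            size : ∀ {Ss} (r : Result Ss) → length (hist r) ≡ length Ss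
            size {Ss} r = trans (≡-sym (ListP.length-map nbrs (hist r))) (trans (cong length (faithful r)) (ListP.length-map lookup Ss))
            len : length (hist (proj₁ (result-at t))) ℕ.< length (hist (proj₁ (result-at t′)))
            len = subst₂ ℕ._<_ (≡-sym (size (proj₁ (result-at t)))) (≡-sym (trans (size (proj₁ (result-at t′))) (cong length split)))
              (ℕ.s≤s (subst (length (prefix t) ℕ.≤_) (≡-sym (ListP.length-++ (reverse zs) {prefix t})) (ℕP.m≤n+m (length (prefix t)) (length (reverse zs)))))

      guarantee : (c : Fin n → Fin n → ℕ) → (∀ t u → c t u ≡ colourer (history ins t) (lookup ins t) u) →
        Proper ins c × UsesAtMost ins c K
      guarantee c c≡ = (within , across) , bounded
        where
        c-round : ∀ t u → c t u ≡ col (round-at t) u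
        c-round t u = trans (c≡ t u) (trans (cong (λ m → lastColour m u) (proj₂ (result-at t))) (lastColour-cons (proj₁ (result-at t)) u))
        within : ∀ t u u′ → u ≢ u′ → u Subset.∈ lookup ins t → u′ Subset.∈ lookup ins t → c t u ≢ c t u′
        within t u u′ u≢u′ p p′ = subst₂ _≢_ (≡-sym (c-round t u)) (≡-sym (c-round t u′))
          (col≢ (All.head (rounds (sound-at t))) u u′ u≢u′ (coloured t u p) (coloured t u′ p′))
        ordered : ∀ u t t′ → toℕ t ℕ.< toℕ t′ → u Subset.∈ lookup ins t → u Subset.∈ lookup ins t′ → c t u ≢ c t′ u
        ordered u t t′ lt p p′ e = later t t′ lt u (coloured t′ u p′) (coloured t u p)
          (trans (≡-sym (c-round t′ u)) (trans (≡-sym e) (c-round t u)))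
        across : ∀ u t t′ → t ≢ t′ → u Subset.∈ lookup ins t → u Subset.∈ lookup ins t′ → c t u ≢ c t′ u
        across u t t′ t≢t′ p p′ with ℕP.<-cmp (toℕ t) (toℕ t′)
        ... | tri< lt _ _ = ordered u t t′ lt p p′
        ... | tri≈ _ e _ = ⊥-elim (t≢t′ (FinP.toℕ-injective e))
        ... | tri> _ _ gt = ordered u t′ t gt p′ p ∘ ≡-sym
        bounded : ∀ t u → u Subset.∈ lookup ins t → c t u ℕ.< K
        bounded t u p = subst (ℕ._< K) (≡-sym (c-round t u)) (col< (All.head (rounds (sound-at t))) u (coloured t u p))

  -- Choice of the parameters

  floor : ∀ M x → 0ℚ ≤ x → x < ⌜ suc M ⌝ → Σ ℕ λ T → ⌜ T ⌝ ≤ x × x < ⌜ suc T ⌝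
  floor zero x h p = 0 , h , p
  floor (suc M) x h p with ⌜ suc M ⌝ ≤? x
  ... | yes q = suc M , q , p
  ... | no q = floor M x h (≰⇒> q)

  [1+y][1-y]≤1 : ∀ y → (1ℚ + y) * (1ℚ - y) ≤ 1ℚ
  [1+y][1-y]≤1 y = ≤-of-diff (l y) (sq≥0 y)
    where
    opaque
      unfolding _+_
      l : ∀ y → 1ℚ - (1ℚ + y) * (1ℚ - y) ≡ y * y
      l = solve-∀ ring

  -- A division-free form of (1 + y)^N ≤ 1 / (1 - N y), from (1 + y) (1 - y) ≤ 1 and Bernoulli's
  -- inequality.
  power-inverse : ∀ y N → 0ℚ ≤ y → y ≤ 1ℚ → (1ℚ + y) ^ N * (1ℚ - ⌜ N ⌝ * y) ≤ 1ℚ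
  power-inverse y N y≥0 y≤1 = ≤-trans (*-monoˡ (^≥0 N (+≥0 0≤1 y≥0)) (bernoulli⁻ y N y≥0 y≤1))
    (subst (_≤ 1ℚ) (^-*-distrib (1ℚ + y) (1ℚ - y) N) (^≤1 N (*≥0 (+≥0 0≤1 y≥0) (diff≥0 y≤1)) ([1+y][1-y]≤1 y)))

  n<2^ : ∀ n → n ℕ.< 2 ℕ.^ suc ⌊log₂ n ⌋
  n<2^ n with n ℕ.<? 2 ℕ.^ suc ⌊log₂ n ⌋
  ... | yes p = p
  ... | no p = ⊥-elim (ℕP.<-irrefl refl (subst (ℕ._≤ ⌊log₂ n ⌋) (⌊log₂[2^n]⌋≡n (suc ⌊log₂ n ⌋)) (⌊log₂⌋-mono-≤ (ℕP.≮⇒≥ p))))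

  ⌜⌝-^ : ∀ a m → ⌜ a ℕ.^ m ⌝ ≡ ⌜ a ⌝ ^ m
  ⌜⌝-^ a zero = +-identityʳ 1ℚ
  ⌜⌝-^ a (suc m) = trans (⌜⌝-* a (a ℕ.^ m)) (cong (⌜ a ⌝ *_) (⌜⌝-^ a m))

  1≤⌜⌝ : ∀ {n} → 1 ℕ.≤ n → 1ℚ ≤ ⌜ n ⌝
  1≤⌜⌝ p = ≤-trans (≤-reflexive (≡-sym (+-identityʳ 1ℚ))) (⌜⌝-mono p)

  opaque
    -- The fifth power arises because the growth per unit of k is about 16 Z⁴ / h, which has to be a
    -- small fraction of 1 / Z.
    scale : ℕ → ℕ
    scale Z = 128 ℕ.* (Z ℕ.* (Z ℕ.* (Z ℕ.* (Z ℕ.* Z))))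

    ⌜scale⌝ : ∀ Z → ⌜ scale Z ⌝ ≡ ⌜ 128 ⌝ * (⌜ Z ⌝ * (⌜ Z ⌝ * (⌜ Z ⌝ * (⌜ Z ⌝ * ⌜ Z ⌝))))
    ⌜scale⌝ Z = trans (⌜⌝-* 128 (Z ℕ.* Z⁴)) (cong (⌜ 128 ⌝ *_) (trans (⌜⌝-* Z Z⁴) (cong (⌜ Z ⌝ *_) (trans (⌜⌝-* Z Z³) (cong (⌜ Z ⌝ *_)
      (trans (⌜⌝-* Z (Z ℕ.* Z)) (cong (⌜ Z ⌝ *_) (⌜⌝-* Z Z))))))))
      where
      Z³ Z⁴ : ℕ
      Z³ = Z ℕ.* (Z ℕ.* Z)
      Z⁴ = Z ℕ.* Z³

    -- This is h times a sufficient exponent k for `budget`: every 4 Z units of k double the gain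
    -- `W ^ k`, and 2 L + 5 doublings exceed (n + 1)² when L is the logarithm of n.
    threshold : ℕ → ℕ → ℕ
    threshold Z L = scale Z ℕ.* (4 ℕ.* Z ℕ.* (2 ℕ.* L ℕ.+ 5))

    threshold-def : ∀ Z L → threshold Z L ≡ scale Z ℕ.* (4 ℕ.* Z ℕ.* (2 ℕ.* L ℕ.+ 5))
    threshold-def Z L = refl

  -- All error terms are multiples of e = 1 / Z; s₀ = (1 − 1/Z) ^ Z is the lower approximation of 1/e, and the phase with
  -- degree bound D uses the exponent k = ⌊D / h⌋.
  module Parameters (R′ : ℕ) (12≤Z : 12 ℕ.≤ suc R′) where
    Z = suc R′
    z = ⌜ Z ⌝
    e = inv z
    s₀ = (1ℚ - e) ^ Z
    ρ = s₀ + 2ℚ * e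
    σ = s₀ + ⌜ 3 ⌝ * e
    h = scale Z

    z>0 : 0ℚ < z
    z>0 = +>0 0<1 (⌜⌝≥0 R′)
    e>0 : 0ℚ < e
    e>0 = inv>0 z>0
    e≥0 : 0ℚ ≤ e
    e≥0 = <⇒≤ e>0
    ze : z * e ≡ 1ℚ
    ze = inv-*ʳ z>0
    e≤1/12 : ⌜ 12 ⌝ * e ≤ 1ℚ
    e≤1/12 = subst (⌜ 12 ⌝ * e ≤_) ze (*-monoʳ e≥0 (⌜⌝-mono 12≤Z))
    e≤1 : e ≤ 1ℚ
    e≤1 = ≤-trans (≤-of-diff (l e) (*≥0 (⌜⌝≥0 11) e≥0)) e≤1/12
      where
      opaque
        unfolding _+_
        l : ∀ e → ⌜ 12 ⌝ * e - e ≡ ⌜ 11 ⌝ * e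
        l = solve-∀ ring
    1≤z : 1ℚ ≤ z
    1≤z = 1≤⌜⌝ {Z} (ℕ.s≤s ℕ.z≤n)

    s₀≥0 : 0ℚ ≤ s₀
    s₀≥0 = ^≥0 Z (diff≥0 e≤1)

    -- By Bernoulli's inequality (1 + e)^Z ≥ 2, while (1 + e)^Z (1 - e)^Z ≤ 1.
    2s₀≤1 : 2ℚ * s₀ ≤ 1ℚ
    2s₀≤1 = ≤-trans (*-monoʳ s₀≥0 (subst (_≤ (1ℚ + e) ^ Z) (cong (1ℚ +_) ze) (bernoulli e Z e≥0)))
      (subst (_≤ 1ℚ) (^-*-distrib (1ℚ + e) (1ℚ - e) Z) (^≤1 Z (*≥0 (+≥0 0≤1 e≥0) (diff≥0 e≤1)) ([1+y][1-y]≤1 e)))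

    ρ≥0 : 0ℚ ≤ ρ
    ρ≥0 = +≥0 s₀≥0 (*≥0 0≤2 e≥0)
    σ≥0 : 0ℚ ≤ σ
    σ≥0 = +≥0 s₀≥0 (*≥0 (⌜⌝≥0 3) e≥0)

    -- From s₀ ≤ 1/2 and 3 e ≤ 1/4, the latter by `12≤Z`.
    4σ≤3 : ⌜ 4 ⌝ * σ ≤ ⌜ 3 ⌝
    4σ≤3 = ≤-of-diff (l s₀ e) (+≥0 (*≥0 0≤2 (diff≥0 2s₀≤1)) (diff≥0 e≤1/12))
      where
      opaque
        unfolding _+_
        l : ∀ s e → ⌜ 3 ⌝ - ⌜ 4 ⌝ * (s + ⌜ 3 ⌝ * e) ≡ 2ℚ * (1ℚ - 2ℚ * s) + (1ℚ - ⌜ 12 ⌝ * e)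
        l = solve-∀ ring
    σ<1 : σ < 1ℚ
    σ<1 = ≰⇒> λ p → <⇒≱′ (⌜⌝-mono-< {3} {4} ℕP.≤-refl) (≤-trans (≤-reflexive (≡-sym (*-identityʳ ⌜ 4 ⌝))) (≤-trans (*-monoˡ (⌜⌝≥0 4) p) 4σ≤3))
    ρ≤σ : ρ ≤ σ
    ρ≤σ = ≤-of-diff (l s₀ e) e≥0
      where
      opaque
        unfolding _+_
        l : ∀ s e → s + ⌜ 3 ⌝ * e - (s + 2ℚ * e) ≡ e
        l = solve-∀ ring
    ρ≤1 : ρ ≤ 1ℚ
    ρ≤1 = ≤-trans ρ≤σ (<⇒≤ σ<1)

    h>0 : 0ℚ < ⌜ h ⌝
    h>0 = subst (0ℚ <_) (≡-sym (⌜scale⌝ Z)) (*>0 (⌜⌝-mono-< {0} {128} (ℕ.s≤s ℕ.z≤n)) (*>0 z>0 (*>0 z>0 (*>0 z>0 (*>0 z>0 z>0)))))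
    ih = inv ⌜ h ⌝
    1≤h : 1 ℕ.≤ h
    1≤h = ⌜⌝-cancel-< {0} h>0

    -- The gain per unit of k. The threshold 2 + e for 1 + overlap, against the initial value 2,
    -- offers a factor 1 + e / 2; half of the excess is kept here and the other half pays for the
    -- growth.
    W : ℚ
    W = 1ℚ + e * inv ⌜ 4 ⌝

    4>0 : 0ℚ < ⌜ 4 ⌝
    4>0 = ⌜⌝-mono-< {0} {4} (ℕ.s≤s ℕ.z≤n)

    W≥1 : 1ℚ ≤ W
    W≥1 = x≤x+y (*≥0 e≥0 (inv≥0 4>0))

    W-double : 2ℚ ≤ W ^ (4 ℕ.* Z)
    W-double = ≤-trans (≤-reflexive (cong (1ℚ +_) (≡-sym eq))) (bernoulli (e * inv ⌜ 4 ⌝) (4 ℕ.* Z) (*≥0 e≥0 (inv≥0 4>0)))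
      where
      opaque
        unfolding _+_
        l : ∀ f z e i → f * z * (e * i) ≡ f * i * (z * e)
        l = solve-∀ ring
      eq : ⌜ 4 ℕ.* Z ⌝ * (e * inv ⌜ 4 ⌝) ≡ 1ℚ
      eq = trans (cong (_* (e * inv ⌜ 4 ⌝)) (⌜⌝-* 4 Z)) (trans (l ⌜ 4 ⌝ z e (inv ⌜ 4 ⌝)) (trans (cong₂ _*_ (inv-*ʳ 4>0) ze) (*-identityˡ 1ℚ)))

    module _ (D k : ℕ) (1≤k : 1 ℕ.≤ k) (kh≤D : k ℕ.* h ℕ.≤ D) (D≤ : D ℕ.+ D ℕ.≤ k ℕ.* (4 ℕ.* h)) where
      d = ⌜ D ⌝
      iD = inv d
      -- The step size q / g² for q ≤ 2 D and g ≥ D / Z.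
      b = 2ℚ * (z * z) * iD
      Gr = growth k b
      -- Exactly the initial weight of a pair, whose overlap ratio is 1; `pair-init` then holds by
      -- reflexivity.
      τ = (1ℚ + 1ℚ) ^ k * (inv (2ℚ + e) ^ k * Gr ^ (D ℕ.+ D))

      D>0 : 0ℚ < d
      D>0 = ⌜⌝-mono-< {0} (ℕP.≤-trans (ℕP.*-mono-≤ 1≤k 1≤h) kh≤D)

      private
        v = 2ℚ * (z * z) * ih

        v≥0 : 0ℚ ≤ v
        v≥0 = *≥0 (*≥0 0≤2 (*≥0 (<⇒≤ z>0) (<⇒≤ z>0))) (inv≥0 h>0)

        k≤ : ⌜ k ⌝ * iD ≤ ih
        k≤ = inv-≤ D>0 (≤-trans (≤-inv h>0 (subst (_≤ d) (⌜⌝-* k h) (⌜⌝-mono kh≤D))) (≤-reflexive (*-comm d ih)))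

        kb≤v : ⌜ k ⌝ * b ≤ v
        kb≤v = subst (_≤ v) (l ⌜ k ⌝ iD z) (*-monoˡ (*≥0 0≤2 (*≥0 (<⇒≤ z>0) (<⇒≤ z>0))) k≤)
          where
          opaque
            unfolding _+_
            l : ∀ k i z → 2ℚ * (z * z) * (k * i) ≡ k * (2ℚ * (z * z) * i)
            l = solve-∀ ring

        -- the constant 128 in the definition of h makes this an eighth of e
        t = ⌜ 16 ⌝ * (z * (z * (z * z))) * ih
        8t≡e : ⌜ 8 ⌝ * t ≡ e
        8t≡e = trans (≡-sym (trans (cong (_* (⌜ 8 ⌝ * t)) ze) (*-identityˡ _))) (trans (l z e ih) (trans (cong (λ x → e * (x * ih)) (≡-sym (⌜scale⌝ Z)))
            (trans (cong (e *_) (inv-*ʳ h>0)) (*-identityʳ e))))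
          where
          opaque
            unfolding _+_
            l : ∀ z e i → z * e * (⌜ 8 ⌝ * (⌜ 16 ⌝ * (z * (z * (z * z))) * i)) ≡ e * (⌜ 128 ⌝ * (z * (z * (z * (z * z)))) * i)
            l = solve-∀ ring

        4hv² : ⌜ 4 ℕ.* h ⌝ * (v * v) ≡ t
        4hv² = trans (cong (_* (v * v)) (⌜⌝-* 4 h)) (trans (l ⌜ h ⌝ ih z) (trans (cong (_* t) (inv-*ʳ h>0)) (*-identityˡ t)))
          where
          opaque
            unfolding _+_
            l : ∀ h i z → ⌜ 4 ⌝ * h * (2ℚ * (z * z) * i * (2ℚ * (z * z) * i)) ≡ h * i * (⌜ 16 ⌝ * (z * (z * (z * z))) * i)
            l = solve-∀ ring

        t≤1 : t ≤ 1ℚ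
        t≤1 = ≤-trans (≤-of-diff (l t) (*≥0 (⌜⌝≥0 7) t≥0)) (≤-trans (≤-reflexive 8t≡e) e≤1)
          where
          opaque
            unfolding _+_
            l : ∀ t → ⌜ 8 ⌝ * t - t ≡ ⌜ 7 ⌝ * t
            l = solve-∀ ring
          t≥0 : 0ℚ ≤ t
          t≥0 = *≥0 (*≥0 (⌜⌝≥0 16) (*≥0 (<⇒≤ z>0) (*≥0 (<⇒≤ z>0) (*≥0 (<⇒≤ z>0) (<⇒≤ z>0))))) (inv≥0 h>0)

      v≤1 : v ≤ 1ℚ
      v≤1 = ≤-trans (≤-trans (≤-of-diff (l (z * z) ih) (*≥0 (*≥0 (<⇒≤ zz>0) (+≥0 (*≥0 (⌜⌝≥0 16) (diff≥0 zz≥1)) (⌜⌝≥0 14))) (inv≥0 h>0)))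
          (≤-reflexive (l₁ z ih))) t≤1
        where
        zz>0 = *>0 z>0 z>0
        zz≥1 : 1ℚ ≤ z * z
        zz≥1 = subst (_≤ z * z) (*-identityˡ 1ℚ) (*-mono (<⇒≤ z>0) 0≤1 1≤z 1≤z)
        opaque
          unfolding _+_
          l : ∀ w i → ⌜ 16 ⌝ * (w * w) * i - 2ℚ * w * i ≡ w * (⌜ 16 ⌝ * (w - 1ℚ) + ⌜ 14 ⌝) * i
          l = solve-∀ ring
          l₁ : ∀ z i → ⌜ 16 ⌝ * (z * z * (z * z)) * i ≡ ⌜ 16 ⌝ * (z * (z * (z * z))) * i
          l₁ = solve-∀ ring

      kb≤1 : ⌜ k ⌝ * b ≤ 1ℚ
      kb≤1 = ≤-trans kb≤v v≤1

      b≥0 : 0ℚ ≤ b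
      b≥0 = *≥0 (*≥0 0≤2 (*≥0 (<⇒≤ z>0) (<⇒≤ z>0))) (inv≥0 D>0)

      Gr≥1 : 1ℚ ≤ Gr
      Gr≥1 = 1≤growth k b

      private
        p = (1ℚ + v * v) ^ (4 ℕ.* h)
        p≥0 : 0ℚ ≤ p
        p≥0 = ^≥0 (4 ℕ.* h) (+≥0 0≤1 (sq≥0 v))

        p≤ : p * (⌜ 8 ⌝ - e) ≤ ⌜ 8 ⌝
        p≤ = subst₂ _≤_ (trans (l p t) (cong (λ x → p * (⌜ 8 ⌝ - x)) 8t≡e)) (*-identityʳ ⌜ 8 ⌝)
          (*-monoˡ (⌜⌝≥0 8) (subst (λ x → p * (1ℚ - x) ≤ 1ℚ) 4hv² (power-inverse (v * v) (4 ℕ.* h) (sq≥0 v)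
            (subst (v * v ≤_) (*-identityˡ 1ℚ) (*-mono 0≤1 v≥0 v≤1 v≤1)))))
          where
          opaque
            unfolding _+_
            l : ∀ p t → ⌜ 8 ⌝ * (p * (1ℚ - t)) ≡ p * (⌜ 8 ⌝ - ⌜ 8 ⌝ * t)
            l = solve-∀ ring

        Gr≤ : Gr ≤ 1ℚ + v * v
        Gr≤ = +-mono-≤ ≤-refl (≤-trans (≤-reflexive (l ⌜ k ⌝ b)) (*-mono v≥0 (*≥0 (⌜⌝≥0 k) b≥0) kb≤v kb≤v))
          where
          opaque
            unfolding _+_
            l : ∀ k b → k * k * (b * b) ≡ k * b * (k * b)
            l = solve-∀ ring

        Gr^≤ : Gr ^ (D ℕ.+ D) ≤ p ^ k
        Gr^≤ = ≤-trans (^-mono (D ℕ.+ D) (≤-trans 0≤1 Gr≥1) Gr≤) (≤-trans (^-monoʳ (x≤x+y (sq≥0 v)) D≤)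
          (≤-reflexive (^-* (1ℚ + v * v) k (4 ℕ.* h))))

        2+e>0 : 0ℚ < 2ℚ + e
        2+e>0 = +>0 (+>0 0<1 0≤1) e≥0

        -- The estimate per unit of k. With p ≤ 8 / (8 - e) it amounts to 16 (4 + e) ≤ 4 (8 - e) (2
        -- + e), whose two sides differ by 8 e - 4 e².
        base : (1ℚ + 1ℚ) * (inv (2ℚ + e) * p) * W ≤ 1ℚ
        base = begin
          (1ℚ + 1ℚ) * (i * p) * (1ℚ + e * j)  ≡⟨ cong (λ x → (1ℚ + 1ℚ) * (i * p) * (x + e * j)) (inv-*ʳ 4>0) ⟨
          (1ℚ + 1ℚ) * (i * p) * (⌜ 4 ⌝ * j + e * j)  ≡⟨ l₁ i j p e ⟩
          p * (2ℚ * (⌜ 4 ⌝ + e)) * (i * j)  ≤⟨ *-monoʳ (*≥0 (inv≥0 2+e>0) (inv≥0 4>0)) claim ⟩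
          ⌜ 4 ⌝ * (2ℚ + e) * (i * j)  ≡⟨ l₂ ⌜ 4 ⌝ (2ℚ + e) i j ⟩
          ⌜ 4 ⌝ * j * ((2ℚ + e) * i)  ≡⟨ cong₂ _*_ (inv-*ʳ 4>0) (inv-*ʳ 2+e>0) ⟩
          1ℚ * 1ℚ  ≡⟨ *-identityˡ 1ℚ ⟩
          1ℚ                                           ∎
          where
          open ≤-Reasoning
          i = inv (2ℚ + e)
          j = inv ⌜ 4 ⌝
          opaque
            unfolding _+_
            l₁ : ∀ i j p e → (1ℚ + 1ℚ) * (i * p) * (⌜ 4 ⌝ * j + e * j) ≡ p * (2ℚ * (⌜ 4 ⌝ + e)) * (i * j)
            l₁ = solve-∀ ring
            l₂ : ∀ f g i j → f * g * (i * j) ≡ f * j * (g * i)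
            l₂ = solve-∀ ring
            l₃ : ∀ p e → (⌜ 8 ⌝ - e) * (p * (2ℚ * (⌜ 4 ⌝ + e))) ≡ p * (⌜ 8 ⌝ - e) * (2ℚ * (⌜ 4 ⌝ + e))
            l₃ = solve-∀ ring
            l₄ : ∀ e → (⌜ 8 ⌝ - e) * (⌜ 4 ⌝ * (2ℚ + e)) - ⌜ 8 ⌝ * (2ℚ * (⌜ 4 ⌝ + e)) ≡ ⌜ 4 ⌝ * e * (1ℚ - e) + ⌜ 4 ⌝ * e
            l₄ = solve-∀ ring
          8-e>0 : 0ℚ < ⌜ 8 ⌝ - e
          8-e>0 = diff>0 (≤-<-trans e≤1 (subst (_< ⌜ 8 ⌝) (+-identityʳ 1ℚ) (⌜⌝-mono-< {1} {8} (ℕ.s≤s (ℕ.s≤s ℕ.z≤n)))))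
          claim : p * (2ℚ * (⌜ 4 ⌝ + e)) ≤ ⌜ 4 ⌝ * (2ℚ + e)
          claim = *-cancelˡ 8-e>0 (≤-trans (≤-reflexive (l₃ p e)) (≤-trans (*-monoʳ (*≥0 0≤2 (+≥0 (⌜⌝≥0 4) e≥0)) p≤)
            (≤-of-diff (l₄ e) (+≥0 (*≥0 (*≥0 (⌜⌝≥0 4) e≥0) (diff≥0 e≤1)) (*≥0 (⌜⌝≥0 4) e≥0)))))

      τ>0 : 0ℚ < τ
      τ>0 = *>0 (^>0 k (+>0 0<1 0≤1)) (*>0 (^>0 k (inv>0 2+e>0)) (^>0 (D ℕ.+ D) (<-≤-trans 0<1 Gr≥1)))

      τ-small : τ * W ^ k ≤ 1ℚ
      τ-small = begin
        (1ℚ + 1ℚ) ^ k * (i ^ k * Gr ^ (D ℕ.+ D)) * W ^ k  ≤⟨ *-monoʳ W^≥0 (*-monoˡ (^≥0 k 0≤2) (*-monoˡ (^≥0 k (inv≥0 2+e>0)) Gr^≤)) ⟩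
        (1ℚ + 1ℚ) ^ k * (i ^ k * p ^ k) * W ^ k  ≡⟨ cong (λ x → (1ℚ + 1ℚ) ^ k * x * W ^ k) (^-*-distrib i p k) ⟨
        (1ℚ + 1ℚ) ^ k * (i * p) ^ k * W ^ k  ≡⟨ cong (_* W ^ k) (^-*-distrib (1ℚ + 1ℚ) (i * p) k) ⟨
        ((1ℚ + 1ℚ) * (i * p)) ^ k * W ^ k  ≡⟨ ^-*-distrib ((1ℚ + 1ℚ) * (i * p)) W k ⟨
        ((1ℚ + 1ℚ) * (i * p) * W) ^ k  ≤⟨ ^≤1 k (*≥0 (*≥0 0≤2 (*≥0 (inv≥0 2+e>0) p≥0)) (≤-trans 0≤1 W≥1)) base ⟩
        1ℚ                                                 ∎
        where
        open ≤-Reasoning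
        i = inv (2ℚ + e)
        W^≥0 : 0ℚ ≤ W ^ k
        W^≥0 = ^≥0 k (≤-trans 0≤1 W≥1)

      -- The n² + 2 n charges are one less than (n + 1)², which gives the strict inequality.
      -- Moreover (n + 1)² ≤ 2^(2 L + 2) is at most `W ^ k`, and τ · `W ^ k` is at most 1.
      budget : ∀ n → 4 ℕ.* Z ℕ.* (2 ℕ.* ⌊log₂ n ⌋ ℕ.+ 5) ℕ.≤ k → ⌜ n ⌝ * (⌜ n ⌝ * τ) + ⌜ n ⌝ * τ + ⌜ n ⌝ * τ < 1ℚ
      budget n M≤k = <-≤-trans (<-of-diff (l ⌜ n ⌝ τ) τ>0) (≤-trans (*-monoʳ (<⇒≤ τ>0) count≤) (≤-trans (≤-reflexive (*-comm _ τ)) τ-small))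
        where
        L = ⌊log₂ n ⌋
        m = 2 ℕ.* L ℕ.+ 5
        opaque
          unfolding _+_
          l : ∀ n t → (1ℚ + (n * n + n + n)) * t - (n * (n * t) + n * t + n * t) ≡ t
          l = solve-∀ ring
        N = 2 ℕ.^ suc L
        n<N : n ℕ.< N
        n<N = n<2^ n
        square : suc (n ℕ.* n ℕ.+ n ℕ.+ n) ℕ.≤ N ℕ.* N
        square = subst (ℕ._≤ N ℕ.* N) (lem n) (ℕP.*-mono-≤ n<N n<N)
          where
          lem : ∀ n → suc n ℕ.* suc n ≡ suc (n ℕ.* n ℕ.+ n ℕ.+ n)
          lem = NatSolver.solve-∀
        exponent : suc L ℕ.+ suc L ℕ.≤ m
        exponent = subst (ℕ._≤ m) (lem L) (ℕP.+-monoʳ-≤ (2 ℕ.* L) (ℕ.s≤s (ℕ.s≤s ℕ.z≤n)))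
          where
          lem : ∀ L → 2 ℕ.* L ℕ.+ 2 ≡ suc L ℕ.+ suc L
          lem = NatSolver.solve-∀
        count≤ : 1ℚ + (⌜ n ⌝ * ⌜ n ⌝ + ⌜ n ⌝ + ⌜ n ⌝) ≤ W ^ k
        count≤ = begin
          1ℚ + (⌜ n ⌝ * ⌜ n ⌝ + ⌜ n ⌝ + ⌜ n ⌝)  ≡⟨ cong (λ x → 1ℚ + (x + ⌜ n ⌝ + ⌜ n ⌝)) (⌜⌝-* n n) ⟨
          1ℚ + (⌜ n ℕ.* n ⌝ + ⌜ n ⌝ + ⌜ n ⌝)  ≡⟨ cong (λ x → 1ℚ + (x + ⌜ n ⌝)) (⌜⌝-+ (n ℕ.* n) n) ⟨
          1ℚ + (⌜ n ℕ.* n ℕ.+ n ⌝ + ⌜ n ⌝)  ≡⟨ cong (1ℚ +_) (⌜⌝-+ (n ℕ.* n ℕ.+ n) n) ⟨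
          ⌜ suc (n ℕ.* n ℕ.+ n ℕ.+ n) ⌝  ≤⟨ ⌜⌝-mono square ⟩
          ⌜ N ℕ.* N ⌝  ≡⟨ cong ⌜_⌝ (ℕP.^-distribˡ-+-* 2 (suc L) (suc L)) ⟨
          ⌜ 2 ℕ.^ (suc L ℕ.+ suc L) ⌝  ≤⟨ ⌜⌝-mono (ℕP.^-monoʳ-≤ 2 exponent) ⟩
          ⌜ 2 ℕ.^ m ⌝  ≡⟨ ⌜⌝-^ 2 m ⟩
          ⌜ 2 ⌝ ^ m  ≤⟨ ^-mono m (⌜⌝≥0 2) (≤-trans (≤-reflexive (cong (1ℚ +_) (+-identityʳ 1ℚ))) W-double) ⟩
          (W ^ (4 ℕ.* Z)) ^ m  ≡⟨ ^-* W m (4 ℕ.* Z) ⟨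
          W ^ (m ℕ.* (4 ℕ.* Z))  ≤⟨ ^-monoʳ W≥1 (subst (ℕ._≤ k) (ℕP.*-comm (4 ℕ.* Z) m) M≤k) ⟩
          W ^ k                                  ∎
          where open ≤-Reasoning

  module Instance (R′ : ℕ) (12≤Z : 12 ℕ.≤ suc R′) where
    open Parameters R′ 12≤Z

    private
      z≥0 = <⇒≤ z>0

      z³≤h : z * (z * z) ≤ ⌜ h ⌝
      z³≤h = ≤-trans (≤-of-diff (l z) (*≥0 (*≥0 z≥0 (*≥0 z≥0 z≥0)) (+≥0 (*≥0 (⌜⌝≥0 128) (diff≥0 z²≥1)) (⌜⌝≥0 127))))
        (≤-reflexive (≡-sym (⌜scale⌝ Z)))
        where
        opaque
          unfolding _+_
          l : ∀ z → ⌜ 128 ⌝ * (z * (z * (z * (z * z)))) - z * (z * z) ≡ z * (z * z) * (⌜ 128 ⌝ * (z * z - 1ℚ) + ⌜ 127 ⌝)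
          l = solve-∀ ring
        z²≥1 : 1ℚ ≤ z * z
        z²≥1 = subst (_≤ z * z) (*-identityˡ 1ℚ) (*-mono z≥0 0≤1 1≤z 1≤z)

      z≤z³ : z ≤ z * (z * z)
      z≤z³ = ≤-trans (≤-reflexive (≡-sym (*-identityʳ z))) (*-monoˡ z≥0 (subst (_≤ z * z) (*-identityˡ 1ℚ) (*-mono z≥0 0≤1 1≤z 1≤z)))

    module _ (n D : ℕ) (large : threshold Z ⌊log₂ n ⌋ ℕ.≤ D) where
      private
        L M : ℕ
        L = ⌊log₂ n ⌋
        M = 4 ℕ.* Z ℕ.* (2 ℕ.* L ℕ.+ 5)
        dℚ : ℚ
        dℚ = ⌜ D ⌝
        large′ : h ℕ.* M ℕ.≤ D
        large′ = subst (ℕ._≤ D) (threshold-def Z L) large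
        1≤M : 1 ℕ.≤ M
        1≤M = ℕP.*-mono-≤ {1} {4 ℕ.* Z} {1} (ℕP.*-mono-≤ {1} {4} {1} (ℕ.s≤s ℕ.z≤n) (ℕ.s≤s ℕ.z≤n)) (ℕP.≤-trans (ℕ.s≤s ℕ.z≤n) (ℕP.m≤n+m 5 (2 ℕ.* L)))
        h≤d : ⌜ h ⌝ ≤ dℚ
        h≤d = ⌜⌝-mono (ℕP.≤-trans (subst (ℕ._≤ h ℕ.* M) (ℕP.*-identityʳ h) (ℕP.*-monoʳ-≤ h 1≤M)) large′)
        d>0 : 0ℚ < dℚ
        d>0 = <-≤-trans h>0 h≤d
        d≥0 = <⇒≤ d>0

        ≤d⇒< : ∀ {x} → x ≤ dℚ → x < ⌜ suc D ⌝
        ≤d⇒< p = ≤-<-trans p (x<1+x dℚ)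

        1≤h′ : 1ℚ ≤ ⌜ h ⌝
        1≤h′ = 1≤⌜⌝ 1≤h

        k-floor : Σ ℕ λ k → ⌜ k ⌝ ≤ dℚ * ih × dℚ * ih < ⌜ suc k ⌝
        k-floor = floor D (dℚ * ih) (*≥0 d≥0 (inv≥0 h>0))
          (≤d⇒< (inv-≤ h>0 (subst (_≤ dℚ * ⌜ h ⌝) (*-identityʳ dℚ) (*-monoˡ d≥0 1≤h′))))
        k : ℕ
        k = proj₁ k-floor
        M≤k : M ℕ.≤ k
        M≤k = ℕ.s≤s⁻¹ (⌜⌝-cancel-< (≤-<-trans (≤-inv h>0 (≤-trans (≤-reflexive (trans (*-comm ⌜ M ⌝ ⌜ h ⌝) (≡-sym (⌜⌝-* h M)))) (⌜⌝-mono large′)))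
          (proj₂ (proj₂ k-floor))))
        1≤k : 1 ℕ.≤ k
        1≤k = ℕP.≤-trans 1≤M M≤k
        dih : dℚ * ih * ⌜ h ⌝ ≡ dℚ
        dih = trans (*-assoc dℚ ih ⌜ h ⌝) (trans (cong (dℚ *_) (inv-*ˡ h>0)) (*-identityʳ dℚ))
        kh≤D : k ℕ.* h ℕ.≤ D
        kh≤D = ⌜⌝-cancel (≤-trans (≤-reflexive (⌜⌝-* k h)) (subst (⌜ k ⌝ * ⌜ h ⌝ ≤_) dih (*-monoʳ (<⇒≤ h>0) (proj₁ (proj₂ k-floor)))))
        D≤ : D ℕ.+ D ℕ.≤ k ℕ.* (4 ℕ.* h)
        D≤ = ⌜⌝-cancel (begin
          ⌜ D ℕ.+ D ⌝  ≡⟨ ⌜⌝-+ D D ⟩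
          dℚ + dℚ  ≤⟨ +-mono-≤ d≤ d≤ ⟩
          (1ℚ + ⌜ k ⌝) * ⌜ h ⌝ + (1ℚ + ⌜ k ⌝) * ⌜ h ⌝  ≤⟨ ≤-of-diff (l ⌜ k ⌝ ⌜ h ⌝) (*≥0 (*≥0 0≤2 (<⇒≤ h>0)) (diff≥0 (1≤⌜⌝ 1≤k))) ⟩
          ⌜ k ⌝ * (⌜ 4 ⌝ * ⌜ h ⌝)  ≡⟨ cong (⌜ k ⌝ *_) (⌜⌝-* 4 h) ⟨
          ⌜ k ⌝ * ⌜ 4 ℕ.* h ⌝  ≡⟨ ⌜⌝-* k (4 ℕ.* h) ⟨
          ⌜ k ℕ.* (4 ℕ.* h) ⌝                            ∎)
          where
          open ≤-Reasoning
          opaque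
            unfolding _+_
            l : ∀ k h → k * (⌜ 4 ⌝ * h) - ((1ℚ + k) * h + (1ℚ + k) * h) ≡ 2ℚ * h * (k - 1ℚ)
            l = solve-∀ ring
          d≤ : dℚ ≤ (1ℚ + ⌜ k ⌝) * ⌜ h ⌝
          d≤ = subst (_≤ (1ℚ + ⌜ k ⌝) * ⌜ h ⌝) dih (*-monoʳ (<⇒≤ h>0) (<⇒≤ (proj₂ (proj₂ k-floor))))

        ed≤d : dℚ * e ≤ dℚ
        ed≤d = subst (dℚ * e ≤_) (*-identityʳ dℚ) (*-monoˡ d≥0 e≤1)
        g-floor : Σ ℕ λ g → ⌜ g ⌝ ≤ dℚ * e × dℚ * e < ⌜ suc g ⌝
        g-floor = floor D (dℚ * e) (*≥0 d≥0 e≥0) (≤d⇒< ed≤d)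
        g : ℕ
        -- Rounding D / Z down and adding 1 guarantees both g ≥ 1 and D ≤ g Z.
        g = suc (proj₁ g-floor)
        G = ⌜ g ⌝
        d≤Gz : dℚ ≤ G * z
        d≤Gz = subst (_≤ G * z) (trans (*-assoc dℚ e z) (trans (cong (dℚ *_) (inv-*ˡ z>0)) (*-identityʳ dℚ)))
          (*-monoʳ z≥0 (<⇒≤ (proj₂ (proj₂ g-floor))))
        z³≤d : z * (z * z) ≤ dℚ
        z³≤d = ≤-trans z³≤h h≤d
        1≤de : 1ℚ ≤ dℚ * e
        1≤de = ≤-inv z>0 (≤-trans (≤-reflexive (*-identityˡ z)) (≤-trans z≤z³ z³≤d))
        G≤ : G ≤ 2ℚ * dℚ * e
        G≤ = ≤-trans (+-mono-≤ 1≤de (proj₁ (proj₂ g-floor))) (≤-reflexive (l dℚ e))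
          where
          opaque
            unfolding _+_
            l : ∀ d e → d * e + d * e ≡ 2ℚ * d * e
            l = solve-∀ ring
        G≤d : G ≤ dℚ
        G≤d = ≤-trans G≤ (≤-of-diff (l dℚ e) (*≥0 d≥0 (+≥0 (diff≥0 e≤1/12) (*≥0 (⌜⌝≥0 10) e≥0))))
          where
          opaque
            unfolding _+_
            l : ∀ d e → d - 2ℚ * d * e ≡ d * (1ℚ - ⌜ 12 ⌝ * e + ⌜ 10 ⌝ * e)
            l = solve-∀ ring
        1≤G : 1ℚ ≤ G
        1≤G = 1≤⌜⌝ {g} (ℕ.s≤s ℕ.z≤n)
        G>0 = <-≤-trans 0<1 1≤G

        σd = σ * dℚ
        T-floor : Σ ℕ λ T → ⌜ T ⌝ ≤ σ * dℚ × σ * dℚ < ⌜ suc T ⌝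
        T-floor = floor D σd (*≥0 σ≥0 d≥0) (≤d⇒< (subst (σd ≤_) (*-identityˡ dℚ) (*-monoʳ d≥0 (<⇒≤ σ<1))))
        T : ℕ
        T = proj₁ T-floor

        bℚ iDℚ τℚ Grℚ : ℚ
        bℚ = b D k 1≤k kh≤D D≤
        iDℚ = inv dℚ
        iD≥0 = inv≥0 d>0
        τℚ = τ D k 1≤k kh≤D D≤
        Grℚ = Gr D k 1≤k kh≤D D≤
        Gr≥1ℚ = Gr≥1 D k 1≤k kh≤D D≤

        open Potential D g R′ k ρ σ e bℚ using (Conditions)
        open Phase n D T g R′ k ρ σ e bℚ τℚ using (PhaseConditions; phase)

        q≤b : ⌜ D ℕ.+ g ⌝ ≤ bℚ * (G * G)
        q≤b = begin
          ⌜ D ℕ.+ g ⌝  ≡⟨ ⌜⌝-+ D g ⟩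
          dℚ + G  ≤⟨ +-mono-≤ ≤-refl G≤d ⟩
          dℚ + dℚ  ≡⟨ l₁ dℚ ⟩
          2ℚ * (dℚ * 1ℚ)  ≡⟨ cong (λ x → 2ℚ * (dℚ * x)) (inv-*ʳ d>0) ⟨
          2ℚ * (dℚ * (dℚ * iDℚ))  ≡⟨ l₂ dℚ iDℚ ⟩
          2ℚ * iDℚ * (dℚ * dℚ)  ≤⟨ *-monoˡ (*≥0 0≤2 iD≥0) (*-mono (≤-trans d≥0 d≤Gz) d≥0 d≤Gz d≤Gz) ⟩
          2ℚ * iDℚ * (G * z * (G * z))  ≡⟨ l₃ iDℚ G z ⟩
          bℚ * (G * G)                    ∎
          where
          open ≤-Reasoning
          opaque
            unfolding _+_
            l₁ : ∀ d → d + d ≡ 2ℚ * (d * 1ℚ)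
            l₁ = solve-∀ ring
            l₂ : ∀ d i → 2ℚ * (d * (d * i)) ≡ 2ℚ * i * (d * d)
            l₂ = solve-∀ ring
            l₃ : ∀ i g z → 2ℚ * i * (g * z * (g * z)) ≡ 2ℚ * (z * z) * i * (g * g)
            l₃ = solve-∀ ring

        2≤b : 2ℚ * iDℚ ≤ bℚ
        2≤b = ≤-of-diff (l z iDℚ) (*≥0 (*≥0 0≤2 iD≥0) (+≥0 (*≥0 z≥0 (diff≥0 1≤z)) (diff≥0 1≤z)))
          where
          opaque
            unfolding _+_
            l : ∀ z i → 2ℚ * (z * z) * i - 2ℚ * i ≡ 2ℚ * i * (z * (z - 1ℚ) + (z - 1ℚ))
            l = solve-∀ ring

        D≤q : (1ℚ + e) * dℚ ≤ ⌜ D ℕ.+ g ⌝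
        D≤q = ≤-trans (≤-of-diff (l dℚ e G) (diff≥0 (<⇒≤ (proj₂ (proj₂ g-floor))))) (≤-reflexive (≡-sym (⌜⌝-+ D g)))
          where
          opaque
            unfolding _+_
            l : ∀ d e g → d + g - (1ℚ + e) * d ≡ g - d * e
            l = solve-∀ ring

        -- By G ≥ D / Z the left side is at most Z² / D, and Z³ ≤ h ≤ D.
        dG²≤e : dℚ * (inv G * inv G) ≤ e
        dG²≤e = begin
          dℚ * (inv G * inv G)  ≤⟨ *-monoˡ d≥0 (*-mono (*≥0 z≥0 iD≥0) (inv≥0 G>0) iG≤ iG≤) ⟩
          dℚ * (z * iDℚ * (z * iDℚ))  ≡⟨ l₁ dℚ z iDℚ ⟩
          z * z * (dℚ * iDℚ) * iDℚ  ≡⟨ cong (λ x → z * z * x * iDℚ) (inv-*ʳ d>0) ⟩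
          z * z * 1ℚ * iDℚ  ≤⟨ inv-≤ d>0 (≤-trans (≤-reflexive zz) (*-monoˡ e≥0 z³≤d)) ⟩
          e                                 ∎
          where
          open ≤-Reasoning
          opaque
            unfolding _+_
            l₁ : ∀ d z i → d * (z * i * (z * i)) ≡ z * z * (d * i) * i
            l₁ = solve-∀ ring
            l₂ : ∀ z e → e * (z * (z * z)) ≡ z * z * (z * e)
            l₂ = solve-∀ ring
          zz : z * z * 1ℚ ≡ e * (z * (z * z))
          zz = ≡-sym (trans (l₂ z e) (cong (z * z *_) ze))
          iG≤ : inv G ≤ z * iDℚ
          iG≤ = subst (_≤ z * iDℚ) (*-identityˡ (inv G)) (inv-≤ G>0 (subst (_≤ z * iDℚ * G) (inv-*ʳ d>0)
            (≤-trans (*-monoʳ iD≥0 d≤Gz) (≤-reflexive (l₃ G z iDℚ)))))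
            where
            opaque
              unfolding _+_
              l₃ : ∀ g z i → g * z * i ≡ z * i * g
              l₃ = solve-∀ ring

        loss≤ρ : e + (1ℚ - e) ^ Z + dℚ * (inv G * inv G) ≤ ρ
        loss≤ρ = ≤-trans (+-mono-≤ ≤-refl dG²≤e) (≤-reflexive (l s₀ e))
          where
          opaque
            unfolding _+_
            l : ∀ s e → e + s + e ≡ s + 2ℚ * e
            l = solve-∀ ring

        conditions : Conditions
        conditions = record
          { D>0 = d>0 ; 1≤g = 1≤G ; R′>0 = ℕP.≤-trans (ℕ.s≤s ℕ.z≤n) (ℕ.s≤s⁻¹ 12≤Z) ; q≤b = q≤b ; 2≤b = 2≤b
          ; kb≤1 = kb≤1 D k 1≤k kh≤D D≤ ; ε≥0 = e≥0 ; D≤q = D≤q ; ρ≥0 = ρ≥0 ; ρ≤1 = ρ≤1 ; σ≥0 = σ≥0 ; loss≤ρ = loss≤ρ }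

        -- The gap σ - ρ = e is chosen so that losses decay at least as fast as pairs: (1 + ρ) / (1
        -- + σ) ≤ 2 / (2 + e), because 2 (1 + σ) - (1 + ρ) (2 + e) = e (1 - ρ).
        loss-init : (1ℚ + ρ) ^ k * (inv (1ℚ + σ) ^ k * Grℚ ^ D) ≤ τℚ
        loss-init = begin
          (1ℚ + ρ) ^ k * (inv (1ℚ + σ) ^ k * Grℚ ^ D)  ≡⟨ *-assoc _ _ (Grℚ ^ D) ⟨
          (1ℚ + ρ) ^ k * inv (1ℚ + σ) ^ k * Grℚ ^ D  ≡⟨ cong (_* Grℚ ^ D) (^-*-distrib (1ℚ + ρ) (inv (1ℚ + σ)) k) ⟨
          ((1ℚ + ρ) * inv (1ℚ + σ)) ^ k * Grℚ ^ D  ≤⟨ *-mono (^≥0 k (*≥0 0≤2 (inv≥0 2+e>0))) (^≥0 D (≤-trans 0≤1 Gr≥1ℚ))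
                                                                        (^-mono k (*≥0 (+≥0 0≤1 ρ≥0) (inv≥0 1+σ>0)) ratio) (^-monoʳ Gr≥1ℚ (ℕP.m≤m+n D D)) ⟩
          ((1ℚ + 1ℚ) * inv (2ℚ + e)) ^ k * Grℚ ^ (D ℕ.+ D)  ≡⟨ cong (_* Grℚ ^ (D ℕ.+ D)) (^-*-distrib (1ℚ + 1ℚ) (inv (2ℚ + e)) k) ⟩
          (1ℚ + 1ℚ) ^ k * inv (2ℚ + e) ^ k * Grℚ ^ (D ℕ.+ D)  ≡⟨ *-assoc _ _ (Grℚ ^ (D ℕ.+ D)) ⟩
          τℚ                                                       ∎
          where
          open ≤-Reasoning
          2+e>0 : 0ℚ < 2ℚ + e
          2+e>0 = +>0 (+>0 0<1 0≤1) e≥0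
          1+σ>0 : 0ℚ < 1ℚ + σ
          1+σ>0 = +>0 0<1 σ≥0
          opaque
            unfolding _+_
            l : ∀ s e → 2ℚ * (1ℚ + (s + ⌜ 3 ⌝ * e)) - (1ℚ + (s + 2ℚ * e)) * (2ℚ + e) ≡ e * (1ℚ - (s + 2ℚ * e))
            l = solve-∀ ring
            l₁ : ∀ i s → 2ℚ * i * s ≡ 2ℚ * s * i
            l₁ = solve-∀ ring
          ratio : (1ℚ + ρ) * inv (1ℚ + σ) ≤ (1ℚ + 1ℚ) * inv (2ℚ + e)
          ratio = inv-≤ 1+σ>0 (≤-trans (≤-inv 2+e>0 (≤-of-diff (l s₀ e) (*≥0 e≥0 (diff≥0 ρ≤1)))) (≤-reflexive (l₁ (1ℚ + σ) (inv (2ℚ + e)))))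

        phaseConditions : PhaseConditions
        phaseConditions = record
          { conditions = conditions ; σD<T+1 = proj₂ (proj₂ T-floor) ; pair-init = ≤-refl ; loss-init = loss-init
          ; budget = budget D k 1≤k kh≤D D≤ n M≤k }

      phaseStrategy : Σ ℕ λ T → Σ ℕ λ g → Strategy n D T (D ℕ.+ g) × ⌜ T ⌝ ≤ σ * ⌜ D ⌝ × ⌜ g ⌝ ≤ 2ℚ * ⌜ D ⌝ * e
      phaseStrategy = T , g , phase phaseConditions , proj₁ (proj₂ T-floor) , G≤

  -- Comparison with e

  -- The mean value bound for x ↦ x^(m + 1), whose derivative on [t, s] is largest at `s`.
  power-difference : ∀ m {s t} → 0ℚ ≤ t → t ≤ s → s ^ suc m - t ^ suc m ≤ ⌜ suc m ⌝ * (s - t) * s ^ m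
  power-difference zero {s} {t} _ _ = ≤-reflexive (l s t)
    where
    opaque
      unfolding _+_
      l : ∀ s t → s * 1ℚ - t * 1ℚ ≡ (1ℚ + 0ℚ) * (s - t) * 1ℚ
      l = solve-∀ ring
  power-difference (suc m) {s} {t} t≥0 t≤s = ≤-trans (≤-of-diff (l₁ s t (s ^ suc m) (t ^ suc m)) (*≥0 (diff≥0 t≤s) (diff≥0 (^-mono (suc m) t≥0 t≤s))))
    (≤-trans (+-mono-≤ (*-monoˡ (≤-trans t≥0 t≤s) (power-difference m t≥0 t≤s)) ≤-refl) (≤-reflexive (l₂ s t ⌜ m ⌝ (s ^ m))))
    where
    opaque
      unfolding _+_
      l₁ : ∀ s t p r → s * (p - r) + (s - t) * p - (s * p - t * r) ≡ (s - t) * (p - r)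
      l₁ = solve-∀ ring
      l₂ : ∀ s t m p → s * ((1ℚ + m) * (s - t) * p) + (s - t) * (s * p) ≡ (1ℚ + (1ℚ + m)) * (s - t) * (s * p)
      l₂ = solve-∀ ring

  invFactorial : ℕ → ℚ
  invFactorial N = inv ⌜ N ℕ.! ⌝

  !>0 : ∀ N → 0ℚ < ⌜ N ℕ.! ⌝
  !>0 N = ⌜⌝-mono-< {0} (ℕP.1≤n! N)

  invFactorial-suc : ∀ N → ⌜ suc N ⌝ * invFactorial (suc N) ≡ invFactorial N
  invFactorial-suc N = begin-equality
    ⌜ suc N ⌝ * i′  ≡⟨ *-identityʳ _ ⟨
    ⌜ suc N ⌝ * i′ * 1ℚ  ≡⟨ cong (⌜ suc N ⌝ * i′ *_) (inv-*ʳ (!>0 N)) ⟨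
    ⌜ suc N ⌝ * i′ * (⌜ N ℕ.! ⌝ * invFactorial N) ≡⟨ l ⌜ suc N ⌝ i′ ⌜ N ℕ.! ⌝ (invFactorial N) ⟩
    ⌜ suc N ⌝ * ⌜ N ℕ.! ⌝ * i′ * invFactorial N  ≡⟨ cong (λ x → x * i′ * invFactorial N) (⌜⌝-* (suc N) (N ℕ.!)) ⟨
    ⌜ suc N ℕ.! ⌝ * i′ * invFactorial N  ≡⟨ cong (_* invFactorial N) (inv-*ʳ (!>0 (suc N))) ⟩
    1ℚ * invFactorial N  ≡⟨ *-identityˡ _ ⟩
    invFactorial N                                ∎
    where
    open ≤-Reasoning
    i′ = invFactorial (suc N)
    opaque
      unfolding _+_
      l : ∀ a b c d → a * b * (c * d) ≡ a * c * b * d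
      l = solve-∀ ring

  expSum : ℕ → ℚ → ℚ
  expSum zero t = 1ℚ
  expSum (suc N) t = expSum N t + t ^ suc N * invFactorial (suc N)

  expSum-0 : ∀ N → expSum N 0ℚ ≡ 1ℚ
  expSum-0 zero = refl
  expSum-0 (suc N) = trans (cong₂ _+_ (expSum-0 N) (l (0ℚ ^ N) (invFactorial (suc N)))) (+-identityʳ 1ℚ)
    where
    opaque
      unfolding _+_
      l : ∀ x i → 0ℚ * x * i ≡ 0ℚ
      l = solve-∀ ring

  expSum≥1 : ∀ N {t} → 0ℚ ≤ t → 1ℚ ≤ expSum N t
  expSum≥1 zero _ = ≤-refl
  expSum≥1 (suc N) {t} h = ≤-trans (expSum≥1 N h) (x≤x+y (*≥0 (^≥0 (suc N) h) (inv≥0 (!>0 (suc N)))))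

  -- expSum N is the derivative of expSum (N + 1), and the derivative is increasing.
  expSum-difference : ∀ N {t y} → 0ℚ ≤ t → 0ℚ ≤ y → expSum (suc N) (t + y) - expSum (suc N) t ≤ y * expSum N (t + y)
  expSum-difference N {t} {y} t≥0 y≥0 = go N
    where
    s = t + y
    t≤s : t ≤ s
    t≤s = x≤x+y y≥0
    term : ∀ N → (s ^ suc N - t ^ suc N) * invFactorial (suc N) ≤ y * (s ^ N * invFactorial N)
    term N = ≤-trans (*-monoʳ (inv≥0 (!>0 (suc N))) (power-difference N t≥0 t≤s))
      (≤-reflexive (trans (l ⌜ suc N ⌝ t y (s ^ N) (invFactorial (suc N))) (cong (λ x → y * (s ^ N * x)) (invFactorial-suc N))))
      where
      opaque
        unfolding _+_
        l : ∀ m t y p i → m * (t + y - t) * p * i ≡ y * (p * (m * i))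
        l = solve-∀ ring
    go : ∀ N → expSum (suc N) s - expSum (suc N) t ≤ y * expSum N s
    go zero = ≤-trans (≤-reflexive (l s t (invFactorial 1))) (≤-trans (term 0) (*-monoˡ y≥0 (≤-reflexive (trans (*-identityˡ _) inv1))))
      where
      opaque
        unfolding _+_
        l : ∀ s t i → 1ℚ + s * 1ℚ * i - (1ℚ + t * 1ℚ * i) ≡ (s * 1ℚ - t * 1ℚ) * i
        l = solve-∀ ring
      inv1 : invFactorial 0 ≡ 1ℚ
      inv1 = trans (≡-sym (*-identityˡ _)) (trans (cong (_* invFactorial 0) (≡-sym (+-identityʳ 1ℚ))) (inv-*ʳ (!>0 0)))
    go (suc N) = ≤-trans (≤-reflexive (l (expSum (suc N) s) (expSum (suc N) t) (s ^ suc (suc N)) (t ^ suc (suc N)) (invFactorial (suc (suc N)))))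
      (≤-trans (+-mono-≤ (go N) (term (suc N))) (≤-reflexive (≡-sym (distribˡ y _ _))))
      where
      opaque
        unfolding _+_
        l : ∀ a b p r i → a + p * i - (b + r * i) ≡ a - b + (p - r) * i
        l = solve-∀ ring

  -- The increment of the partial sum over a step `y` is at most `y` times its value at the right
  -- end.
  expSum-step : ∀ N {t y} → 0ℚ ≤ t → 0ℚ ≤ y → (1ℚ - y) * expSum N (t + y) ≤ expSum N t
  expSum-step zero {t} {y} _ y≥0 = ≤-trans (≤-reflexive (*-identityʳ _)) (1-x≤1 y≥0)
  expSum-step (suc N) {t} {y} t≥0 y≥0 = ≤-of-diff (l y (expSum N (t + y)) _ (expSum (suc N) t))
    (+≥0 (diff≥0 (expSum-difference N t≥0 y≥0)) (*≥0 y≥0 (*≥0 (^≥0 (suc N) (+≥0 t≥0 y≥0)) (inv≥0 (!>0 (suc N))))))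
    where
    opaque
      unfolding _+_
      l : ∀ y a b c → c - (1ℚ - y) * (a + b) ≡ y * a - (a + b - c) + y * b
      l = solve-∀ ring

  -- `j` steps of `expSum-step` lead from j y down to 0. With y = 1 / Z and j = Z this shows that (1
  -- - 1/Z)^Z is at most the reciprocal of every partial sum of e.
  expSum-bound : ∀ N j {y} → 0ℚ ≤ y → y ≤ 1ℚ → (1ℚ - y) ^ j * expSum N (⌜ j ⌝ * y) ≤ 1ℚ
  expSum-bound N zero {y} _ _ = ≤-reflexive (trans (*-identityˡ _) (trans (cong (expSum N) (zeroˡ y)) (expSum-0 N)))
  expSum-bound N (suc j) {y} y≥0 y≤1 = ≤-trans (≤-reflexive (trans (cong ((1ℚ - y) * (1ℚ - y) ^ j *_) (cong (expSum N) (l₁ ⌜ j ⌝ y)))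
      (l₂ (1ℚ - y) ((1ℚ - y) ^ j) _)))
    (≤-trans (*-monoˡ (^≥0 j (diff≥0 y≤1)) (expSum-step N (*≥0 (⌜⌝≥0 j) y≥0) y≥0)) (expSum-bound N j y≥0 y≤1))
    where
    opaque
      unfolding _+_
      l₁ : ∀ j y → (1ℚ + j) * y ≡ j * y + y
      l₁ = solve-∀ ring
      l₂ : ∀ a b c → a * b * c ≡ b * (a * c)
      l₂ = solve-∀ ring

  opaque
    unfolding _+_

    reciprocal : ∀ m .{{nz : ℕ.NonZero m}} → (ℤ.+ 1) ℚ./ m ≡ inv ⌜ m ⌝
    reciprocal (suc m) = ≡-sym (trans (≡-sym (*-identityˡ (inv ⌜ suc m ⌝))) (trans (cong (_* inv ⌜ suc m ⌝) (≡-sym times))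
        (trans (*-assoc r ⌜ suc m ⌝ (inv ⌜ suc m ⌝)) (trans (cong (r *_) (inv-*ʳ (⌜⌝-mono-< {0} {suc m} (ℕ.s≤s ℕ.z≤n)))) (*-identityʳ r)))))
      where
      r : ℚ
      r = (ℤ.+ 1) ℚ./ suc m
      times : r * ⌜ suc m ⌝ ≡ 1ℚ
      times = trans (cong (λ x → r * x) (≡-sym (toℚ≡⌜⌝ (suc m)))) (ℚP.toℚᵘ-injective {r ℚ.* toℚ (suc m)} {1ℚ} (ℚᵘP.≃-trans (ℚP.toℚᵘ-homo-* r (toℚ (suc m)))
        (ℚᵘP.≃-trans (ℚᵘP.*-cong (ℚP.toℚᵘ-fromℚᵘ (ℚᵘ.mkℚᵘ (ℤ.+ 1) m)) (ℚP.toℚᵘ-fromℚᵘ (ℚᵘ.mkℚᵘ (ℤ.+ suc m) 0)))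
          (ℚᵘ.*≡* {ℚᵘ.mkℚᵘ (ℤ.+ 1) m ℚᵘ.* ℚᵘ.mkℚᵘ (ℤ.+ suc m) 0} {ℚᵘ.1ℚᵘ} (cong ℤ.+_ (arith m))))))
        where
        arith : ∀ m → 1 ℕ.* suc m ℕ.* 1 ≡ 1 ℕ.* (suc m ℕ.* 1)
        arith m = ℕP.*-assoc 1 (suc m) 1

    eApprox≡expSum : ∀ N → eApprox N ≡ expSum N 1ℚ
    eApprox≡expSum zero = refl
    eApprox≡expSum (suc N) = cong₂ ℚ._+_ (eApprox≡expSum N) (trans (reciprocal (suc N ℕ.!) {{suc N ℕP.!≢0}})
      (≡-sym (trans (cong (_* inv ⌜ suc N ℕ.! ⌝) (1^ (suc N))) (*-identityˡ (inv ⌜ suc N ℕ.! ⌝)))))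

    archimedean : ∀ ε → 0ℚ < ε → Σ ℕ λ m → 1ℚ ≤ ⌜ m ⌝ * ε
    archimedean ε@(mkℚ (ℤ.+ zero) _ _) h = ⊥-elim (ℤP.<-irrefl refl (ℚP.drop-*<* h))
    archimedean ε@(mkℚ ℤ.-[1+ _ ] _ _) h = ⊥-elim (<-irrefl (<-≤-trans h (ℚP.nonPositive⁻¹ ε)))
    -- The denominator of ε serves as the multiplier.
    archimedean ε@(mkℚ (ℤ.+ suc a) d-1 c) h = suc d-1 , subst (λ x → 1ℚ ℚ.≤ x ℚ.* ε) (toℚ≡⌜⌝ (suc d-1))
      (ℚP.toℚᵘ-cancel-≤ (ℚᵘP.≤-respʳ-≃ (ℚᵘP.≃-sym (ℚᵘP.≃-trans (ℚP.toℚᵘ-homo-* (toℚ (suc d-1)) ε)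
        (ℚᵘP.*-congʳ {ℚᵘ.mkℚᵘ (ℤ.+ suc a) d-1} (ℚP.toℚᵘ-fromℚᵘ (ℚᵘ.mkℚᵘ (ℤ.+ suc d-1) 0)))))
        (ℚᵘ.*≤* (ℤ.+≤+ (ineq (suc d-1) a)))))
      where
      ineq : ∀ m a → 1 ℕ.* (1 ℕ.* m) ℕ.≤ m ℕ.* suc a ℕ.* 1
      ineq m a = ℕP.≤-trans (ℕP.≤-reflexive (trans (ℕP.*-identityˡ _) (ℕP.*-identityˡ m)))
        (ℕP.≤-trans (ℕP.m≤m*n m (suc a)) (ℕP.≤-reflexive (≡-sym (ℕP.*-identityʳ _))))

  -- Assembling the algorithm

  opaque
    -- Doubling `threshold Z L` and multiplying by Z gives 8 · `scale Z` · Z² · (2 L + 5), and 2 L +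
    -- 5 ≤ 7 L for L ≥ 1; hence 56 = 8 · 7.
    logFactor : ℕ → ℕ
    logFactor Z = 56 ℕ.* (scale Z ℕ.* (Z ℕ.* Z))

    threshold≤ : ∀ Z {L Δ} → 1 ℕ.≤ L → logFactor Z ℕ.* L ℕ.≤ Δ → 2 ℕ.* threshold Z L ℕ.* Z ℕ.≤ Δ
    threshold≤ Z {L} 1≤L h = ℕP.≤-trans (ℕP.≤-trans (ℕP.≤-reflexive (trans (cong (λ x → 2 ℕ.* x ℕ.* Z) (threshold-def Z L)) (l₁ (scale Z) Z (2 ℕ.* L ℕ.+ 5))))
      (ℕP.≤-trans (ℕP.*-monoʳ-≤ (8 ℕ.* (scale Z ℕ.* (Z ℕ.* Z))) 2L+5≤7L) (ℕP.≤-reflexive (l₂ (scale Z) Z L)))) h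
      where
      l₁ : ∀ s Z m → 2 ℕ.* (s ℕ.* (4 ℕ.* Z ℕ.* m)) ℕ.* Z ≡ 8 ℕ.* (s ℕ.* (Z ℕ.* Z)) ℕ.* m
      l₁ = NatSolver.solve-∀
      l₂ : ∀ s Z L → 8 ℕ.* (s ℕ.* (Z ℕ.* Z)) ℕ.* (7 ℕ.* L) ≡ 56 ℕ.* (s ℕ.* (Z ℕ.* Z)) ℕ.* L
      l₂ = NatSolver.solve-∀
      l₃ : ∀ L → 2 ℕ.* L ℕ.+ 5 ℕ.* L ≡ 7 ℕ.* L
      l₃ = NatSolver.solve-∀
      2L+5≤7L : 2 ℕ.* L ℕ.+ 5 ℕ.≤ 7 ℕ.* L
      2L+5≤7L = ℕP.≤-trans (ℕP.+-monoʳ-≤ (2 ℕ.* L) (ℕP.*-monoʳ-≤ 5 1≤L)) (ℕP.≤-reflexive (l₃ L))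

  module Complete (R′ : ℕ) (12≤Z : 12 ℕ.≤ suc R′) where
    open Parameters R′ 12≤Z public
    open Instance R′ 12≤Z

    u = 1ℚ - s₀
    A = inv u + ⌜ 32 ⌝ * e

    private
      2u≥1 : 1ℚ ≤ 2ℚ * u
      2u≥1 = ≤-of-diff (l s₀) (diff≥0 2s₀≤1)
        where
        opaque
          unfolding _+_
          l : ∀ s → 2ℚ * (1ℚ - s) - 1ℚ ≡ 1ℚ - 2ℚ * s
          l = solve-∀ ring

    u>0 : 0ℚ < u
    u>0 = ≰⇒> λ p → <⇒≱′ 0<1 (≤-trans 2u≥1 (subst (2ℚ * u ≤_) (zeroʳ 2ℚ) (*-monoˡ 0≤2 p)))

    private
      A≥0 : 0ℚ ≤ A
      A≥0 = +≥0 (inv≥0 u>0) (*≥0 (⌜⌝≥0 32) e≥0)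

      -- A phase spends at most (1 + 2 e) D colours and leaves degree σ D, so `A` must absorb this
      -- geometric series. The constant 32 results from 1 / u ≤ 2, u ≥ 1/2 and 12 e ≤ 1: A (1 - σ) ≥
      -- 1 - 6 e + 16 e - 8 e.
      A-recursion : 1ℚ + 2ℚ * e + A * σ ≤ A
      A-recursion = ≤-of-diff (trans (l₁ (inv u) s₀ e) (trans (cong (λ x → x - 1ℚ - 2ℚ * e - ⌜ 3 ⌝ * e * inv u + ⌜ 32 ⌝ * e * u - ⌜ 96 ⌝ * (e * e)) (inv-*ˡ u>0)) (l₂ (inv u) s₀ e)))
        (+≥0 (+≥0 (*≥0 (*≥0 (⌜⌝≥0 3) e≥0) (diff≥0 iu≤2)) (*≥0 (*≥0 (⌜⌝≥0 16) e≥0) (diff≥0 2u≥1))) (*≥0 (*≥0 (⌜⌝≥0 8) e≥0) (diff≥0 e≤1/12)))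
        where
        iu≤2 : inv u ≤ 2ℚ
        iu≤2 = subst (_≤ 2ℚ) (*-identityˡ (inv u)) (inv-≤ u>0 2u≥1)
        opaque
          unfolding _+_
          l₁ : ∀ i s e → i + ⌜ 32 ⌝ * e - (1ℚ + 2ℚ * e + (i + ⌜ 32 ⌝ * e) * (s + ⌜ 3 ⌝ * e)) ≡
                   i * (1ℚ - s) - 1ℚ - 2ℚ * e - ⌜ 3 ⌝ * e * i + ⌜ 32 ⌝ * e * (1ℚ - s) - ⌜ 96 ⌝ * (e * e)
          l₁ = solve-∀ ring
          l₂ : ∀ i s e → 1ℚ - 1ℚ - 2ℚ * e - ⌜ 3 ⌝ * e * i + ⌜ 32 ⌝ * e * (1ℚ - s) - ⌜ 96 ⌝ * (e * e) ≡
                   ⌜ 3 ⌝ * e * (2ℚ - i) + ⌜ 16 ⌝ * e * (2ℚ * (1ℚ - s) - 1ℚ) + ⌜ 8 ⌝ * e * (1ℚ - ⌜ 12 ⌝ * e)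
          l₂ = solve-∀ ring

    module _ (n : ℕ) where
      private
        B = threshold Z ⌊log₂ n ⌋

        small : ∀ {D} → D ℕ.≤ B → ⌜ D ℕ.+ D ⌝ ≤ A * ⌜ D ⌝ + 2ℚ * ⌜ B ⌝
        small {D} D≤B = ≤-trans (≤-reflexive (⌜⌝-+ D D)) (≤-of-diff (l ⌜ D ⌝ (A * ⌜ D ⌝) ⌜ B ⌝)
          (+≥0 (*≥0 A≥0 (⌜⌝≥0 D)) (*≥0 0≤2 (diff≥0 (⌜⌝-mono D≤B)))))
          where
          opaque
            unfolding _+_
            l : ∀ d a b → a + 2ℚ * b - (d + d) ≡ a + 2ℚ * (b - d)
            l = solve-∀ ring

      -- The degree drops strictly in each phase because σ < 1. The final greedy phase is paid for
      -- once, by the additive term that the recursion passes along unchanged.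
      complete : ∀ fuel D → D ℕ.≤ fuel → Σ ℕ λ K → Strategy n D 0 K × ⌜ K ⌝ ≤ A * ⌜ D ⌝ + 2ℚ * ⌜ B ⌝
      complete zero D D≤ = D ℕ.+ D , greedy D , small (ℕP.≤-trans D≤ ℕ.z≤n)
      complete (suc fuel) D D≤ with B ℕ.≤? D
      ... | no B≰D = D ℕ.+ D , greedy D , small (ℕP.<⇒≤ (ℕP.≰⇒> B≰D))
      ... | yes B≤D = recurse (D ℕ.≟ 0)
        where
        recurse : Dec (D ≡ 0) → Σ ℕ λ K → Strategy n D 0 K × ⌜ K ⌝ ≤ A * ⌜ D ⌝ + 2ℚ * ⌜ B ⌝
        recurse (yes refl) = 0 , greedy 0 , small {0} ℕ.z≤n
        recurse (no D≢0) =
          let T , g , s , T≤ , g≤ = phaseStrategy n D B≤D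
              K , s′ , K≤ = complete fuel T (T≤fuel T T≤)
          in D ℕ.+ g ℕ.+ K , compose s s′ , bound T g K T≤ g≤ K≤
          where
          T≤fuel : ∀ T → ⌜ T ⌝ ≤ σ * ⌜ D ⌝ → T ℕ.≤ fuel
          T≤fuel T h = ℕ.s≤s⁻¹ (ℕP.<-≤-trans (⌜⌝-cancel-< (≤-<-trans h (subst₂ _<_ (*-comm ⌜ D ⌝ σ) (*-identityʳ ⌜ D ⌝)
            (*-monoˡ-< (⌜⌝-mono-< {0} (ℕP.n≢0⇒n>0 D≢0)) σ<1)))) D≤)
          bound : ∀ T g K → ⌜ T ⌝ ≤ σ * ⌜ D ⌝ → ⌜ g ⌝ ≤ 2ℚ * ⌜ D ⌝ * e → ⌜ K ⌝ ≤ A * ⌜ T ⌝ + 2ℚ * ⌜ B ⌝ →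
            ⌜ D ℕ.+ g ℕ.+ K ⌝ ≤ A * ⌜ D ⌝ + 2ℚ * ⌜ B ⌝
          bound T g K T≤ g≤ K≤ = begin
            ⌜ D ℕ.+ g ℕ.+ K ⌝  ≡⟨ trans (⌜⌝-+ (D ℕ.+ g) K) (cong (_+ ⌜ K ⌝) (⌜⌝-+ D g)) ⟩
            ⌜ D ⌝ + ⌜ g ⌝ + ⌜ K ⌝  ≤⟨ +-mono-≤ (+-mono-≤ ≤-refl g≤) (≤-trans K≤ (+-mono-≤ (*-monoˡ A≥0 T≤) ≤-refl)) ⟩
            ⌜ D ⌝ + 2ℚ * ⌜ D ⌝ * e + (A * (σ * ⌜ D ⌝) + 2ℚ * ⌜ B ⌝)  ≡⟨ l ⌜ D ⌝ e A σ (2ℚ * ⌜ B ⌝) ⟩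
            (1ℚ + 2ℚ * e + A * σ) * ⌜ D ⌝ + 2ℚ * ⌜ B ⌝  ≤⟨ +-mono-≤ (*-monoʳ (⌜⌝≥0 D) A-recursion) ≤-refl ⟩
            A * ⌜ D ⌝ + 2ℚ * ⌜ B ⌝                                               ∎
            where
            open ≤-Reasoning
            opaque
              unfolding _+_
              l : ∀ d e a s b → d + 2ℚ * d * e + (a * (s * d) + b) ≡ (1ℚ + 2ℚ * e + a * s) * d + b
              l = solve-∀ ring

      solution : ∀ Δ → Σ ℕ λ K → Strategy n Δ 0 K × ⌜ K ⌝ ≤ A * ⌜ Δ ⌝ + 2ℚ * ⌜ B ⌝
      solution Δ = complete Δ Δ ℕP.≤-refl

      -- The additive cost of the greedy phase is at most e Δ, which turns the 32 of `A` into 33.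
      colours≤ : ∀ {Δ K} → 1 ℕ.≤ ⌊log₂ n ⌋ → logFactor Z ℕ.* ⌊log₂ n ⌋ ℕ.≤ Δ → ⌜ K ⌝ ≤ A * ⌜ Δ ⌝ + 2ℚ * ⌜ B ⌝ →
        ⌜ K ⌝ ≤ (inv u + ⌜ 33 ⌝ * e) * ⌜ Δ ⌝
      colours≤ {Δ} 1≤L h K≤ = ≤-trans K≤ (≤-of-diff (l (inv u) e ⌜ Δ ⌝ ⌜ B ⌝) (diff≥0 (≤-trans
          (≤-inv z>0 (subst (_≤ ⌜ Δ ⌝) eq (⌜⌝-mono (threshold≤ Z 1≤L h)))) (≤-reflexive (*-comm ⌜ Δ ⌝ e)))))
        where
        opaque
          unfolding _+_
          l : ∀ i e d b → (i + ⌜ 33 ⌝ * e) * d - ((i + ⌜ 32 ⌝ * e) * d + 2ℚ * b) ≡ e * d - 2ℚ * b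
          l = solve-∀ ring
          l₁ : ∀ b → (1ℚ + (1ℚ + 0ℚ)) * b ≡ 2ℚ * b
          l₁ = solve-∀ ring
        eq : ⌜ 2 ℕ.* B ℕ.* Z ⌝ ≡ 2ℚ * ⌜ B ⌝ * z
        eq = trans (⌜⌝-* (2 ℕ.* B) Z) (cong (_* z) (trans (⌜⌝-* 2 B) (l₁ ⌜ B ⌝)))

    es₀≤1 : ∀ N → eApprox N * s₀ ≤ 1ℚ
    es₀≤1 N = subst (_≤ 1ℚ) (trans (cong ((1ℚ - e) ^ Z *_) (trans (cong (expSum N) ze) (≡-sym (eApprox≡expSum N)))) (*-comm s₀ (eApprox N)))
      (expSum-bound N Z e≥0 e≤1)

    eApprox≥1 : ∀ N → 1ℚ ≤ eApprox N
    eApprox≥1 N = subst (1ℚ ≤_) (≡-sym (eApprox≡expSum N)) (expSum≥1 N 0≤1)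

    -- For each partial sum x of e, x s₀ ≤ 1 gives x - 1 ≤ x u. Thus the bound K - ε Δ ≤ Δ / u
    -- yields the claim for every N without passing to a limit.
    e-bound : ∀ {K Δ ε} → ⌜ K ⌝ ≤ (inv u + ⌜ 33 ⌝ * e) * ⌜ Δ ⌝ → ⌜ 33 ⌝ * e ≤ ε → ∀ N →
      (⌜ K ⌝ - ε * ⌜ Δ ⌝) * (eApprox N - 1ℚ) ≤ eApprox N * ⌜ Δ ⌝
    e-bound {K} {Δ} {ε} K≤ ε≥ N = begin
      (⌜ K ⌝ - ε * ⌜ Δ ⌝) * (x - 1ℚ)  ≤⟨ *-monoʳ (diff≥0 (eApprox≥1 N)) (≤-of-diff (l₁ ⌜ K ⌝ ε ⌜ Δ ⌝ (inv u) e)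
                                              (+≥0 (diff≥0 K≤) (*≥0 (diff≥0 ε≥) (⌜⌝≥0 Δ)))) ⟩
      inv u * ⌜ Δ ⌝ * (x - 1ℚ)  ≤⟨ *-monoˡ (*≥0 (inv≥0 u>0) (⌜⌝≥0 Δ)) (≤-of-diff (l₂ x s₀) (diff≥0 (es₀≤1 N))) ⟩
      inv u * ⌜ Δ ⌝ * (x * u)  ≡⟨ l₃ (inv u) ⌜ Δ ⌝ x u ⟩
      inv u * u * (x * ⌜ Δ ⌝)  ≡⟨ trans (cong (_* (x * ⌜ Δ ⌝)) (inv-*ˡ u>0)) (*-identityˡ _) ⟩
      x * ⌜ Δ ⌝                         ∎
      where
      open ≤-Reasoning
      x = eApprox N
      opaque
        unfolding _+_
        l₁ : ∀ k ε d i e → i * d - (k - ε * d) ≡ (i + ⌜ 33 ⌝ * e) * d - k + (ε - ⌜ 33 ⌝ * e) * d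
        l₁ = solve-∀ ring
        l₂ : ∀ x s → x * (1ℚ - s) - (x - 1ℚ) ≡ 1ℚ - x * s
        l₂ = solve-∀ ring
        l₃ : ∀ i d x u → i * d * (x * u) ≡ i * u * (x * d)
        l₃ = solve-∀ ring

    -- Since e ≥ 5/2, the ratio 1 / u is at most 5/3.
    two-bound : ∀ {K Δ} → ⌜ K ⌝ ≤ (inv u + ⌜ 33 ⌝ * e) * ⌜ Δ ⌝ → ⌜ 198 ⌝ * e ≤ 1ℚ → ⌜ 6 ⌝ * ⌜ K ⌝ ≤ ⌜ 11 ⌝ * ⌜ Δ ⌝
    two-bound {K} {Δ} K≤ e≤ = ≤-trans (*-monoˡ (⌜⌝≥0 6) K≤) (≤-of-diff (l (inv u) e ⌜ Δ ⌝)
        (*≥0 (+≥0 (*≥0 0≤2 (diff≥0 3iu≤5)) (diff≥0 e≤)) (⌜⌝≥0 Δ)))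
      where
      opaque
        unfolding _+_
        l : ∀ i e d → ⌜ 11 ⌝ * d - ⌜ 6 ⌝ * ((i + ⌜ 33 ⌝ * e) * d) ≡ (2ℚ * (⌜ 5 ⌝ - ⌜ 3 ⌝ * i) + (1ℚ - ⌜ 198 ⌝ * e)) * d
        l = solve-∀ ring
        e₂ : 2ℚ * eApprox 2 ≡ ⌜ 5 ⌝
        e₂ = solve-∀ ring
        l₁ : ∀ s x → ⌜ 5 ⌝ * (1ℚ - s) - ⌜ 3 ⌝ ≡ 2ℚ * (1ℚ - x * s) + (2ℚ * x - ⌜ 5 ⌝) * s
        l₁ = solve-∀ ring
      3≤5u : ⌜ 3 ⌝ ≤ ⌜ 5 ⌝ * u
      3≤5u = ≤-of-diff (l₁ s₀ (eApprox 2)) (+≥0 (*≥0 0≤2 (diff≥0 (es₀≤1 2))) (*≥0 (diff≥0 (≤-reflexive (≡-sym e₂))) s₀≥0))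
      3iu≤5 : ⌜ 3 ⌝ * inv u ≤ ⌜ 5 ⌝
      3iu≤5 = inv-≤ u>0 3≤5u

  -- Choice of the accuracy and the final algorithm

  Admissible : (n Δ Z : ℕ) → Set
  Admissible n Δ Z = 12 ℕ.≤ Z × logFactor Z ℕ.* ⌊log₂ n ⌋ ℕ.≤ Δ

  admissible? : ∀ n Δ Z → Dec (Admissible n Δ Z)
  admissible? n Δ Z = (12 ℕ.≤? Z) ×-dec (logFactor Z ℕ.* ⌊log₂ n ⌋ ℕ.≤? Δ)

  -- The algorithm is fixed before ε, so it takes the most accurate admissible Z. Every Z₀ demanded
  -- by some ε becomes admissible once n and Δ / log n are large, and the choice is then at least
  -- Z₀. Searching only up to n keeps the search finite.
  largest : ∀ n Δ → ℕ → Maybe (Σ ℕ (Admissible n Δ))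
  largest n Δ zero = nothing
  largest n Δ (suc Z) with admissible? n Δ (suc Z)
  ... | yes p = just (suc Z , p)
  ... | no _ = largest n Δ Z

  largest-≥ : ∀ n Δ m {Z₀} → Z₀ ℕ.≤ m → Admissible n Δ Z₀ →
    Σ (Σ ℕ (Admissible n Δ)) λ Z → Z₀ ℕ.≤ proj₁ Z × largest n Δ m ≡ just Z
  largest-≥ n Δ zero p (12≤Z₀ , _) with ℕP.≤-trans 12≤Z₀ p
  ... | ()
  largest-≥ n Δ (suc m) {Z₀} p a with admissible? n Δ (suc m)
  ... | yes q = (suc m , q) , p , refl
  ... | no ¬q = largest-≥ n Δ m (ℕ.s≤s⁻¹ (ℕP.≤∧≢⇒< p λ { refl → ¬q a })) a

  strategyFor : ∀ n Δ → (Z : Σ ℕ (Admissible n Δ)) → Σ ℕ (Strategy n Δ 0)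
  strategyFor n Δ (suc R′ , 12≤Z , _) = let K , s , _ = Complete.solution R′ 12≤Z n Δ in K , s

  colourWith : ∀ n Δ → Maybe (Σ ℕ (Admissible n Δ)) → List (Subset n) → Subset n → Fin n → ℕ
  colourWith n Δ nothing _ _ _ = 0
  colourWith n Δ (just Z) = Run.colourer (proj₂ (strategyFor n Δ Z))

  algorithm : OnlineAlg
  algorithm n Δ = colourWith n Δ (largest n Δ n)

  algorithm-guarantee : ∀ n Δ Z → largest n Δ n ≡ just Z → Guarantee algorithm n Δ (proj₁ (strategyFor n Δ Z))
  algorithm-guarantee n Δ Z eq ins md = Run.guarantee (proj₂ (strategyFor n Δ Z)) ins md (colour algorithm n Δ ins)
    λ t v → cong (λ m → colourWith n Δ m (history ins t) (lookup ins t) v) eq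

  module Outcome (n Δ Z₀ : ℕ) (2≤n : 2 ℕ.≤ n) (Z₀≤n : Z₀ ℕ.≤ n) (12≤Z₀ : 12 ℕ.≤ Z₀)
    (large : logFactor Z₀ ℕ.* ⌊log₂ n ⌋ ℕ.≤ Δ) where

    private
      1≤log : 1 ℕ.≤ ⌊log₂ n ⌋
      1≤log = subst (ℕ._≤ ⌊log₂ n ⌋) (⌊log₂[2^n]⌋≡n 1) (⌊log₂⌋-mono-≤ 2≤n)

      choice = largest-≥ n Δ n Z₀≤n (12≤Z₀ , large)

    K : ℕ
    K = proj₁ (strategyFor n Δ (proj₁ choice))

    guarantee : Guarantee algorithm n Δ K
    guarantee = algorithm-guarantee n Δ (proj₁ choice) (proj₂ (proj₂ choice))

    conclude : ∀ {P : ℕ → Set} → (∀ R′ (12≤Z : 12 ℕ.≤ suc R′) → Z₀ ℕ.≤ suc R′ → ∀ K →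
      ⌜ K ⌝ ≤ (inv (Complete.u R′ 12≤Z) + ⌜ 33 ⌝ * inv ⌜ suc R′ ⌝) * ⌜ Δ ⌝ → P K) → P K
    conclude {P} f = go (proj₁ choice) (proj₁ (proj₂ choice))
      where
      go : ∀ Z → Z₀ ℕ.≤ proj₁ Z → P (proj₁ (strategyFor n Δ Z))
      go (suc R′ , 12≤Z , h) Z₀≤Z = f R′ 12≤Z Z₀≤Z _
        (Complete.colours≤ R′ 12≤Z n {Δ} {proj₁ (Complete.solution R′ 12≤Z n Δ)} 1≤log h (proj₂ (proj₂ (Complete.solution R′ 12≤Z n Δ))))

  inv-small : ∀ c {Z₀ Z x} → 0ℚ < ⌜ Z ⌝ → Z₀ ℕ.≤ Z → c ≤ ⌜ Z₀ ⌝ * x → 0ℚ ≤ x → c * inv ⌜ Z ⌝ ≤ x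
  inv-small c {Z₀} {Z} {x} Z>0 p h x≥0 = inv-≤ Z>0 (≤-trans h (≤-trans (*-monoʳ x≥0 (⌜⌝-mono p)) (≤-reflexive (*-comm ⌜ Z ⌝ x))))

  opaque
    unfolding _+_

    ratio<2 : Σ ℚ λ δ → (0ℚ ℚ.< δ) × Σ ℕ λ c → Σ ℕ λ N → ∀ (n Δ : ℕ) → N ℕ.≤ n → c ℕ.* ⌊log₂ n ⌋ ℕ.≤ Δ →
      Σ ℕ λ K → (toℚ K ℚ.≤ (toℚ 2 ℚ.- δ) ℚ.* toℚ Δ) × Guarantee algorithm n Δ K
    -- 198 = 6 · 33 makes 33 / Z at most 1/6, so the ratio is at most 5/3 + 1/6 = 11/6 = 2 - δ.
    ratio<2 = δ , ℚ.*<* (ℤ.+<+ (ℕ.s≤s ℕ.z≤n)) , logFactor 198 , 198 , λ n Δ N≤n h →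
      let open Outcome n Δ 198 (ℕP.≤-trans (ℕ.s≤s (ℕ.s≤s ℕ.z≤n)) N≤n) N≤n (ℕP.m≤m+n 12 186) h
      in K , conclude {λ K → toℚ K ℚ.≤ (toℚ 2 ℚ.- δ) ℚ.* toℚ Δ} (bound Δ) , guarantee
      where
      δ : ℚ
      δ = (ℤ.+ 1) ℚ./ 6
      lem : ∀ d → ⌜ 6 ⌝ * ((toℚ 2 ℚ.- δ) * d) ≡ ⌜ 11 ⌝ * d
      lem d = ≡-sym (*-assoc ⌜ 6 ⌝ (toℚ 2 ℚ.- δ) d)
      bound : ∀ Δ R′ (12≤Z : 12 ℕ.≤ suc R′) → 198 ℕ.≤ suc R′ → ∀ K →
        ⌜ K ⌝ ≤ (inv (Complete.u R′ 12≤Z) + ⌜ 33 ⌝ * inv ⌜ suc R′ ⌝) * ⌜ Δ ⌝ → toℚ K ℚ.≤ (toℚ 2 ℚ.- δ) ℚ.* toℚ Δ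
      bound Δ R′ 12≤Z Z₀≤Z K h = subst₂ (λ a b → a ℚ.≤ (toℚ 2 ℚ.- δ) ℚ.* b) (≡-sym (toℚ≡⌜⌝ K)) (≡-sym (toℚ≡⌜⌝ Δ))
        (*-cancelˡ {⌜ K ⌝} {(toℚ 2 ℚ.- δ) * ⌜ Δ ⌝} {⌜ 6 ⌝} (⌜⌝-mono-< {0} {6} (ℕ.s≤s ℕ.z≤n))
          (subst (⌜ 6 ⌝ * ⌜ K ⌝ ≤_) (≡-sym (lem ⌜ Δ ⌝))
            (Complete.two-bound R′ 12≤Z {K} {Δ} h (inv-small ⌜ 198 ⌝ {198} {suc R′} (Complete.z>0 R′ 12≤Z) Z₀≤Z (≤-reflexive (≡-sym (*-identityʳ ⌜ 198 ⌝))) 0≤1))))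

    ratio-e : ∀ (ε : ℚ) → 0ℚ ℚ.< ε → Σ ℕ λ c → Σ ℕ λ N → ∀ (n Δ : ℕ) → N ℕ.≤ n → c ℕ.* ⌊log₂ n ⌋ ℕ.≤ Δ →
      Σ ℕ λ K → WithinEBound K Δ ε × Guarantee algorithm n Δ K
    ratio-e ε ε>0 = logFactor Z₀ , Z₀ , λ n Δ N≤n h →
      let open Outcome n Δ Z₀ (ℕP.≤-trans (ℕ.s≤s (ℕ.s≤s ℕ.z≤n)) (ℕP.≤-trans (ℕP.m≤m+n 12 (33 ℕ.* m)) N≤n)) N≤n (ℕP.m≤m+n 12 (33 ℕ.* m)) h
      in K , conclude {λ K → WithinEBound K Δ ε} (bound Δ) , guarantee
      where
      m Z₀ : ℕ
      m = proj₁ (archimedean ε ε>0)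
      -- With m ε ≥ 1, the summand 33 m makes 33 / Z at most ε for all Z ≥ Z₀; the summand 12
      -- secures admissibility.
      Z₀ = 12 ℕ.+ 33 ℕ.* m
      ε≥0 : 0ℚ ≤ ε
      ε≥0 = <⇒≤ ε>0
      33≤ : ⌜ 33 ⌝ ≤ ⌜ Z₀ ⌝ * ε
      33≤ = ≤-trans {⌜ 33 ⌝} {⌜ 33 ⌝ * (⌜ m ⌝ * ε)} {⌜ Z₀ ⌝ * ε}
        (subst (_≤ ⌜ 33 ⌝ * (⌜ m ⌝ * ε)) (*-identityʳ ⌜ 33 ⌝) (*-monoˡ {1ℚ} {⌜ m ⌝ * ε} {⌜ 33 ⌝} (⌜⌝≥0 33) (proj₂ (archimedean ε ε>0))))
        (subst (_≤ ⌜ Z₀ ⌝ * ε) (trans (cong (_* ε) (⌜⌝-* 33 m)) (*-assoc ⌜ 33 ⌝ ⌜ m ⌝ ε))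
          (*-monoʳ {⌜ 33 ℕ.* m ⌝} {⌜ Z₀ ⌝} {ε} ε≥0 (⌜⌝-mono (ℕP.m≤n+m (33 ℕ.* m) 12))))
      bound : ∀ Δ R′ (12≤Z : 12 ℕ.≤ suc R′) → Z₀ ℕ.≤ suc R′ → ∀ K →
        ⌜ K ⌝ ≤ (inv (Complete.u R′ 12≤Z) + ⌜ 33 ⌝ * inv ⌜ suc R′ ⌝) * ⌜ Δ ⌝ → WithinEBound K Δ ε
      bound Δ R′ 12≤Z Z₀≤Z K h N = subst₂ (λ a b → (a ℚ.- ε ℚ.* b) ℚ.* (eApprox N ℚ.- 1ℚ) ℚ.≤ eApprox N ℚ.* b)
        (≡-sym (toℚ≡⌜⌝ K)) (≡-sym (toℚ≡⌜⌝ Δ))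
        (Complete.e-bound R′ 12≤Z {K} {Δ} {ε} h (inv-small ⌜ 33 ⌝ {Z₀} {suc R′} {ε} (Complete.z>0 R′ 12≤Z) Z₀≤Z 33≤ ε≥0) N)

open import Data.Nat using (ℕ; _≤_; _*_)
open import Data.Nat.Logarithm using (⌊log₂_⌋)
open import Data.Rational using (ℚ; 0ℚ; _<_; _-_)
open import Data.Rational as ℚ using ()
open import Data.Integer using (+_)
open import Data.Product using (Σ; _×_; ∃; _,_)

theorem3p3 : Σ OnlineAlg λ alg →
    -- (1) ratio < 2 when Δ ≥ c·log n for a sufficiently large constant c
    (Σ ℚ λ δ → (0ℚ < δ) × Σ ℕ λ c → Σ ℕ λ N →
       ∀ (n Δ : ℕ) → N ≤ n → c * ⌊log₂ n ⌋ ≤ Δ →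
         Σ ℕ λ K → (toℚ K ℚ.≤ (toℚ 2 - δ) ℚ.* toℚ Δ) × Guarantee alg n Δ K)
    ×
    -- (2) ratio e/(e-1) + o(1) when Δ = ω(log n)
    (∀ (ε : ℚ) → 0ℚ < ε → Σ ℕ λ c → Σ ℕ λ N →
       ∀ (n Δ : ℕ) → N ≤ n → c * ⌊log₂ n ⌋ ≤ Δ →
         Σ ℕ λ K → WithinEBound K Δ ε × Guarantee alg n Δ K)
theorem3p3 = EdgeColouring.algorithm , EdgeColouring.ratio<2 , EdgeColouring.ratio-e
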